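{- Let $x$ be an even integer with $4\le x\le 12$. Then for every integer $v$ and every multiset $L$ of size $v-1$ with underlying set $\{1,2,x\}$, $L$ is realizable in $K_v$ if and only if $L$ is admissible.
   Context: $K_v$ is the complete graph on vertex set $\{0,1,\dots,v-1\}$, with edge length $\ell(p,q)=\min(|p-q|,v-|p-q|)$. A multiset $L$ is realizable in $K_v$ if some Hamiltonian path of $K_v$ has multiset of edge lengths exactly $L$. A multiset $L$ of size $v-1$ of positive integers is admissible if its largest element is at most $\lfloor v/2\rfloor$ and for every divisor $d$ of $v$ the number of elements of $L$ (with multiplicity) that are multiples of $d$ is at most $v-d$. The underlying set of a multiset is the set of its distinct elements. -}

module Defs where

open import Data.Nat using (ℕ; zero; suc; _∸_; _⊓_; ∣_-_∣; _≤_; _/_)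
open import Data.Nat.Divisibility using (_∣_; _∣?_)
open import Data.List using (List; []; _∷_; length; filter; upTo)
open import Data.List.Relation.Unary.All using (All)
open import Data.List.Relation.Binary.Permutation.Propositional using (_↭_)
open import Data.List.Membership.Propositional using (_∈_)
open import Data.Product using (Σ; _×_)
open import Data.Sum using (_⊎_)
open import Relation.Binary.PropositionalEquality using (_≡_)
open import Function.Bundles using (_⇔_)

-- A multiset of naturals is represented by a list, considered up to
-- permutation (_↭_).

edgeLen : ℕ → ℕ → ℕ → ℕ
edgeLen v p q = ∣ p - q ∣ ⊓ (v ∸ ∣ p - q ∣)

edgeLengths : ℕ → List ℕ → List ℕ
edgeLengths v []           = []
edgeLengths v (p ∷ [])     = []
edgeLengths v (p ∷ q ∷ ps) = edgeLen v p q ∷ edgeLengths v (q ∷ ps)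

IsHamPath : ℕ → List ℕ → Set
IsHamPath v ps = ps ↭ upTo v

Realizable : ℕ → List ℕ → Set
Realizable v L = Σ (List ℕ) (λ ps → IsHamPath v ps × edgeLengths v ps ↭ L)

countMultiples : ℕ → List ℕ → ℕ
countMultiples d L = length (filter (d ∣?_) L)

Admissible : ℕ → List ℕ → Set
Admissible v L =
  (length L ≡ v ∸ 1)
  × All (λ a → 1 ≤ a) L
  × All (λ a → a ≤ v / 2) L
  × ((d : ℕ) → d ∣ v → countMultiples d L ≤ v ∸ d)

UnderlyingSet12x : ℕ → List ℕ → Set
UnderlyingSet12x x L = (y : ℕ) → (y ∈ L) ⇔ (y ≡ 1 ⊎ y ≡ 2 ⊎ y ≡ x)

{-# OPTIONS --safe #-}

-- Write L = {1^a, 2^b, x^c}, so v = a + b + c + 1.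
--
-- Necessity of the divisor condition: if d divides v, an edge whose length is
-- a multiple of d stays in one residue class modulo d, and the path has to
-- visit all d classes.
--
-- Sufficiency: cut the vertices 0 .. v - 1 below m and open a gap of g new
-- vertices there. If each of the g vertices just below the cut is the lower
-- end of exactly one edge across it, then rerouting each such edge {p, q},
-- p < m ≤ q, as p, p + g, q + g visits every new vertex once and adds g edges
-- of length g. The new path can be grown at the same cut again, and at all
-- cuts below m where the old one could. Growing with g = 1, 2 and x turns a
-- single realization into an infinite family, and finitely many realizations,
-- found by computer, generate all admissible (a, b, c).
module Submission where

open import Defs
open import Data.Bool using (Bool; true; false)
import Data.Bool.Properties as Bool
open import Data.Fin using (toℕ)
open import Data.Fin.Properties using (injective⇒≤; toℕ<n; toℕ-injective)
open import Data.List using (List; []; _∷_; [_]; _++_; map; length; filter; lookup; replicate; applyUpTo; upTo)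
import Data.List.Properties as List
open import Data.List.Membership.Propositional using (_∈_)
open import Data.List.Membership.Propositional.Properties
  using (∈-map⁺; ∈-++⁺ˡ; ∈-++⁺ʳ; ∈-applyUpTo⁺; ∈-upTo⁺)
open import Data.List.Relation.Binary.Permutation.Propositional hiding (trans)
open import Data.List.Relation.Binary.Permutation.Propositional.Properties
open import Data.List.Relation.Unary.All as All using (All; []; _∷_)
import Data.List.Relation.Unary.All.Properties as All
open import Data.List.Relation.Unary.Any as Any using (Any; here; there)
open import Data.List.Relation.Unary.Any.Properties using (lookup-index)
open import Data.List.Relation.Unary.Linked as Linked using (Linked; []; [-]; _∷_)
open import Data.Nat
open import Data.Nat.Properties
open import Data.List.Membership.DecPropositional _≟_ using (_∈?_)
open import Data.Nat.Divisibility
  using (_∣_; _∣?_; divides; n∣m*n; ∣m∣n⇒∣m+n; ∣m+n∣m⇒∣n; ∣-trans; ∣⇒≤)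
open import Data.Nat.DivMod
  using (m≡m%n+[m/n]*n; m%n<n; m<n⇒m%n≡m; [m+kn]%n≡m%n; m/n*n≤m; m*n/n≡m; /-monoˡ-≤)
open import Data.Product using (Σ; ∃; ∃₂; _×_; _,_; proj₁; proj₂)
open import Data.Sum using (_⊎_; inj₁; inj₂; [_,_]′)
open import Function using (_∘_; id)
open import Function.Bundles using (_⇔_; mk⇔; Equivalence)
open import Relation.Binary.PropositionalEquality hiding ([_])
open import Relation.Nullary using (Dec; yes; no; ¬_; contradiction)
open import Relation.Nullary.Decidable as Dec using (_×-dec_; _⊎-dec_; ¬?; toWitness)

-- Necessity

-- The obstacle is that a cyclic length depends on `v`, which growing changes. Each edge is
-- therefore classified by comparing its linear length with the fixed bound `t = x`: short edges
-- keep their linear length, long ones are stretched together with `v`. The resulting length `len`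
-- is meaningful for small `v` too, and the finite check relies on this. There the multiplicities
-- are divided into single values and rays, which are residue classes modulo 1, 2 or `x` from a
-- threshold on. A ray in `a` or `b` has to be covered as a whole, although its first members may
-- have `v < 2x`, where `K_v` has no edge of length `x` at all. Rays in `a` and `b` lie where
-- `a + b + 1 ≥ x`. No divisor of `x` exceeds `a + b + 1` there, so the divisor condition can
-- obstruct only finitely many pairs `(a, b)`. In `c` an obstruction persists along a whole class
-- modulo `x`, because adding `x` edges of length `x` changes `v` by a multiple of every divisor of
-- `x`.

edgeLen-≤ : ∀ v p q → edgeLen v p q ≤ v / 2
edgeLen-≤ v p q = subst (_≤ v / 2) (m*n/n≡m e 2) (/-monoˡ-≤ 2 twice)
  where
  d = ∣ p - q ∣
  e = edgeLen v p q
  twice : e * 2 ≤ v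
  twice with d ≤? v
  ... | yes d≤v = begin
    e * 2       ≡⟨ trans (*-comm e 2) (cong (e +_) (+-identityʳ e)) ⟩
    e + e       ≤⟨ +-mono-≤ (m⊓n≤m d (v ∸ d)) (m⊓n≤n d (v ∸ d)) ⟩
    d + (v ∸ d) ≡⟨ m+[n∸m]≡n d≤v ⟩
    v           ∎
    where open ≤-Reasoning
  -- When `d` exceeds `v`, the truncated `v ∸ d` is 0, and so is the minimum.
  ... | no d≰v = subst (λ z → z * 2 ≤ v) (sym (trans (cong (d ⊓_) (m≤n⇒m∸n≡0 (<⇒≤ (≰⇒> d≰v)))) (⊓-zeroʳ d))) z≤n

edgeLengths-≤ : ∀ v ps → All (_≤ v / 2) (edgeLengths v ps)
edgeLengths-≤ v []           = []
edgeLengths-≤ v (p ∷ [])     = []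
edgeLengths-≤ v (p ∷ q ∷ ps) = edgeLen-≤ v p q ∷ edgeLengths-≤ v (q ∷ ps)

module _ (d v : ℕ) .{{_ : NonZero d}} (d∣v : d ∣ v) where

  ∣∸⇒%≡ : ∀ {p q} → p ≤ q → d ∣ q ∸ p → p % d ≡ q % d
  ∣∸⇒%≡ {p} {q} p≤q (divides k eq) = begin
    p % d             ≡⟨ [m+kn]%n≡m%n p k d ⟨
    (p + k * d) % d   ≡⟨ cong (λ z → (p + z) % d) eq ⟨
    (p + (q ∸ p)) % d ≡⟨ cong (_% d) (m+[n∸m]≡n p≤q) ⟩
    q % d             ∎
    where open ≡-Reasoning

  ∣diff⇒%≡ : ∀ p q → d ∣ ∣ p - q ∣ → p % d ≡ q % d
  ∣diff⇒%≡ p q h with ≤-total p q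
  ... | inj₁ p≤q = ∣∸⇒%≡ p≤q (subst (d ∣_) (m≤n⇒∣m-n∣≡n∸m p≤q) h)
  ... | inj₂ q≤p = sym (∣∸⇒%≡ q≤p (subst (d ∣_) (m≤n⇒∣n-m∣≡n∸m q≤p) h))

  -- Since `d` divides `v`, it divides `v - |p - q|` only if it divides `|p - q|`, so it does not
  -- matter which of the two the minimum selects. Both ends being below `v` keeps the subtraction
  -- from truncating.
  ∣edgeLen⇒%≡ : ∀ {p q} → p < v → q < v → d ∣ edgeLen v p q → p % d ≡ q % d
  ∣edgeLen⇒%≡ {p} {q} p<v q<v h with ⊓-sel ∣ p - q ∣ (v ∸ ∣ p - q ∣)
  ... | inj₁ e = ∣diff⇒%≡ p q (subst (d ∣_) e h)
  ... | inj₂ e = ∣diff⇒%≡ p q (∣m+n∣m⇒∣n (subst (d ∣_) (sym (m∸n+n≡m diff≤v)) d∣v) (subst (d ∣_) e h))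
    where
    diff≤v : ∣ p - q ∣ ≤ v
    diff≤v = ≤-trans (∣m-n∣≤m⊔n p q) (⊔-lub (<⇒≤ p<v) (<⇒≤ q<v))

  -- A path visits at most one new residue class modulo d for each of its
  -- edges whose length is not a multiple of d.
  residues : ∀ p ps → All (_< v) (p ∷ ps) →
    ∃ λ rs → All (λ q → q % d ∈ rs) (p ∷ ps) × length rs + countMultiples d (edgeLengths v (p ∷ ps)) ≤ length (p ∷ ps)
  residues p [] _ = [ p % d ] , here refl ∷ [] , ≤-refl
  residues p (q ∷ ps) (p<v ∷ q<v ∷ ps<v) with residues q ps (q<v ∷ ps<v) | d ∣? edgeLen v p q
  ... | rs , q∈ ∷ ps∈ , bound | yes d∣e =
    rs , subst (_∈ rs) (sym (∣edgeLen⇒%≡ p<v q<v d∣e)) q∈ ∷ q∈ ∷ ps∈ ,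
    ≤-trans (≤-reflexive (+-suc (length rs) _)) (s≤s bound)
  ... | rs , qs∈ , bound | no _ = p % d ∷ rs , here refl ∷ All.map there qs∈ , s≤s bound

-- Pigeonhole: sending a residue to the position where it was found in `rs` is injective, because
-- looking up that position gives the residue back. Repetitions in `rs` do no harm.
covers-residues : ∀ d rs → (∀ {i} → i < d → i ∈ rs) → d ≤ length rs
covers-residues d rs h = injective⇒≤ {f = λ i → Any.index (h (toℕ<n i))} λ {i} {j} e → toℕ-injective (begin
  toℕ i                            ≡⟨ lookup-index (h (toℕ<n i)) ⟩
  lookup rs (Any.index (h (toℕ<n i))) ≡⟨ cong (lookup rs) e ⟩
  lookup rs (Any.index (h (toℕ<n j))) ≡⟨ lookup-index (h (toℕ<n j)) ⟨
  toℕ j                            ∎)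
  where open ≡-Reasoning

path-countMultiples : ∀ {v ps} d → 0 < v → IsHamPath v ps → d ∣ v → countMultiples d (edgeLengths v ps) ≤ v ∸ d
-- The divisor 0 would force `v = 0`. The remaining divisors are written as successors so that `%`
-- is available.
path-countMultiples {v} {ps} zero 0<v ham (divides q eq) = contradiction (trans eq (*-zeroʳ q)) (>⇒≢ 0<v)
path-countMultiples {v} {[]} (suc _) 0<v ham d∣v = contradiction (trans (sym (List.length-upTo v)) (↭-length (↭-sym ham))) (>⇒≢ 0<v)
path-countMultiples {v} {p ∷ ps} d@(suc _) 0<v ham d∣v with residues d v d∣v p ps (All-resp-↭ (↭-sym ham) (All.all-upTo v))
... | rs , ∈rs , bound = m+n≤o⇒m≤o∸n _ (begin
  cm + d                ≡⟨ +-comm cm d ⟩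
  d + cm                ≤⟨ +-monoˡ-≤ cm (covers-residues d rs covers) ⟩
  length rs + cm        ≤⟨ bound ⟩
  length (p ∷ ps)       ≡⟨ trans (↭-length ham) (List.length-upTo v) ⟩
  v                     ∎)
  where
  open ≤-Reasoning
  cm = countMultiples d (edgeLengths v (p ∷ ps))
  covers : ∀ {i} → i < d → i ∈ rs
  -- As `d ≤ v`, every `i < d` is itself a vertex of the path and its own residue.
  covers {i} i<d = subst (_∈ rs) (m<n⇒m%n≡m i<d)
    (All.lookup ∈rs (∈-resp-↭ (↭-sym ham) (∈-upTo⁺ (≤-trans i<d (∣⇒≤ {{>-nonZero 0<v}} d∣v)))))

realizable⇒admissible : ∀ {v L} → 0 < v → length L ≡ v ∸ 1 → All (1 ≤_) L → Realizable v L → Admissible v L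
realizable⇒admissible {v} {L} 0<v size pos (ps , ham , es) =
  size , pos , All-resp-↭ es (edgeLengths-≤ v ps) ,
  λ d d∣v → subst (_≤ v ∸ d) (↭-length (filter-↭ (d ∣?_) es)) (path-countMultiples d 0<v ham d∣v)

-- Growing a path

Short : ℕ → ℕ → ℕ → Set
Short t p q = ∣ p - q ∣ ≤ t

-- Stated with `⊓` and `⊔` so that the direction in which the path runs through the edge is
-- irrelevant.
Crosses : ℕ → ℕ → ℕ → Set
Crosses m p q = p ⊓ q < m × m ≤ p ⊔ q

short? : ∀ t p q → Dec (Short t p q)
short? t p q = ∣ p - q ∣ ≤? t

crosses? : ∀ m p q → Dec (Crosses m p q)
crosses? m p q = (p ⊓ q <? m) ×-dec (m ≤? p ⊔ q)

-- Agrees with edgeLen v if all values are at most t and 2t ≤ v. Unlike edgeLen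
-- it is stable under growth also for 2t > v, where small base paths live.
len : ℕ → ℕ → ℕ → ℕ → ℕ
len t v p q with short? t p q
... | yes _ = ∣ p - q ∣
... | no  _ = v ∸ ∣ p - q ∣

lens : ℕ → ℕ → List ℕ → List ℕ
lens t v (p ∷ q ∷ ps) = len t v p q ∷ lens t v (q ∷ ps)
lens t v _            = []

-- A list of at most one vertex: the lower end of an edge that growing at `m` reroutes. A long edge
-- across the cut contributes nothing, since it is stretched and not rerouted.
low : ℕ → ℕ → ℕ → ℕ → List ℕ
low t m p q with short? t p q ×-dec crosses? m p q
... | yes _ = [ p ⊓ q ]
... | no  _ = []

lows : ℕ → ℕ → List ℕ → List ℕ
lows t m (p ∷ q ∷ ps) = low t m p q ++ lows t m (q ∷ ps)
lows t m _            = []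

openGap : ℕ → ℕ → ℕ → ℕ
openGap m g p with p <? m
... | yes _ = p
... | no  _ = p + g

module _ (t m g : ℕ) where

  -- Continues after the old vertex `p`, whose image is already written. The detour vertex is `g`
  -- above the lower end of the edge, whether the edge is run through upwards or downwards.
  growFrom : ℕ → List ℕ → List ℕ
  growFrom p []       = []
  growFrom p (q ∷ ps) = map (g +_) (low t m p q) ++ openGap m g q ∷ growFrom q ps

  grow : List ℕ → List ℕ
  grow []       = []
  grow (p ∷ ps) = openGap m g p ∷ growFrom p ps

len-short : ∀ {t} v {p q} → Short t p q → len t v p q ≡ ∣ p - q ∣
len-short {t} v {p} {q} s with short? t p q
... | yes _ = refl
... | no ¬s = contradiction s ¬s

len-long : ∀ {t} v {p q} → ¬ Short t p q → len t v p q ≡ v ∸ ∣ p - q ∣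
len-long {t} v {p} {q} ¬s with short? t p q
... | yes s = contradiction s ¬s
... | no _  = refl

low-crosses : ∀ {t m p q} → Short t p q → Crosses m p q → low t m p q ≡ [ p ⊓ q ]
low-crosses {t} {m} {p} {q} s c with short? t p q ×-dec crosses? m p q
... | yes _ = refl
... | no ¬sc = contradiction (s , c) ¬sc

low-otherwise : ∀ {t m p q} → ¬ (Short t p q × Crosses m p q) → low t m p q ≡ []
low-otherwise {t} {m} {p} {q} ¬sc with short? t p q ×-dec crosses? m p q
... | yes sc = contradiction sc ¬sc
... | no _   = refl

openGap-< : ∀ {m} g {p} → p < m → openGap m g p ≡ p
openGap-< {m} g {p} p<m with p <? m
... | yes _ = refl
... | no p≮m = contradiction p<m p≮m

openGap-≥ : ∀ {m} g {p} → m ≤ p → openGap m g p ≡ p + g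
openGap-≥ {m} g {p} m≤p with p <? m
... | yes p<m = contradiction p<m (≤⇒≯ m≤p)
... | no _    = refl

short-comm : ∀ {t} p q → Short t p q → Short t q p
short-comm p q = subst (_≤ _) (∣-∣-comm p q)

crosses-comm : ∀ {m} p q → Crosses m p q → Crosses m q p
crosses-comm p q (l , u) rewrite ⊓-comm p q | ⊔-comm p q = l , u

len-comm : ∀ t v p q → len t v p q ≡ len t v q p
len-comm t v p q with short? t p q
... | yes s = trans (∣-∣-comm p q) (sym (len-short v {q} {p} (short-comm p q s)))
... | no ¬s = trans (cong (v ∸_) (∣-∣-comm p q)) (sym (len-long v {q} {p} (¬s ∘ short-comm q p)))

low-comm : ∀ t m p q → low t m p q ≡ low t m q p
low-comm t m p q with short? t p q ×-dec crosses? m p q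
... | yes (s , c) = trans (cong [_] (⊓-comm p q)) (sym (low-crosses {p = q} {p} (short-comm p q s) (crosses-comm p q c)))
... | no ¬sc = sym (low-otherwise {p = q} {p} λ (s , c) → ¬sc (short-comm q p s , crosses-comm q p c))

low-above : ∀ {t m p q} → m ≤ p → m ≤ q → low t m p q ≡ []
low-above {p = p} {q} m≤p m≤q = low-otherwise {p = p} {q} λ (_ , l , _) → contradiction (⊓-glb m≤p m≤q) (<⇒≱ l)

low-long : ∀ {t m p q} → ¬ Short t p q → low t m p q ≡ []
low-long {p = p} {q} ¬s = low-otherwise {p = p} {q} (¬s ∘ proj₁)

low-below : ∀ {t m p q} → p < m → q < m → low t m p q ≡ []
low-below {p = p} {q} p<m q<m = low-otherwise {p = p} {q} λ (_ , _ , u) → contradiction u (<⇒≱ (⊔-pres-<m p<m q<m))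

-- Every edge that is long in the linear sense has to run across the cut, since
-- its cyclic length is only unchanged if its linear length grows with v.
EdgeOk : ℕ → ℕ → ℕ → ℕ → Set
EdgeOk t m p q = Short t p q ⊎ Crosses m p q

edgeOk? : ∀ t m p q → Dec (EdgeOk t m p q)
edgeOk? t m p q = short? t p q ⊎-dec crosses? m p q

ok-comm : ∀ {t m} p q → EdgeOk t m p q → EdgeOk t m q p
ok-comm p q (inj₁ s) = inj₁ (short-comm p q s)
ok-comm p q (inj₂ c) = inj₂ (crosses-comm p q c)

-- The effect of growing on a single edge

module _ (t v m g : ℕ) where

  private
    o = openGap m g

  -- Collects all that the inductions along the path need to know about one edge: the new lengths,
  -- the lower ends at every cut `m′ ≤ m`, and `EdgeOk` at those cuts. In `split` the last item is
  -- replaced by the shortness of both halves, which gives `EdgeOk` at any cut.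
  data Step (p q : ℕ) : Set where
    keep  : low t m p q ≡ [] →
            len t (v + g) (o p) (o q) ≡ len t v p q →
            (∀ {m′} → m′ ≤ m → low t m′ (o p) (o q) ≡ low t m′ p q) →
            (∀ {m′} → m′ ≤ m → EdgeOk t m′ p q → EdgeOk t m′ (o p) (o q)) →
            Step p q
    split : ∀ r → low t m p q ≡ [ r ] →
            lens t (v + g) (o p ∷ g + r ∷ o q ∷ []) ↭ g ∷ len t v p q ∷ [] →
            (∀ {m′} → m′ ≤ m → low t m′ (o p) (g + r) ++ low t m′ (g + r) (o q) ↭ low t m′ p q) →
            Short t (o p) (g + r) → Short t (g + r) (o q) →
            Step p q

  -- Reversing an edge exchanges the halves of a split. For this reason `split` compares lengths and
  -- lower ends only up to permutation.
  step-comm : ∀ {p q} → Step p q → Step q p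
  step-comm {p} {q} (keep l e k w) = keep
    (trans (low-comm t m q p) l)
    (trans (len-comm t (v + g) (o q) (o p)) (trans e (len-comm t v p q)))
    (λ {m′} m′≤m → trans (low-comm t m′ (o q) (o p)) (trans (k m′≤m) (low-comm t m′ p q)))
    (λ m′≤m → ok-comm (o p) (o q) ∘ w m′≤m ∘ ok-comm q p)
  step-comm {p} {q} (split r l e k s s′) = split r
    (trans (low-comm t m q p) l)
    (begin
      len t (v + g) (o q) (g + r) ∷ len t (v + g) (g + r) (o p) ∷ []
        ≡⟨ cong₂ (λ a b → a ∷ b ∷ []) (len-comm t (v + g) (o q) (g + r)) (len-comm t (v + g) (g + r) (o p)) ⟩
      len t (v + g) (g + r) (o q) ∷ len t (v + g) (o p) (g + r) ∷ []
        ↭⟨ swap _ _ ↭-refl ⟩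
      len t (v + g) (o p) (g + r) ∷ len t (v + g) (g + r) (o q) ∷ []
        ↭⟨ e ⟩
      g ∷ len t v p q ∷ []
        ≡⟨ cong (λ a → g ∷ a ∷ []) (len-comm t v p q) ⟩
      g ∷ len t v q p ∷ [] ∎)
    (λ {m′} m′≤m → begin
      low t m′ (o q) (g + r) ++ low t m′ (g + r) (o p)
        ≡⟨ cong₂ _++_ (low-comm t m′ (o q) (g + r)) (low-comm t m′ (g + r) (o p)) ⟩
      low t m′ (g + r) (o q) ++ low t m′ (o p) (g + r)
        ↭⟨ ++-comm (low t m′ (g + r) (o q)) _ ⟩
      low t m′ (o p) (g + r) ++ low t m′ (g + r) (o q)
        ↭⟨ k m′≤m ⟩
      low t m′ p q
        ≡⟨ low-comm t m′ p q ⟩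
      low t m′ q p ∎)
    (short-comm (g + r) (o q) s′) (short-comm (o p) (g + r) s)
    where open PermutationReasoning

  -- For `p ≤ q` the edge lies above the cut, below it, or across it, and in the last case it is
  -- long or short; only the short crossing edge is split. The last premise puts its lower end
  -- within `g` of the cut, so that the detour vertex `g + p` lies at or above `m`.
  step-up : g ≤ t → ∀ {p q} → p ≤ q → EdgeOk t m p q → (Short t p q → Crosses m p q → m ≤ g + p ⊓ q) → Step p q
  step-up g≤t {p} {q} p≤q ok fits with p <? m | m ≤? q
  -- Above the cut both ends move up by `g`. `EdgeOk` makes the edge short, so its length does not
  -- involve `v`, and it crosses no cut `m′ ≤ m` before or after the move.
  ... | no p≮m | _ = keep (low-above {t} m≤p m≤q) len-eq low-eq ok′
    where
    m≤p = ≮⇒≥ p≮m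
    m≤q = ≤-trans m≤p p≤q
    diff : ∣ o p - o q ∣ ≡ ∣ p - q ∣
    diff = trans (cong₂ ∣_-_∣ (trans (openGap-≥ g m≤p) (+-comm p g)) (trans (openGap-≥ g m≤q) (+-comm q g)))
                 (∣m+n-m+o∣≡∣n-o∣ g p q)
    shrt : Short t p q
    shrt = [ id , (λ (l , _) → contradiction (⊓-glb m≤p m≤q) (<⇒≱ l)) ]′ ok
    shrt′ : Short t (o p) (o q)
    shrt′ = subst (_≤ t) (sym diff) shrt
    len-eq = trans (len-short (v + g) {o p} {o q} shrt′) (trans diff (sym (len-short v {p} {q} shrt)))
    above : ∀ {r} → m ≤ r → m ≤ o r
    above {r} m≤r = subst (m ≤_) (sym (openGap-≥ g m≤r)) (m≤n⇒m≤n+o g m≤r)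
    low-eq : ∀ {m′} → m′ ≤ m → low t m′ (o p) (o q) ≡ low t m′ p q
    low-eq m′≤m = trans (low-above {t} (≤-trans m′≤m (above m≤p)) (≤-trans m′≤m (above m≤q)))
                        (sym (low-above {t} (≤-trans m′≤m m≤p) (≤-trans m′≤m m≤q)))
    ok′ : ∀ {m′} → m′ ≤ m → EdgeOk t m′ p q → EdgeOk t m′ (o p) (o q)
    ok′ _ _ = inj₁ shrt′
  -- Below the cut nothing moves. The edge cannot cross, so it is short and its length is unaffected
  -- by the new `v`.
  ... | yes p<m | no m≰q = keep (low-below {t} p<m (≰⇒> m≰q)) len-eq
         (λ {m′} _ → cong₂ (low t m′) op oq) (λ {m′} _ → subst₂ (EdgeOk t m′) (sym op) (sym oq))
    where
    op = openGap-< g p<m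
    oq = openGap-< g (≰⇒> m≰q)
    shrt : Short t p q
    shrt = [ id , (λ (_ , u) → contradiction u (<⇒≱ (⊔-pres-<m p<m (≰⇒> m≰q)))) ]′ ok
    len-eq : len t (v + g) (o p) (o q) ≡ len t v p q
    len-eq = trans (cong₂ (len t (v + g)) op oq) (trans (len-short (v + g) {p} {q} shrt) (sym (len-short v {p} {q} shrt)))
  ... | yes p<m | yes m≤q with short? t p q
  -- The linear length of a long edge across the cut grows by `g`, as does the number of vertices,
  -- so the cyclic length `v ∸ |p - q|` is the same. The edge stays long and hence contributes no
  -- lower end to any cut.
  ...   | no long = keep (low-long {t} {m} {p} {q} long) len-eq
                      (λ {m′} _ → trans (low-long {t} {m′} {o p} {o q} long′) (sym (low-long {t} {m′} {p} {q} long))) ok′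
    where
    op = openGap-< g p<m
    oq = openGap-≥ g m≤q
    diff : ∣ o p - o q ∣ ≡ ∣ p - q ∣ + g
    diff = begin
      ∣ o p - o q ∣   ≡⟨ cong₂ ∣_-_∣ op oq ⟩
      ∣ p - (q + g) ∣ ≡⟨ m≤n⇒∣m-n∣≡n∸m (m≤n⇒m≤n+o g p≤q) ⟩
      q + g ∸ p       ≡⟨ +-∸-comm g p≤q ⟩
      q ∸ p + g       ≡⟨ cong (_+ g) (m≤n⇒∣m-n∣≡n∸m p≤q) ⟨
      ∣ p - q ∣ + g   ∎
      where open ≡-Reasoning
    long′ : ¬ Short t (o p) (o q)
    long′ s = long (≤-trans (m≤m+n _ g) (subst (_≤ t) diff s))
    len-eq : len t (v + g) (o p) (o q) ≡ len t v p q
    len-eq = begin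
      len t (v + g) (o p) (o q)   ≡⟨ len-long (v + g) {o p} {o q} long′ ⟩
      v + g ∸ ∣ o p - o q ∣       ≡⟨ cong₂ _∸_ (+-comm v g) (trans diff (+-comm _ g)) ⟩
      (g + v) ∸ (g + ∣ p - q ∣)   ≡⟨ [m+n]∸[m+o]≡n∸o g v _ ⟩
      v ∸ ∣ p - q ∣               ≡⟨ len-long v {p} {q} long ⟨
      len t v p q                 ∎
      where open ≡-Reasoning
    ok′ : ∀ {m′} → m′ ≤ m → EdgeOk t m′ p q → EdgeOk t m′ (o p) (o q)
    ok′ _    (inj₁ s) = contradiction s long
    ok′ m′≤m (inj₂ (l , _)) rewrite op | oq | m≤n⇒m⊓n≡m p≤q =
      inj₂ (≤-<-trans (m⊓n≤m p (q + g)) l , ≤-trans m′≤m (≤-trans (≤-trans m≤q (m≤m+n q g)) (m≤n⊔m p (q + g))))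
  -- The first half is the new edge of length `g`, short because `g ≤ t`. The second half is the old
  -- edge translated by `g`, up to the position of its ends.
  ...   | yes shrt = split p low-eq len-eq low-keep s₁ s₂
    where
    op = openGap-< g p<m
    oq = openGap-≥ g m≤q
    p⊓q = m≤n⇒m⊓n≡m p≤q
    crss : Crosses m p q
    crss = subst (_< m) (sym p⊓q) p<m , ≤-trans m≤q (m≤n⊔m p q)
    low-eq : low t m p q ≡ [ p ]
    low-eq = trans (low-crosses {t} {m} {p} {q} shrt crss) (cong [_] p⊓q)
    m≤g+p : m ≤ g + p
    m≤g+p = subst (λ r → m ≤ g + r) p⊓q (fits shrt crss)
    d₁ : ∣ o p - (g + p) ∣ ≡ g
    d₁ = trans (cong₂ ∣_-_∣ op (+-comm g p)) (∣m-m+n∣≡n p g)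
    d₂ : ∣ g + p - o q ∣ ≡ ∣ p - q ∣
    d₂ = trans (cong (∣ g + p -_∣) (trans oq (+-comm q g))) (∣m+n-m+o∣≡∣n-o∣ g p q)
    s₁ : Short t (o p) (g + p)
    s₁ = subst (_≤ t) (sym d₁) g≤t
    s₂ : Short t (g + p) (o q)
    s₂ = subst (_≤ t) (sym d₂) shrt
    len-eq : lens t (v + g) (o p ∷ g + p ∷ o q ∷ []) ↭ g ∷ len t v p q ∷ []
    len-eq = ↭-reflexive (cong₂ (λ a b → a ∷ b ∷ [])
      (trans (len-short (v + g) {o p} {g + p} s₁) d₁)
      (trans (len-short (v + g) {g + p} {o q} s₂) (trans d₂ (sym (len-short v {p} {q} shrt)))))
    -- At a cut `m′ ≤ m` only the first half can be a crossing edge, since the second lies at or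
    -- above `m`. The first half inherits the lower end `p`, and its upper end is at least `m`, so
    -- it crosses `m′` exactly when the old edge did. This covers `m′ = m` and is what makes a cut
    -- reusable.
    low-keep : ∀ {m′} → m′ ≤ m → low t m′ (o p) (g + p) ++ low t m′ (g + p) (o q) ↭ low t m′ p q
    low-keep {m′} m′≤m with p <? m′
    ... | yes p<m′ = ↭-reflexive (trans (cong₂ _++_
          (trans (low-crosses {t} {m′} {o p} {g + p} s₁ (subst (λ z → Crosses m′ z (g + p)) (sym op)
                   (subst (_< m′) (sym (m≤n⇒m⊓n≡m (m≤n+m p g))) p<m′ , ≤-trans m′≤m (≤-trans m≤g+p (m≤n⊔m p (g + p))))))
                 (trans (cong [_] (trans (cong (_⊓ (g + p)) op) (trans (m≤n⇒m⊓n≡m (m≤n+m p g)) (sym p⊓q))))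
                        (sym (low-crosses {t} {m′} {p} {q} shrt (subst (_< m′) (sym p⊓q) p<m′ , ≤-trans m′≤m (≤-trans m≤q (m≤n⊔m p q)))))))
          (low-above {t} (≤-trans m′≤m m≤g+p) (subst (m′ ≤_) (sym oq) (≤-trans m′≤m (m≤n⇒m≤n+o g m≤q)))))
          (List.++-identityʳ _))
    ... | no p≮m′ = ↭-reflexive (trans (cong₂ _++_
          (low-above {t} (subst (m′ ≤_) (sym op) m′≤p) (≤-trans m′≤m m≤g+p))
          (low-above {t} (≤-trans m′≤m m≤g+p) (subst (m′ ≤_) (sym oq) (≤-trans m′≤m (m≤n⇒m≤n+o g m≤q)))))
          (sym (low-above {t} m′≤p (≤-trans m′≤m m≤q))))
      where m′≤p = ≮⇒≥ p≮m′

  step : g ≤ t → ∀ p q → EdgeOk t m p q → All (λ l → m ≤ g + l) (low t m p q) → Step p q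
  step g≤t p q ok fits with ≤-total p q
  ... | inj₁ p≤q = step-up g≤t p≤q ok λ s c →
          All.head (subst (All _) (low-crosses {t} {m} {p} {q} s c) fits)
  ... | inj₂ q≤p = step-comm (step-up g≤t q≤p (ok-comm p q ok) λ s c →
          All.head (subst (All _) (trans (low-comm t m p q) (low-crosses {t} {m} {q} {p} s c)) fits))

-- The vertices of the grown path

applyUpTo-++ : ∀ {A : Set} (f : ℕ → A) m n → applyUpTo f (m + n) ≡ applyUpTo f m ++ applyUpTo (λ i → f (m + i)) n
applyUpTo-++ f zero    n = refl
applyUpTo-++ f (suc m) n = cong (f 0 ∷_) (applyUpTo-++ (f ∘ suc) m n)

applyUpTo-cong : ∀ {A : Set} {f h : ℕ → A} n → (∀ {i} → i < n → f i ≡ h i) → applyUpTo f n ≡ applyUpTo h n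
applyUpTo-cong zero    e = refl
applyUpTo-cong (suc n) e = cong₂ _∷_ (e z<s) (applyUpTo-cong n (e ∘ s<s))

replicate-+ : ∀ {A : Set} m n (x : A) → replicate (m + n) x ≡ replicate m x ++ replicate n x
replicate-+ zero    n x = refl
replicate-+ (suc m) n x = cong (x ∷_) (replicate-+ m n x)

module _ (t m g : ℕ) where

  -- The detours are interleaved with the images of the old vertices. Sorting the two kinds apart
  -- leaves a relabelled vertex set and one new vertex per lower end, which can be compared with an
  -- interval.
  growFrom-↭ : ∀ p ps → growFrom t m g p ps ↭ map (openGap m g) ps ++ map (g +_) (lows t m (p ∷ ps))
  growFrom-↭ p []       = ↭-refl
  growFrom-↭ p (q ∷ ps) = begin
    M ++ openGap m g q ∷ growFrom t m g q ps ↭⟨ shift (openGap m g q) M _ ⟩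
    openGap m g q ∷ M ++ growFrom t m g q ps ↭⟨ prep _ (++⁺ˡ M (growFrom-↭ q ps)) ⟩
    openGap m g q ∷ M ++ S ++ map (g +_) R   ↭⟨ prep _ (shifts M S) ⟩
    openGap m g q ∷ S ++ M ++ map (g +_) R   ≡⟨ cong (λ z → openGap m g q ∷ S ++ z) (List.map-++ (g +_) (low t m p q) R) ⟨
    openGap m g q ∷ S ++ map (g +_) (low t m p q ++ R) ∎
    where
    open PermutationReasoning
    M = map (g +_) (low t m p q)
    S = map (openGap m g) ps
    R = lows t m (q ∷ ps)

  grow-↭ : ∀ ps → grow t m g ps ↭ map (openGap m g) ps ++ map (g +_) (lows t m ps)
  grow-↭ []       = ↭-refl
  grow-↭ (p ∷ ps) = prep _ (growFrom-↭ p ps)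

Block : ℕ → ℕ → List ℕ
Block m g = applyUpTo (λ i → (m ∸ g) + i) g

-- The permutation also forbids lower ends outside the block: from a vertex below `m ∸ g` the detour
-- would run into an old vertex. The bound `g ≤ t` makes the new edges short, and `g ≤ m` keeps
-- `m ∸ g` from truncating.
Cut : ℕ → ℕ → ℕ → ℕ → List ℕ → Set
Cut t v m g ps = g ≤ t × g ≤ m × m ≤ v × lows t m ps ↭ Block m g × Linked (EdgeOk t m) ps

-- Opening the gap leaves exactly `m .. m + g - 1` free, and this interval is the block below the
-- cut shifted up by `g`.
open-range : ∀ {m v} g → g ≤ m → m ≤ v →
             map (openGap m g) (upTo v) ++ map (g +_) (Block m g) ↭ upTo (v + g)
open-range {m} {v} g g≤m m≤v = begin
  map (openGap m g) (upTo v) ++ map (g +_) (Block m g)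
    ≡⟨ cong₂ _++_ below-above fresh ⟩
  (upTo m ++ A) ++ F
    ≡⟨ List.++-assoc (upTo m) A F ⟩
  upTo m ++ A ++ F
    ↭⟨ ++⁺ˡ (upTo m) (++-comm A F) ⟩
  upTo m ++ F ++ A
    ≡⟨ cong (upTo m ++_) (applyUpTo-++ (m +_) g (v ∸ m)) ⟨
  upTo m ++ applyUpTo (m +_) (g + (v ∸ m))
    ≡⟨ applyUpTo-++ id m (g + (v ∸ m)) ⟨
  upTo (m + (g + (v ∸ m)))
    ≡⟨ cong upTo (trans (cong (m +_) (+-comm g _)) (trans (sym (+-assoc m _ g)) (cong (_+ g) (m+[n∸m]≡n m≤v)))) ⟩
  upTo (v + g) ∎
  where
  open PermutationReasoning
  F = applyUpTo (m +_) g
  A = applyUpTo (λ i → m + (g + i)) (v ∸ m)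
  fresh : map (g +_) (Block m g) ≡ F
  fresh = trans (List.map-applyUpTo _ (g +_) g)
    (applyUpTo-cong g λ {i} _ → trans (sym (+-assoc g (m ∸ g) i)) (cong (_+ i) (m+[n∸m]≡n g≤m)))
  below-above : map (openGap m g) (upTo v) ≡ upTo m ++ A
  below-above = trans (List.map-upTo (openGap m g) v) (trans (cong (applyUpTo (openGap m g)) (sym (m+[n∸m]≡n m≤v)))
    (trans (applyUpTo-++ (openGap m g) m (v ∸ m)) (cong₂ _++_
      (applyUpTo-cong m (openGap-< g))
      (applyUpTo-cong (v ∸ m) λ {i} _ → trans (openGap-≥ g (m≤m+n m i)) (trans (+-assoc m i g) (cong (m +_) (+-comm i g)))))))

Block-≥ : ∀ {m g} → g ≤ m → All (λ l → m ≤ g + l) (Block m g)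
Block-≥ {m} {g} g≤m = All.applyUpTo⁺₂ _ g λ i →
  ≤-trans (≤-reflexive (sym (m+[n∸m]≡n g≤m))) (+-monoʳ-≤ g (m≤m+n (m ∸ g) i))

-- Lengths and cuts along the grown path

module _ (t v m g : ℕ) where

  Steps : List ℕ → Set
  Steps = Linked (Step t v m g)

  steps : g ≤ t → ∀ {ps} → Linked (EdgeOk t m) ps → All (λ l → m ≤ g + l) (lows t m ps) → Steps ps
  steps g≤t []        _ = []
  steps g≤t [-]       _ = [-]
  steps g≤t {p ∷ q ∷ ps} (o ∷ os) a =
    step t v m g g≤t p q o (All.++⁻ˡ (low t m p q) a) ∷ steps g≤t os (All.++⁻ʳ (low t m p q) a)

  -- Every split adds one edge of length `g`, and there are as many splits as lower ends at the cut.
  lens-grow : ∀ {ps} → Steps ps →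
              lens t (v + g) (grow t m g ps) ↭ replicate (length (lows t m ps)) g ++ lens t v ps
  lens-grow []  = ↭-refl
  lens-grow [-] = ↭-refl
  lens-grow {p ∷ q ∷ ps} (keep l e _ _ ∷ ss) rewrite l | e =
    ↭-trans (prep _ (lens-grow ss)) (↭-sym (shift _ (replicate (length (lows t m (q ∷ ps))) g) _))
  lens-grow {p ∷ q ∷ ps} (split r l e _ _ _ ∷ ss) rewrite l =
    ↭-trans (++⁺ e (lens-grow ss)) (prep _ (↭-sym (shift _ (replicate (length (lows t m (q ∷ ps))) g) _)))

  -- Holds edge by edge, since a detour leaves the lower end of its edge in place. Nothing is
  -- claimed about cuts above `m`, where vertices have moved.
  lows-grow : ∀ {m′ ps} → m′ ≤ m → Steps ps → lows t m′ (grow t m g ps) ↭ lows t m′ ps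
  lows-grow _ []  = ↭-refl
  lows-grow _ [-] = ↭-refl
  lows-grow {m′} {p ∷ q ∷ ps} m′≤m (keep l _ k _ ∷ ss) rewrite l =
    ++⁺ (↭-reflexive (k m′≤m)) (lows-grow m′≤m ss)
  lows-grow {m′} {p ∷ q ∷ ps} m′≤m (split r l _ k _ _ ∷ ss) rewrite l =
    ↭-trans (↭-reflexive (sym (List.++-assoc (low t m′ (openGap m g p) (g + r)) _ _)))
            (++⁺ (k m′≤m) (lows-grow m′≤m ss))

  ok-grow : ∀ {m′ ps} → m′ ≤ m → Steps ps → Linked (EdgeOk t m′) ps → Linked (EdgeOk t m′) (grow t m g ps)
  ok-grow _ []  _ = []
  ok-grow _ [-] _ = [-]
  ok-grow {m′} {p ∷ q ∷ ps} m′≤m (keep l _ _ w ∷ ss) (o ∷ os) rewrite l = w m′≤m o ∷ ok-grow m′≤m ss os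
  ok-grow {m′} {p ∷ q ∷ ps} m′≤m (split r l _ _ s s′ ∷ ss) (o ∷ os) rewrite l =
    inj₁ s ∷ inj₁ s′ ∷ ok-grow m′≤m ss os

-- Paths with prescribed lengths and their repeated growth

record Path (t v : ℕ) (L : List ℕ) : Set where
  field
    path     : List ℕ
    vertices : path ↭ upTo v
    edges    : lens t v path ↭ L
open Path

HasCut : ∀ {t v L} → Path t v L → ℕ → ℕ → Set
HasCut {t} {v} P m g = Cut t v m g (path P)

-- The size `g′` of a surviving cut is arbitrary. Growing by one of 1, 2, `x` thus leaves lower cuts
-- for the other two intact, which lets the three kinds of growth be combined.
grow-path : ∀ {t v L m g} (P : Path t v L) → HasCut P m g →
  Σ (Path t (v + g) (replicate g g ++ L)) λ Q →
    ∀ {m′ g′} → m′ ≤ m → HasCut P m′ g′ → HasCut Q m′ g′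
grow-path {t} {v} {L} {m} {g} P (g≤t , g≤m , m≤v , ls , os) = Q , keeps
  where
  ps = path P
  ss = steps t v m g g≤t os (All-resp-↭ (↭-sym ls) (Block-≥ g≤m))
  Q = record
    { path     = grow t m g ps
    ; vertices = begin
        grow t m g ps                              ↭⟨ grow-↭ t m g ps ⟩
        map (openGap m g) ps ++ map (g +_) (lows t m ps) ↭⟨ ++⁺ (map⁺ (openGap m g) (vertices P)) (map⁺ (g +_) ls) ⟩
        map (openGap m g) (upTo v) ++ map (g +_) (Block m g) ↭⟨ open-range g g≤m m≤v ⟩
        upTo (v + g) ∎
    ; edges    = begin
        lens t (v + g) (grow t m g ps) ↭⟨ lens-grow t v m g ss ⟩
        replicate (length (lows t m ps)) g ++ lens t v ps
          ≡⟨ cong (λ k → replicate k g ++ lens t v ps) (trans (↭-length ls) (List.length-applyUpTo _ g)) ⟩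
        replicate g g ++ lens t v ps ↭⟨ ++⁺ˡ (replicate g g) (edges P) ⟩
        replicate g g ++ L ∎
    }
    where open PermutationReasoning
  keeps : ∀ {m′ g′} → m′ ≤ m → HasCut P m′ g′ → HasCut Q m′ g′
  keeps m′≤m (g′≤t , g′≤m′ , m′≤v , ls′ , os′) =
    g′≤t , g′≤m′ , m≤n⇒m≤n+o g m′≤v ,
    ↭-trans (lows-grow t v m g m′≤m ss) ls′ , ok-grow t v m g m′≤m ss os′

-- The cut in use survives its own growth by the case `m′ = m`, so the induction on `k` can always
-- use the same `m`.
grow-path* : ∀ {t v L m g} k (P : Path t v L) → HasCut P m g →
  Σ (Path t (v + k * g) (replicate (k * g) g ++ L)) λ Q →
    ∀ {m′ g′} → m′ ≤ m → HasCut P m′ g′ → HasCut Q m′ g′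
grow-path* {t} {v} {L} {m} {g} zero P cut rewrite +-identityʳ v = P , λ _ c → c
grow-path* {t} {v} {L} {m} {g} (suc k) P cut
  with grow-path P cut
... | Q , keeps with grow-path* k Q (keeps ≤-refl cut)
... | R , keeps′ rewrite +-assoc v g (k * g) = 
  record { path = path R ; vertices = vertices R ; edges = ↭-trans (edges R) blocks } , λ m′≤m → keeps′ m′≤m ∘ keeps m′≤m
  where
  blocks : replicate (k * g) g ++ replicate g g ++ L ↭ replicate (g + k * g) g ++ L
  blocks = ↭-trans (shifts (replicate (k * g) g) (replicate g g))
    (↭-reflexive (trans (sym (List.++-assoc (replicate g g) (replicate (k * g) g) L)) (cong (_++ L) (sym (replicate-+ g (k * g) g)))))

-- Base paths and the lists they cover

∈-─ : ∀ {x : ℕ} {ys} (i : x ∈ ys) → ys ↭ x ∷ (ys Any.─ i)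
∈-─ (here refl) = ↭-refl
∈-─ (there i)   = ↭-trans (prep _ (∈-─ i)) (swap _ _ ↭-refl)

infix 4 _↭?_
-- Removes each head from the other list. This test is run on every base path, for its vertices, its
-- lengths and the lower ends at its cuts.
_↭?_ : (xs ys : List ℕ) → Dec (xs ↭ ys)
[]       ↭? []       = yes ↭-refl
[]       ↭? (y ∷ ys) = no (¬x∷xs↭[] ∘ ↭-sym)
(x ∷ xs) ↭? ys with x ∈? ys
... | no x∉ys = no λ p → x∉ys (∈-resp-↭ p (here refl))
... | yes i   = Dec.map′ (λ p → ↭-trans (prep x p) (↭-sym (∈-─ i))) (λ p → drop-∷ (↭-trans p (∈-─ i))) (xs ↭? (ys Any.─ i))

cut? : ∀ t v m g ps → Dec (Cut t v m g ps)
cut? t v m g ps = (g ≤? t) ×-dec (g ≤? m) ×-dec (m ≤? v) ×-dec (lows t m ps ↭? Block m g) ×-dec Linked.linked? (edgeOk? t m) ps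

multi : ℕ → ℕ → ℕ → ℕ → List ℕ
multi x a b c = replicate a 1 ++ replicate b 2 ++ replicate c x

lens-length : ∀ t v ps → length (lens t v ps) ≡ length ps ∸ 1
lens-length t v []           = refl
lens-length t v (p ∷ [])     = refl
lens-length t v (p ∷ q ∷ ps) = cong suc (lens-length t v (q ∷ ps))

-- A nonempty `L` determines the number of vertices, so the combined growth may leave that number
-- existential.
path-size : ∀ {t v L} → Path t v L → length L ≡ v ∸ 1
path-size {t} {v} P = trans (sym (↭-length (edges P)))
  (trans (lens-length t v (path P)) (cong (_∸ 1) (trans (↭-length (vertices P)) (List.length-upTo v))))

-- For a short edge `|p - q| ≤ t ≤ v - t ≤ v - |p - q|`, and for a long one
-- `v - |p - q| ≤ t < |p - q|`. In both cases `len` picks the minimum.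
len-edgeLen : ∀ {t v} p q → 2 * t ≤ v → len t v p q ≤ t → edgeLen v p q ≡ len t v p q
len-edgeLen {t} {v} p q 2t≤v l≤t with short? t p q
... | yes s = m≤n⇒m⊓n≡m (m+n≤o⇒m≤o∸n _ (≤-trans (+-mono-≤ s s) (subst (_≤ v) (cong (t +_) (+-identityʳ t)) 2t≤v)))
... | no ¬s = m≥n⇒m⊓n≡n (≤-trans l≤t (<⇒≤ (≰⇒> ¬s)))

lens-edgeLengths : ∀ {t v} → 2 * t ≤ v → ∀ ps → All (_≤ t) (lens t v ps) → edgeLengths v ps ≡ lens t v ps
lens-edgeLengths 2t≤v []           _        = refl
lens-edgeLengths 2t≤v (p ∷ [])     _        = refl
lens-edgeLengths 2t≤v (p ∷ q ∷ ps) (l ∷ ls) = cong₂ _∷_ (len-edgeLen p q 2t≤v l) (lens-edgeLengths 2t≤v (q ∷ ps) ls)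

path⇒realizable : ∀ {t v L} → Path t v L → 2 * t ≤ v → All (_≤ t) L → Realizable v L
path⇒realizable {t} {v} P 2t≤v L≤t = path P , vertices P ,
  ↭-trans (↭-reflexive (lens-edgeLengths 2t≤v (path P) (All-resp-↭ (↭-sym (edges P)) L≤t))) (edges P)

-- A cut at 0 stands for an absent cut.
OptionalCut : ∀ {t v L} → Path t v L → ℕ → ℕ → Set
OptionalCut P m g = m ≡ 0 ⊎ HasCut P m g

-- With an absent cut the number of growths is forced to be 0, so the path is returned unchanged and
-- all its cuts survive.
grow-path? : ∀ {t v L} m g k → (m ≡ 0 → k ≡ 0) → (P : Path t v L) → OptionalCut P m g →
  Σ (Path t (v + k * g) (replicate (k * g) g ++ L)) λ Q →
    ∀ {m′ g′} → m ≡ 0 ⊎ m′ ≤ m → OptionalCut P m′ g′ → OptionalCut Q m′ g′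
grow-path? {v = v} m g k none P h with m ≟ 0
... | yes m≡0 rewrite none m≡0 | +-identityʳ v = P , λ _ c → c
... | no m≢0 with h
...   | inj₁ m≡0 = contradiction m≡0 m≢0
...   | inj₂ cut with grow-path* k P cut
...     | Q , keeps = Q , λ
          { _ (inj₁ e) → inj₁ e
          ; (inj₁ m≡0) (inj₂ c) → contradiction m≡0 m≢0
          ; (inj₂ le) (inj₂ c) → inj₂ (keeps le c) }

-- Whether growth at `m` may precede growth at `m′`: only cuts up to `m` are known to survive, while
-- an absent `m` is never grown at. An absent `m′` is 0 and satisfies the inequality.
Compatible : ℕ → ℕ → Set
Compatible m m′ = m ≡ 0 ⊎ m′ ≤ m

grow₃ : ∀ {t v L m m′ m″} g g′ g″ k k′ k″ →
  (m ≡ 0 → k ≡ 0) → (m′ ≡ 0 → k′ ≡ 0) → (m″ ≡ 0 → k″ ≡ 0) →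
  Compatible m m′ → Compatible m m″ → Compatible m′ m″ →
  (P : Path t v L) → OptionalCut P m g → OptionalCut P m′ g′ → OptionalCut P m″ g″ →
  ∃ λ v′ → Path t v′ (replicate (k″ * g″) g″ ++ replicate (k′ * g′) g′ ++ replicate (k * g) g ++ L)
grow₃ g g′ g″ k k′ k″ n n′ n″ s₁ s₂ s₃ P h h′ h″ with grow-path? _ g k n P h
... | Q , f with grow-path? _ g′ k′ n′ Q (f s₁ h′)
... | R , f′ with grow-path? _ g″ k″ n″ R (f′ s₃ (f s₂ h″))
... | S , _ = _ , S

add₁ : ∀ x k a b c → replicate k 1 ++ multi x a b c ≡ multi x (k + a) b c
add₁ x k a b c = trans (sym (List.++-assoc (replicate k 1) (replicate a 1) _))
  (cong (_++ (replicate b 2 ++ replicate c x)) (sym (replicate-+ k a 1)))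

add₂ : ∀ x k a b c → replicate k 2 ++ multi x a b c ↭ multi x a (k + b) c
add₂ x k a b c = ↭-trans (shifts (replicate k 2) (replicate a 1)) (++⁺ˡ (replicate a 1) (↭-reflexive (trans
  (sym (List.++-assoc (replicate k 2) (replicate b 2) _)) (cong (_++ replicate c x) (sym (replicate-+ k b 2))))))

addₓ : ∀ x k a b c → replicate k x ++ multi x a b c ↭ multi x a b (k + c)
addₓ x k a b c = ↭-trans (shifts (replicate k x) (replicate a 1)) (++⁺ˡ (replicate a 1)
  (↭-trans (shifts (replicate k x) (replicate b 2)) (++⁺ˡ (replicate b 2) (↭-reflexive (sym (replicate-+ k c x))))))

-- A path with c edges of length x, and the cuts at which it can be grown by 1, 2
-- and x.
record Entry : Set where
  constructor entry
  field
    c m₁ m₂ mₓ start code : ℕ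

-- Entries with the same `(a, b)` are grouped so that the search for a covering path can pass over a
-- whole group at once.
record Row : Set where
  constructor row
  field
    a b     : ℕ
    entries : List Entry

-- The base 6 digits of the code of a path are its steps ±1, ±2, ±x modulo v.
offset : ℕ → ℕ → ℕ → ℕ
offset x v 0 = 1
offset x v 1 = v ∸ 1
offset x v 2 = 2
offset x v 3 = v ∸ 2
offset x v 4 = x
offset x v _ = v ∸ x

-- The first step is the least significant digit. The second numeric argument counts the steps still
-- to be made, since leading zero digits are steps as well.
walk : ℕ → (v : ℕ) → .{{NonZero v}} → ℕ → ℕ → ℕ → List ℕ
walk x v zero    p _    = p ∷ []
walk x v (suc n) p code = p ∷ walk x v n ((p + offset x v (code % 6)) % v) (code / 6)

module _ (x a b : ℕ) (e : Entry) where
  open Entry e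

  decode : List ℕ
  decode = walk x (suc (a + b + c)) (a + b + c) start code

  private
    v = suc (a + b + c)

    OptCut : ℕ → ℕ → Set
    OptCut m g = m ≡ 0 ⊎ Cut x v m g decode

  -- The cut for growth by 1 has to be used last. In the tables it is at 1 whenever present, with
  -- only the vertex 0 below it. The order of the cuts for 2 and `x` varies from path to path, hence
  -- the disjunction.
  ValidEntry : Set
  ValidEntry = decode ↭ upTo v × lens x v decode ↭ multi x a b c
    × OptCut m₁ 1 × OptCut m₂ 2 × OptCut mₓ x
    × Compatible m₂ m₁ × Compatible mₓ m₁ × (Compatible m₂ mₓ ⊎ Compatible mₓ m₂)

  validEntry? : Dec ValidEntry
  validEntry? = (decode ↭? upTo v) ×-dec (lens x v decode ↭? multi x a b c)
    ×-dec c? m₁ 1 ×-dec c? m₂ 2 ×-dec c? mₓ x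
    ×-dec compatible? m₂ m₁ ×-dec compatible? mₓ m₁ ×-dec (compatible? m₂ mₓ ⊎-dec compatible? mₓ m₂)
    where
    c? : ∀ m g → Dec (OptCut m g)
    c? m g = (m ≟ 0) ⊎-dec cut? x v m g decode
    compatible? : ∀ m m′ → Dec (Compatible m m′)
    compatible? m m′ = (m ≟ 0) ⊎-dec (m′ ≤? m)

  grow-entry : ValidEntry → ∀ k₁ k₂ kₓ → (m₁ ≡ 0 → k₁ ≡ 0) → (m₂ ≡ 0 → k₂ ≡ 0) → (mₓ ≡ 0 → kₓ ≡ 0) →
               ∃ λ v′ → Path x v′ (multi x (k₁ * 1 + a) (k₂ * 2 + b) (kₓ * x + c))
  grow-entry (vs , es , h₁ , h₂ , hₓ , s₂₁ , sₓ₁ , s) k₁ k₂ kₓ n₁ n₂ nₓ = grown s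
    where
    P : Path x v (multi x a b c)
    P = record { path = decode ; vertices = vs ; edges = es }
    re : ∀ {L L′} → L ↭ L′ → (∃ λ v′ → Path x v′ L) → ∃ λ v′ → Path x v′ L′
    re p (v′ , Q) = v′ , record { path = path Q ; vertices = vertices Q ; edges = ↭-trans (edges Q) p }
    R₁ = replicate (k₁ * 1) 1
    R₂ = replicate (k₂ * 2) 2
    Rₓ = replicate (kₓ * x) x
    total : R₁ ++ R₂ ++ Rₓ ++ multi x a b c ↭ multi x (k₁ * 1 + a) (k₂ * 2 + b) (kₓ * x + c)
    total = begin
      R₁ ++ R₂ ++ Rₓ ++ multi x a b c                ↭⟨ ++⁺ˡ R₁ (++⁺ˡ R₂ (addₓ x (kₓ * x) a b c)) ⟩
      R₁ ++ R₂ ++ multi x a b (kₓ * x + c)           ↭⟨ ++⁺ˡ R₁ (add₂ x (k₂ * 2) a b _) ⟩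
      R₁ ++ multi x a (k₂ * 2 + b) (kₓ * x + c)      ≡⟨ add₁ x (k₁ * 1) a (k₂ * 2 + b) (kₓ * x + c) ⟩
      multi x (k₁ * 1 + a) (k₂ * 2 + b) (kₓ * x + c) ∎
      where open PermutationReasoning
    grown : Compatible m₂ mₓ ⊎ Compatible mₓ m₂ → ∃ λ v′ → Path x v′ (multi x (k₁ * 1 + a) (k₂ * 2 + b) (kₓ * x + c))
    -- Here growth by 2 comes before growth by `x`. The later growth stands further left in the
    -- list, so the two blocks have to be exchanged.
    grown (inj₁ s₂ₓ) = re (↭-trans (++⁺ˡ R₁ (shifts Rₓ R₂)) total)
      (grow₃ 2 x 1 k₂ kₓ k₁ n₂ nₓ n₁ s₂ₓ s₂₁ sₓ₁ P h₂ hₓ h₁)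
    grown (inj₂ sₓ₂) = re (↭-trans (++⁺ˡ R₁ ↭-refl) total)
      (grow₃ x 2 1 kₓ k₂ k₁ nₓ n₂ n₁ sₓ₂ sₓ₁ s₂₁ P hₓ h₂ h₁)

-- A point (false , n) stands for n alone, (true , n) for n and everything
-- above it in its residue class modulo the growth size g.
Point : Set
Point = Bool × ℕ

Rep : ℕ → Point → ℕ → Set
Rep g (false , n) N = N ≡ n
Rep g (true  , n) N = ∃ λ j → N ≡ j * g + n

-- A finite list that represents every positive integer. Single values start at 1 because all three
-- multiplicities are positive; from the threshold `N` on there is one ray per class modulo `g`.
points : ℕ → ℕ → List Point
points N g = map (false ,_) (applyUpTo suc (N ∸ 1)) ++ map (true ,_) (applyUpTo (N +_) g)

represented : ∀ N g .{{_ : NonZero g}} n → 1 ≤ n → ∃ λ p → p ∈ points N g × Rep g p n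
represented N g (suc n) _ with suc n <? N
... | yes n<N = (false , suc n) , ∈-++⁺ˡ (∈-map⁺ (false ,_) (∈-applyUpTo⁺ suc (∸-monoˡ-≤ 1 n<N))) , refl
... | no n≮N  = (true , N + r) , ∈-++⁺ʳ _ (∈-map⁺ (true ,_) (∈-applyUpTo⁺ (N +_) (m%n<n d g))) , d / g , eq
  where
  d = suc n ∸ N
  r = d % g
  eq : suc n ≡ d / g * g + (N + r)
  eq = begin
    suc n               ≡⟨ m+[n∸m]≡n (≮⇒≥ n≮N) ⟨
    N + d               ≡⟨ cong (N +_) (m≡m%n+[m/n]*n d g) ⟩
    N + (r + d / g * g) ≡⟨ +-assoc N r _ ⟨
    N + r + d / g * g   ≡⟨ +-comm (N + r) _ ⟩
    d / g * g + (N + r) ∎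
    where open ≡-Reasoning

-- One coordinate of the covering relation. Without a cut a path serves only its own multiplicity
-- `n₀` and never a ray. With a cut it serves `n₀` plus all multiples of `g`, and then reaching the
-- start of a ray is reaching all of it.
Reaches : ℕ → ℕ → ℕ → Point → Set
Reaches g m n₀ (f , n) = (f ≡ false × n ≡ n₀) ⊎ (m ≢ 0 × n₀ ≤ n × g ∣ n ∸ n₀)

reaches? : ∀ g m n₀ p → Dec (Reaches g m n₀ p)
reaches? g m n₀ (f , n) = ((f Bool.≟ false) ×-dec (n ≟ n₀)) ⊎-dec (¬? (m ≟ 0) ×-dec (n₀ ≤? n) ×-dec (g ∣? n ∸ n₀))

reached : ∀ {g m n₀} p {N} → Reaches g m n₀ p → Rep g p N → ∃ λ k → (m ≡ 0 → k ≡ 0) × N ≡ k * g + n₀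
reached (false , n) (inj₁ (_ , refl)) refl = 0 , (λ _ → refl) , refl
reached {n₀ = n₀} (false , n) (inj₂ (m≢0 , n₀≤n , divides q eq)) refl =
  q , (λ e → contradiction e m≢0) , trans (sym (m∸n+n≡m n₀≤n)) (cong (_+ n₀) eq)
reached {g} {n₀ = n₀} (true , n) (inj₂ (m≢0 , n₀≤n , divides q eq)) (j , refl) =
  j + q , (λ e → contradiction e m≢0) , (begin
    j * g + n             ≡⟨ cong (j * g +_) (m∸n+n≡m n₀≤n) ⟨
    j * g + (n ∸ n₀ + n₀) ≡⟨ cong (λ z → j * g + (z + n₀)) eq ⟩
    j * g + (q * g + n₀)  ≡⟨ +-assoc (j * g) (q * g) n₀ ⟨
    j * g + q * g + n₀    ≡⟨ cong (_+ n₀) (*-distribʳ-+ g j q) ⟨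
    (j + q) * g + n₀      ∎)
  where open ≡-Reasoning

module _ (x : ℕ) where

  ValidRow : Row → Set
  ValidRow (row a b es) = All (ValidEntry x a b) es

  validRow? : ∀ r → Dec (ValidRow r)
  validRow? (row a b es) = All.all? (validEntry? x a b) es

  EntryCovers : ℕ → ℕ → Point → Point → Point → Entry → Set
  EntryCovers a b pa pb pc e = Reaches x (Entry.mₓ e) (Entry.c e) pc × Reaches 2 (Entry.m₂ e) b pb × Reaches 1 (Entry.m₁ e) a pa

  -- The bounds on `a` and `b` are tested first, so that an unsuitable row is rejected before its
  -- entries are searched.
  RowCovers : Point → Point → Point → Row → Set
  RowCovers pa pb pc (row a b es) = (a ≤ proj₂ pa × b ≤ proj₂ pb) × Any (EntryCovers a b pa pb pc) es

  rowCovers? : ∀ pa pb pc r → Dec (RowCovers pa pb pc r)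
  rowCovers? pa pb pc (row a b es) = ((a ≤? proj₂ pa) ×-dec (b ≤? proj₂ pb)) ×-dec
    Any.any? (λ e → reaches? x (Entry.mₓ e) (Entry.c e) pc ×-dec reaches? 2 (Entry.m₂ e) b pb ×-dec reaches? 1 (Entry.m₁ e) a pa) es

  -- All lists represented by an excused triple violate v ≥ 2x, or the divisor
  -- condition for a common divisor d of x and v.
  Excused : Point → Point → Point → Set
  Excused (fa , a) (fb , b) (fc , c) = fa ≡ false × fb ≡ false ×
    ((fc ≡ false × suc (a + b + c) < 2 * x) ⊎
     Any (λ d → suc (a + b) < d × d ∣ x × d ∣ suc (a + b + c)) (upTo (suc x)))

  excused? : ∀ pa pb pc → Dec (Excused pa pb pc)
  excused? (fa , a) (fb , b) (fc , c) = (fa Bool.≟ false) ×-dec (fb Bool.≟ false) ×-dec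
    (((fc Bool.≟ false) ×-dec (suc (a + b + c) <? 2 * x)) ⊎-dec
     Any.any? (λ d → (suc (a + b) <? d) ×-dec (d ∣? x) ×-dec (d ∣? suc (a + b + c))) (upTo (suc x)))

  -- The thresholds 3x, x + 2 and max (2, x - 1 - b) for c, b and a are where the
  -- tables below become periodic.
  pointsᵃ : ℕ → List Point
  pointsᵃ b = points (2 ⊔ (x ∸ suc b)) 1

  -- The points for `b` come outermost because the threshold for `a` depends on `b`.
  Complete : List Row → Set
  Complete T = All (λ pb → All (λ pa → All (λ pc → Excused pa pb pc ⊎ Any (RowCovers pa pb pc) T)
    (points (3 * x) x)) (pointsᵃ (proj₂ pb))) (points (2 + x) 2)

  complete? : ∀ T → Dec (Complete T)
  complete? T = All.all? (λ pb → All.all? (λ pa → All.all? (λ pc → excused? pa pb pc ⊎-dec Any.any? (rowCovers? pa pb pc) T)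
    (points (3 * x) x)) (pointsᵃ (proj₂ pb))) (points (2 + x) 2)

  entry-path : ∀ {a₀ b₀ a b c es} pa pb pc → Rep 1 pa a → Rep 2 pb b → Rep x pc c →
    All (ValidEntry x a₀ b₀) es → Any (EntryCovers a₀ b₀ pa pb pc) es → ∃ λ v → Path x v (multi x a b c)
  entry-path {a₀} {b₀} {es = e ∷ _} pa pb pc ra rb rc (ve ∷ _) (here (hc , hb , ha))
    with reached pa ha ra | reached pb hb rb | reached pc hc rc
  ... | k₁ , n₁ , refl | k₂ , n₂ , refl | kₓ , nₓ , refl = grow-entry x a₀ b₀ e ve k₁ k₂ kₓ n₁ n₂ nₓ
  entry-path pa pb pc ra rb rc (_ ∷ vs) (there h) = entry-path pa pb pc ra rb rc vs h

  covered-path : ∀ {a b c T} pa pb pc → Rep 1 pa a → Rep 2 pb b → Rep x pc c →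
    All ValidRow T → Any (RowCovers pa pb pc) T → ∃ λ v → Path x v (multi x a b c)
  covered-path pa pb pc ra rb rc (vs ∷ _) (here (_ , h)) = entry-path pa pb pc ra rb rc vs h
  covered-path pa pb pc ra rb rc (_ ∷ vs) (there h)      = covered-path pa pb pc ra rb rc vs h

  excused-inadmissible : ∀ {a b c} pa pb pc → Rep 1 pa a → Rep 2 pb b → Rep x pc c → Excused pa pb pc →
    2 * x ≤ suc (a + b + c) → ¬ (∀ d → d ∣ x → d ∣ suc (a + b + c) → d ≤ suc (a + b))
  excused-inadmissible (false , a) (false , b) (false , c) refl refl refl (_ , _ , inj₁ (_ , v<2x)) 2x≤v _ =
    <⇒≱ v<2x 2x≤v
  excused-inadmissible (false , a) (false , b) (fc , c) refl refl rc (_ , _ , inj₂ h) _ adm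
    with Any.satisfied h
  ... | d , small , d∣x , d∣v = <⇒≱ small (adm d d∣x (d∣v′ fc rc))
    where
    -- Along a ray `c` changes by multiples of `x`, hence of `d`, and `suc (a + b) < d` does not
    -- mention `c`. One check at the start of the ray therefore excludes all of it.
    d∣v′ : ∀ fc {c′} → Rep x (fc , c) c′ → d ∣ suc (a + b + c′)
    d∣v′ false refl = d∣v
    d∣v′ true (j , refl) = subst (d ∣_) (cong suc eq) (∣m∣n⇒∣m+n d∣v (∣-trans d∣x (n∣m*n j)))
      where
      eq : a + b + c + j * x ≡ a + b + (j * x + c)
      eq = trans (+-assoc (a + b) c _) (cong (a + b +_) (+-comm c _))

  complete-path : ∀ T .{{_ : NonZero x}} → Complete T → All ValidRow T → ∀ {a b c} → 1 ≤ a → 1 ≤ b → 1 ≤ c →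
    2 * x ≤ suc (a + b + c) → (∀ d → d ∣ x → d ∣ suc (a + b + c) → d ≤ suc (a + b)) →
    ∃ λ v → Path x v (multi x a b c)
  complete-path T comp valid {a} {b} {c} 1≤a 1≤b 1≤c 2x≤v adm
    with represented (2 + x) 2 b 1≤b
  ... | pb , pb∈ , rb with represented (2 ⊔ (x ∸ suc (proj₂ pb))) 1 a 1≤a | represented (3 * x) x c 1≤c
  ... | pa , pa∈ , ra | pc , pc∈ , rc with All.lookup (All.lookup (All.lookup comp pb∈) pa∈) pc∈
  ... | inj₁ exc = contradiction adm (excused-inadmissible pa pb pc ra rb rc exc 2x≤v)
  ... | inj₂ cov = covered-path pa pb pc ra rb rc valid cov

-- From multisets to multiplicities

One-Two-x : ℕ → ℕ → Set
One-Two-x x y = y ≡ 1 ⊎ y ≡ 2 ⊎ y ≡ x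

multiplicities : ∀ {x L} → All (One-Two-x x) L → ∃ λ a → ∃₂ λ b c → L ↭ multi x a b c
multiplicities [] = 0 , 0 , 0 , ↭-refl
multiplicities {x} (y ∷ ys) with multiplicities ys
multiplicities {x} (inj₁ refl ∷ _)        | a , b , c , p = suc a , b , c , prep 1 p
multiplicities {x} (inj₂ (inj₁ refl) ∷ _) | a , b , c , p = a , suc b , c , ↭-trans (prep 2 p) (add₂ x 1 a b c)
multiplicities {x} (inj₂ (inj₂ refl) ∷ _) | a , b , c , p = a , b , suc c , ↭-trans (prep x p) (addₓ x 1 a b c)

tail-∈ : ∀ {y z : ℕ} {L L′} → y ≢ z → L ↭ z ∷ L′ → y ∈ L → y ∈ L′
tail-∈ y≢z p y∈L with ∈-resp-↭ p y∈L
... | here y≡z = contradiction y≡z y≢z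
... | there i  = i

-- One copy each of 1, 2 and `x` is set aside before the rest is counted, which yields the three
-- successors directly. As the three values are distinct, removing one of them leaves the others
-- present.
positive-multiplicities : ∀ {x L} → 2 < x → UnderlyingSet12x x L →
  ∃ λ a → ∃₂ λ b c → L ↭ multi x (suc a) (suc b) (suc c)
positive-multiplicities {x} {L} 2<x U = suc-multi (multiplicities in₃)
  where
  member : ∀ {y} → One-Two-x x y → y ∈ L
  member = Equivalence.from (U _)
  i₁ = member (inj₁ refl)
  p₁ = ∈-─ i₁
  i₂ = tail-∈ (λ ()) p₁ (member (inj₂ (inj₁ refl)))
  p₂ = ↭-trans p₁ (prep 1 (∈-─ i₂))
  iₓ = tail-∈ (>⇒≢ 2<x) (∈-─ i₂) (tail-∈ (>⇒≢ (<-trans (n<1+n 1) 2<x)) p₁ (member (inj₂ (inj₂ refl))))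
  pₓ = ↭-trans p₂ (prep 1 (prep 2 (∈-─ iₓ)))
  in₃ : All (One-Two-x x) (((L Any.─ i₁) Any.─ i₂) Any.─ iₓ)
  in₃ with All-resp-↭ pₓ (All.tabulate (λ {y} → Equivalence.to (U y)))
  ... | _ ∷ _ ∷ _ ∷ os = os
  suc-multi : (∃ λ a → ∃₂ λ b c → ((L Any.─ i₁) Any.─ i₂) Any.─ iₓ ↭ multi x a b c) →
    ∃ λ a → ∃₂ λ b c → L ↭ multi x (suc a) (suc b) (suc c)
  suc-multi (a , b , c , p) = a , b , c , (begin
    L                                             ↭⟨ pₓ ⟩
    1 ∷ 2 ∷ x ∷ (((L Any.─ i₁) Any.─ i₂) Any.─ iₓ) ↭⟨ prep 1 (prep 2 (prep x p)) ⟩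
    1 ∷ 2 ∷ x ∷ multi x a b c                     ↭⟨ prep 1 (prep 2 (addₓ x 1 a b c)) ⟩
    1 ∷ 2 ∷ multi x a b (suc c)                   ↭⟨ prep 1 (add₂ x 1 a b (suc c)) ⟩
    multi x (suc a) (suc b) (suc c)               ∎)
    where open PermutationReasoning

length-multi : ∀ x a b c → length (multi x a b c) ≡ a + b + c
length-multi x a b c = begin
  length (multi x a b c) ≡⟨ List.length-++ (replicate a 1) ⟩
  length (replicate a 1) + length (replicate b 2 ++ replicate c x)
    ≡⟨ cong₂ _+_ (List.length-replicate a) (trans (List.length-++ (replicate b 2))
         (cong₂ _+_ (List.length-replicate b) (List.length-replicate c))) ⟩
  a + (b + c) ≡⟨ +-assoc a b c ⟨
  a + b + c ∎
  where open ≡-Reasoning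

countMultiples-multi : ∀ {d x} a b c → d ∣ x → c ≤ countMultiples d (multi x a b c)
countMultiples-multi {d} {x} a b c d∣x = begin
  c ≡⟨ List.length-replicate c ⟨
  length (replicate c x) ≡⟨ cong length (List.filter-all (d ∣?_) (All.replicate⁺ c d∣x)) ⟨
  length (filter (d ∣?_) (replicate c x)) ≤⟨ m≤n+m _ _ ⟩
  length (filter (d ∣?_) B) + length (filter (d ∣?_) (replicate c x)) ≡⟨ List.length-++ (filter (d ∣?_) B) ⟨
  length (filter (d ∣?_) B ++ filter (d ∣?_) (replicate c x)) ≡⟨ cong length (List.filter-++ (d ∣?_) B (replicate c x)) ⟨
  countMultiples d (B ++ replicate c x) ≡⟨ cong (countMultiples d) (List.++-assoc (replicate a 1) (replicate b 2) _) ⟩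
  countMultiples d (multi x a b c) ∎
  where
  open ≤-Reasoning
  B = replicate a 1 ++ replicate b 2

-- The positive right-hand side excludes `w = 0`, the one value at which `w ∸ 1` loses information.
suc-pred-+suc : ∀ w n c → w ∸ 1 ≡ n + suc c → w ≡ suc (n + suc c)
suc-pred-+suc zero    n c e = contradiction (trans e (+-suc n c)) λ ()
suc-pred-+suc (suc w) n c e = cong suc e

module _ {x : ℕ} (4≤x : 4 ≤ x) {v L} (size : length L ≡ v ∸ 1) (U : UnderlyingSet12x x L) where

  private
    2<x : 2 < x
    2<x = <⇒≤ 4≤x

    elements : All (One-Two-x x) L
    elements = All.tabulate (λ {y} → Equivalence.to (U y))

  elements-≥1 : All (1 ≤_) L
  elements-≥1 = All.map (λ { (inj₁ refl) → ≤-refl ; (inj₂ (inj₁ refl)) → s≤s z≤n ; (inj₂ (inj₂ refl)) → <⇒≤ (<⇒≤ 2<x) }) elements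

  elements-≤x : All (_≤ x) L
  elements-≤x = All.map (λ { (inj₁ refl) → <⇒≤ (<⇒≤ 2<x) ; (inj₂ (inj₁ refl)) → <⇒≤ 2<x ; (inj₂ (inj₂ refl)) → ≤-refl }) elements

  size-multi : ∀ a b c → L ↭ multi x a b (suc c) → v ≡ suc (a + b + suc c)
  size-multi a b c p = suc-pred-+suc v (a + b) c
    (trans (sym size) (trans (↭-length p) (length-multi x a b (suc c))))

  admissible-2x : Admissible v L → 2 * x ≤ v
  admissible-2x (_ , _ , ≤v/2 , _) = begin
    2 * x     ≤⟨ *-monoʳ-≤ 2 (All.lookup ≤v/2 (Equivalence.from (U x) (inj₂ (inj₂ refl)))) ⟩
    2 * (v / 2) ≡⟨ *-comm 2 (v / 2) ⟩
    v / 2 * 2 ≤⟨ m/n*n≤m v 2 ⟩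
    v         ∎
    where open ≤-Reasoning

  -- All copies of `x` are multiples of `d`, so their number is at most `v - d`; the rest of `v` is
  -- `a + b + 1`. A divisor of `v` greater than 2 that does not divide `x` has no multiples in `L`
  -- and restricts nothing.
  admissible-divisor : ∀ a b c → L ↭ multi x a b (suc c) → Admissible v L →
                       ∀ d → d ∣ x → d ∣ v → d ≤ suc (a + b)
  admissible-divisor a b c p (_ , _ , _ , mult) d d∣x d∣v = +-cancelʳ-≤ (suc c) d (suc (a + b)) (begin
    d + suc c                    ≡⟨ +-comm d (suc c) ⟩
    suc c + d                    ≤⟨ m≤o∸n⇒m+n≤o (suc c) d≤v (begin
      suc c                                ≤⟨ countMultiples-multi a b (suc c) d∣x ⟩
      countMultiples d (multi x a b (suc c)) ≡⟨ ↭-length (filter-↭ (d ∣?_) p) ⟨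
      countMultiples d L                   ≤⟨ mult d d∣v ⟩
      v ∸ d                                ∎) ⟩
    v                            ≡⟨ size-multi a b c p ⟩
    suc (a + b) + suc c          ∎)
    where
    open ≤-Reasoning
    d≤v : d ≤ v
    d≤v = ∣⇒≤ {{>-nonZero (subst (0 <_) (sym (size-multi a b c p)) z<s)}} d∣v

  -- The length of the list fixes the number of vertices, which identifies the existential `v′` with
  -- `v`.
  path-resize : ∀ a b c → L ↭ multi x a b (suc c) → (∃ λ v′ → Path x v′ (multi x a b (suc c))) → Path x v L
  path-resize a b c p (v′ , P) = subst (λ w → Path x w L) v′≡v record
    { path = Path.path P ; vertices = Path.vertices P ; edges = ↭-trans (Path.edges P) (↭-sym p) }
    where
    v′≡v : v′ ≡ v
    v′≡v = trans (suc-pred-+suc v′ (a + b) c (trans (sym (path-size P)) (length-multi x a b (suc c)))) (sym (size-multi a b c p))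

  module _ (T : List Row) (complete : Complete x T) (valid : All (ValidRow x) T) where

    realizable⇔admissible : Realizable v L ⇔ Admissible v L
    realizable⇔admissible = go (positive-multiplicities 2<x U)
      where
      go : (∃ λ a → ∃₂ λ b c → L ↭ multi x (suc a) (suc b) (suc c)) → Realizable v L ⇔ Admissible v L
      go (a , b , c , p) = mk⇔
        (realizable⇒admissible (subst (0 <_) (sym v≡) z<s) size elements-≥1)
        -- Admissibility enters twice: it rules out the excused triples, and through `2 * x ≤ v` it
        -- turns lengths measured by `len` into edge lengths of `K_v`.
        (λ adm → path⇒realizable (path-resize (suc a) (suc b) c p
          (complete-path x T {{>-nonZero (<-trans z<s 2<x)}} complete valid z<s z<s z<s
            (subst (2 * x ≤_) v≡ (admissible-2x adm))
            (λ d d∣x d∣v → admissible-divisor (suc a) (suc b) c p adm d d∣x (subst (d ∣_) (sym v≡) d∣v))))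
          (admissible-2x adm) elements-≤x)
        where
        v≡ : v ≡ suc (suc a + suc b + suc c)
        v≡ = size-multi (suc a) (suc b) c p

-- The base paths

-- In all five tables each pair with `a + b + 1 < x` has a row of its own, whose paths grow by `x`
-- at most. Gaps in these rows reflect obstructions: row `1 1` here has no `c` congruent to 1 modulo
-- 4, because 4 would then divide `v = c + 3` and exceed `a + b + 1 = 3`.
table4 : List Row
table4 =
  row 1 3 (
    entry 1 1 3 0 0 3074 ∷ entry 2 1 3 5 0 41822 ∷ entry 3 1 2 6 0 215486 ∷ entry 4 1 2 6 0 1573226 ∷
    entry 5 1 3 6 0 9924650 ∷ []) ∷
  row 1 2 (
    entry 1 1 2 0 0 667 ∷ entry 2 1 2 4 0 3045 ∷ entry 3 1 2 4 0 41668 ∷ entry 4 1 2 4 0 215296 ∷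
    entry 5 1 2 5 0 1571968 ∷ []) ∷
  row 2 1 (
    entry 1 1 0 0 0 115 ∷ entry 2 1 0 0 0 1803 ∷ entry 3 1 0 4 0 39862 ∷ entry 4 1 0 4 0 200164 ∷
    entry 5 1 0 6 0 1435816 ∷ entry 6 1 0 4 0 8887780 ∷ []) ∷
  row 1 1 (
    entry 6 0 0 4 7 1672804 ∷ entry 7 0 0 4 7 8058448 ∷ entry 8 0 0 5 10 60448931 ∷ []) ∷
  []

-- Validity and completeness are decided by evaluation, so nothing rests on the search that produced
-- the paths.
valid4 : All (ValidRow 4) table4
valid4 = toWitness {a? = All.all? (validRow? 4) table4} _

complete4 : Complete 4 table4
complete4 = toWitness {a? = complete? 4 table4} _

-- Rows `1 7` and `1 6` supply the growth by 2 that is missing in rows `1 5` and `1 4` for `c = 1`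
-- and `c = 7`.
table6 : List Row
table6 =
  row 1 7 (
    entry 1 1 9 0 0 4176230 ∷ entry 7 1 15 11 0 427732899422 ∷ []) ∷
  row 1 6 (
    entry 1 1 8 0 0 693878 ∷ entry 7 1 14 7 0 71288350010 ∷ []) ∷
  row 1 5 (
    entry 1 1 0 0 0 111801 ∷ entry 2 1 3 0 0 1510622 ∷ entry 3 1 3 0 0 9448622 ∷ entry 4 1 10 6 0 38036002 ∷
    entry 5 1 3 7 0 279848654 ∷ entry 6 1 2 8 0 2042214650 ∷ entry 7 1 0 10 0 11881358522 ∷
    entry 8 1 3 7 0 77183891234 ∷ entry 9 1 2 7 0 465386538914 ∷ []) ∷
  row 1 4 (
    entry 1 1 0 0 0 18487 ∷ entry 2 1 2 0 0 111585 ∷ entry 3 1 2 0 0 1510468 ∷ entry 4 1 2 6 0 9091138 ∷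
    entry 5 1 2 6 0 54554452 ∷ entry 6 1 2 8 0 279848464 ∷ entry 7 1 0 8 0 1980070192 ∷
    entry 8 1 2 6 0 12863935216 ∷ entry 9 1 2 9 0 77183883820 ∷ []) ∷
  row 2 3 (
    entry 1 1 0 0 0 16315 ∷ entry 2 1 0 0 0 150843 ∷ entry 3 1 0 0 0 168892 ∷ entry 4 1 0 6 0 8887126 ∷
    entry 5 1 0 7 0 51677116 ∷ entry 6 1 0 6 0 259428472 ∷ entry 7 1 0 8 0 1976804200 ∷
    entry 8 1 0 8 0 12233412964 ∷ entry 9 1 0 11 0 76476168064 ∷ []) ∷
  row 1 3 (
    entry 8 0 0 7 12 1733333901 ∷ entry 9 0 0 8 0 10447015533 ∷ entry 10 0 0 7 5 73555003558 ∷
    entry 11 0 0 8 15 470051174691 ∷ entry 12 0 0 0 3 2248162656065 ∷ entry 18 0 0 11 17 129671752674148474 ∷ []) ∷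
  row 3 2 (
    entry 1 1 0 0 0 17539 ∷ entry 2 1 0 0 0 142635 ∷ entry 3 1 0 0 0 1479406 ∷ entry 4 1 0 6 0 8591638 ∷
    entry 5 1 0 6 0 56590750 ∷ entry 6 1 0 7 0 248790904 ∷ entry 7 1 0 8 0 2037267784 ∷
    entry 8 1 0 7 0 12223319716 ∷ entry 9 1 0 7 0 69048655948 ∷ []) ∷
  row 2 2 (
    entry 8 0 0 7 0 1565065149 ∷ entry 9 0 0 6 10 13027605546 ∷ entry 10 0 0 8 0 78230961183 ∷
    entry 11 0 0 9 13 428384039035 ∷ entry 12 0 0 9 2 2256887836515 ∷ []) ∷
  row 1 2 (
    entry 9 0 0 6 12 1489483467 ∷ entry 10 0 0 8 5 13060449052 ∷ entry 11 0 0 8 6 78343915366 ∷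
    entry 12 0 0 0 11 470183560010 ∷ entry 13 0 0 6 1 2820916401544 ∷ entry 18 0 0 10 16 21936950386405900 ∷ []) ∷
  row 4 1 (
    entry 1 1 0 0 0 4147 ∷ entry 2 1 0 0 0 62283 ∷ entry 3 1 0 0 0 1434934 ∷ entry 4 1 0 0 0 6980518 ∷
    entry 5 1 0 6 0 51689278 ∷ entry 6 1 0 7 0 259412692 ∷ entry 7 1 0 6 0 1860814792 ∷
    entry 8 1 0 9 0 11517321124 ∷ entry 9 1 0 10 0 76476075976 ∷ entry 10 1 0 10 0 414668271268 ∷ []) ∷
  row 3 1 (
    entry 8 0 0 0 4 2176777512 ∷ entry 9 0 0 8 12 9063206807 ∷ entry 10 0 0 0 13 78049702620 ∷
    entry 11 0 0 7 14 468661231993 ∷ entry 12 0 0 8 12 2256886627799 ∷ entry 14 0 0 9 17 101555166957911 ∷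
    entry 16 0 0 9 4 2924874468941680 ∷ []) ∷
  row 2 1 (
    entry 9 0 0 0 5 1511647917 ∷ entry 10 0 0 6 6 10420337471 ∷ entry 11 0 0 8 4 78331784800 ∷
    entry 12 0 0 10 1 376030414537 ∷ entry 13 0 0 7 12 2753193178823 ∷ entry 15 0 0 13 18 101555167746667 ∷ []) ∷
  row 1 1 (
    entry 10 0 0 7 11 1919801087 ∷ entry 11 0 0 7 11 10448375068 ∷ entry 12 0 0 7 5 62653033180 ∷
    entry 13 0 0 8 7 463218161356 ∷ entry 14 0 0 7 13 2821109711284 ∷ []) ∷
  []

valid6 : All (ValidRow 6) table6
valid6 = toWitness {a? = All.all? (validRow? 6) table6} _

complete6 : Complete 6 table6
complete6 = toWitness {a? = complete? 6 table6} _

-- For even `b` a path that can be grown by 2 appears at `b = 6` if `c` is even, but only at `b = 8`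
-- if `c` is odd.
table8 : List Row
table8 =
  row 1 9 (
    entry 1 1 10 0 0 145989734 ∷ entry 5 1 2 0 0 360523351790 ∷ entry 7 1 4 12 0 10298158885178 ∷
    entry 9 1 3 14 0 603142022662790 ∷ entry 13 1 3 15 0 781672959718503638 ∷ []) ∷
  row 1 8 (
    entry 1 1 10 0 0 24318662 ∷ entry 3 1 11 0 0 875987914 ∷ entry 5 1 14 0 0 58560206602 ∷
    entry 7 1 3 11 0 2646827808278 ∷ entry 9 1 2 8 0 100030656055234 ∷ entry 11 1 3 15 0 3618852075525326 ∷
    entry 13 1 2 10 0 129641032520879572 ∷ []) ∷
  row 1 7 (
    entry 1 1 0 0 0 4030041 ∷ entry 2 1 3 0 0 54413342 ∷ entry 3 1 2 0 0 235810420 ∷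
    entry 4 1 3 0 0 2041639226 ∷ entry 5 1 0 0 0 10135708730 ∷ entry 6 1 2 9 0 70712376110 ∷
    entry 7 1 0 10 0 292683653584 ∷ entry 8 1 2 10 0 2646829440314 ∷ entry 9 1 0 12 0 15398359898426 ∷
    entry 10 1 3 10 0 100030665677858 ∷ entry 11 1 2 12 0 404710535395756 ∷
    entry 12 1 2 10 0 3618852134267402 ∷ entry 13 1 0 10 0 21611105305598474 ∷ []) ∷
  row 1 6 (
    entry 1 1 0 0 0 670807 ∷ entry 2 1 2 0 0 4028745 ∷ entry 3 1 0 0 0 37942324 ∷ entry 4 1 2 0 0 340265428 ∷
    entry 5 1 0 0 0 1669068850 ∷ entry 6 1 2 8 0 11785349362 ∷ entry 7 1 0 8 0 71283157684 ∷
    entry 8 1 2 10 0 362713283152 ∷ entry 9 1 0 10 0 2566228075696 ∷ entry 10 1 2 10 0 16671775933360 ∷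
    entry 11 1 0 11 0 95342239035820 ∷ entry 12 1 2 14 0 603142012300204 ∷
    entry 13 1 0 10 0 3326046616747504 ∷ []) ∷
  row 2 5 (
    entry 1 1 0 0 0 657835 ∷ entry 2 1 0 0 0 5943963 ∷ entry 3 1 0 0 0 6090532 ∷ entry 4 1 0 0 0 195649756 ∷
    entry 5 1 0 0 0 1976803726 ∷ entry 6 1 0 8 0 12233412310 ∷ entry 7 1 0 8 0 71280847270 ∷
    entry 8 1 0 10 0 361978171000 ∷ entry 9 1 0 9 0 2566110502504 ∷ entry 10 1 0 11 0 15880261125988 ∷
    entry 11 1 0 8 0 92229780129868 ∷ entry 12 1 0 11 0 597487372391152 ∷ entry 13 1 0 10 0 3601694546411392 ∷ []) ∷
  row 1 5 (
    entry 10 0 0 0 5 2252968728447 ∷ entry 11 0 0 8 5 13541270360632 ∷ entry 12 0 0 0 6 101555469517382 ∷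
    entry 13 0 0 0 16 487409394245279 ∷ entry 14 0 0 0 8 3649951988173048 ∷
    entry 15 0 0 0 15 17549536697018188 ∷ entry 16 0 0 0 8 105295106163709401 ∷
    entry 18 0 0 0 17 4738381338124757682 ∷ entry 20 0 0 18 7 170581690940615021199 ∷
    entry 21 0 0 17 24 818555375111020816679 ∷ entry 22 0 0 10 28 4912753690319090079644 ∷
    entry 23 0 0 11 25 29476522629132524346884 ∷ entry 24 0 0 15 21 201422904629367944595479 ∷
    entry 26 0 0 17 26 6366920358870669813443684 ∷ []) ∷
  row 3 4 (
    entry 1 1 0 0 0 665539 ∷ entry 2 1 0 0 0 5896875 ∷ entry 3 1 0 0 0 29045326 ∷ entry 4 1 0 0 0 85461994 ∷
    entry 5 1 0 0 0 1978482790 ∷ entry 6 1 0 8 0 12223319062 ∷ entry 7 1 0 9 0 73341627964 ∷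
    entry 8 1 0 9 0 362683609492 ∷ entry 9 1 0 11 0 2640299137408 ∷ entry 10 1 0 10 0 15879898313380 ∷
    entry 11 1 0 12 0 95050769104972 ∷ entry 12 1 0 8 0 570291208044364 ∷ entry 13 1 0 9 0 3584992407705676 ∷ []) ∷
  row 2 4 (
    entry 10 0 0 0 4 1302721590876 ∷ entry 11 0 0 0 12 15841823682842 ∷ entry 12 0 0 10 0 81185270307102 ∷
    entry 13 0 0 0 8 554973849133156 ∷ entry 14 0 0 8 2 2894457192911548 ∷
    entry 15 0 0 0 8 15805957856438411 ∷ entry 16 0 0 0 6 131621703819287439 ∷
    entry 18 0 0 9 22 4738381338288287312 ∷ entry 19 0 0 13 23 22744230386575626522 ∷
    entry 21 0 0 14 23 818785711731772989544 ∷ entry 23 0 0 20 5 29340057235038790124600 ∷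
    entry 24 0 0 9 16 176532082166879420937562 ∷ []) ∷
  row 1 4 (
    entry 11 0 0 8 10 1760472713531 ∷ entry 12 0 0 0 6 13541322515414 ∷ entry 13 0 0 0 5 67706637684967 ∷
    entry 14 0 0 9 6 609187300451410 ∷ entry 15 0 0 0 14 3601835748476219 ∷
    entry 16 0 0 13 5 17549560339077442 ∷ entry 17 0 0 12 18 104199261715168799 ∷
    entry 20 0 0 0 8 22744230415184736287 ∷ entry 21 0 0 14 12 170186659948005044224 ∷
    entry 23 0 0 16 27 5764076370938444119186 ∷ entry 28 0 0 19 31 47751966659666556643379486 ∷ []) ∷
  row 4 3 (
    entry 1 1 0 0 0 151747 ∷ entry 2 1 0 0 0 2242533 ∷ entry 3 1 0 0 0 5394364 ∷ entry 4 1 0 0 0 251300998 ∷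
    entry 5 1 0 0 0 1860814318 ∷ entry 6 1 0 8 0 11517320470 ∷ entry 7 1 0 8 0 71164951102 ∷
    entry 8 1 0 8 0 336219299860 ∷ entry 9 1 0 8 0 2411619282856 ∷ entry 10 1 0 12 0 14927183166628 ∷
    entry 11 1 0 12 0 86818178310220 ∷ entry 12 1 0 9 0 537352137736012 ∷ entry 13 1 0 11 0 3568075591060864 ∷ []) ∷
  row 3 3 (
    entry 10 0 0 8 12 2479636080287 ∷ entry 11 0 0 0 1 13541283801072 ∷ entry 12 0 0 0 3 101152414635591 ∷
    entry 13 0 0 11 18 597487254718487 ∷ entry 14 0 0 0 5 2924875959398684 ∷
    entry 15 0 0 8 15 15789187700278172 ∷ entry 16 0 0 10 19 94735127580268755 ∷
    entry 19 0 0 11 8 8529081801166036060 ∷ entry 20 0 0 14 3 170579168751123917132 ∷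
    entry 22 0 0 11 25 4912753384139386811804 ∷ []) ∷
  row 2 3 (
    entry 11 0 0 9 15 2182768486715 ∷ entry 12 0 0 10 12 13535231654327 ∷ entry 13 0 0 0 14 100524819405284 ∷
    entry 14 0 0 10 7 600330777428128 ∷ entry 15 0 0 8 6 2639524103615488 ∷
    entry 16 0 0 13 17 17549527570329101 ∷ entry 17 0 0 0 21 119919018995829936 ∷
    entry 21 0 0 10 23 136465371823311891621 ∷ entry 25 0 0 9 28 176859135776585980656443 ∷ []) ∷
  row 1 3 (
    entry 12 0 0 8 7 2821109881676 ∷ entry 13 0 0 0 17 16926651021364 ∷ entry 14 0 0 0 4 81244041751736 ∷
    entry 15 0 0 10 2 609108946374514 ∷ entry 16 0 0 11 14 3655907021702039 ∷
    entry 17 0 0 10 1 21936950397615004 ∷ entry 18 0 0 15 22 105295106163716488 ∷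
    entry 21 0 0 10 16 28140720273204940106 ∷ entry 22 0 0 8 8 170581728175219601867 ∷ []) ∷
  row 5 2 (
    entry 1 1 0 0 0 864691 ∷ entry 2 1 0 0 0 17355 ∷ entry 3 1 0 0 0 12112828 ∷ entry 4 1 0 0 0 260816782 ∷
    entry 5 1 0 0 0 2037266902 ∷ entry 6 1 0 8 0 11134368022 ∷ entry 7 1 0 9 0 69045170236 ∷
    entry 8 1 0 9 0 322412576632 ∷ entry 9 1 0 9 0 2640299045320 ∷ entry 10 1 0 9 0 15841421110180 ∷
    entry 11 1 0 11 0 89482559889484 ∷ entry 12 1 0 12 0 519485108322124 ∷ entry 13 1 0 8 0 3584845522177408 ∷ []) ∷
  row 4 2 (
    entry 10 0 0 0 0 1890825694996 ∷ entry 11 0 0 0 4 15855681050015 ∷ entry 12 0 0 9 15 92526304420943 ∷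
    entry 13 0 0 0 19 608323953799584 ∷ entry 14 0 0 9 18 3649951959075360 ∷
    entry 15 0 0 13 21 21510394650203743 ∷ entry 16 0 0 12 1 115981470511635859 ∷
    entry 18 0 0 16 13 4738381337960481724 ∷ entry 19 0 0 13 0 26692881315003194443 ∷
    entry 21 0 0 11 26 1023442105999335305760 ∷ []) ∷
  row 3 2 (
    entry 11 0 0 0 0 1959104097620 ∷ entry 12 0 0 0 6 16926615671951 ∷ entry 13 0 0 0 5 81241394661363 ∷
    entry 14 0 0 0 7 485229376974712 ∷ entry 15 0 0 9 17 2911330551439836 ∷
    entry 16 0 0 0 12 21934975863254627 ∷ entry 17 0 0 15 0 131189509804439929 ∷
    entry 19 0 0 9 12 4738157906415975017 ∷ entry 20 0 0 15 17 22744228637239792151 ∷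
    entry 21 0 0 8 25 136465199722970107059 ∷ entry 22 0 0 16 10 818778347688497905756 ∷
    entry 24 0 0 9 22 29453778397030652264419 ∷ []) ∷
  row 2 2 (
    entry 12 0 0 0 5 1954315181056 ∷ entry 13 0 0 8 17 13541289259837 ∷ entry 14 0 0 0 2 101309186640351 ∷
    entry 15 0 0 8 12 600331172372213 ∷ entry 16 0 0 13 1 3424827427650647 ∷
    entry 17 0 0 14 11 17549554417208896 ∷ entry 18 0 0 9 21 112528431988604910 ∷
    entry 20 0 0 12 1 3282499047488539842 ∷ entry 22 0 0 16 12 136399571691560034322 ∷ []) ∷
  row 1 2 (
    entry 13 0 0 0 12 2230403740859 ∷ entry 14 0 0 0 6 16926650710701 ∷ entry 15 0 0 0 2 80776038924257 ∷
    entry 16 0 0 8 4 487346694184108 ∷ entry 17 0 0 13 1 3656158438881021 ∷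
    entry 18 0 0 12 12 17549560250282177 ∷ entry 19 0 0 13 8 105295106184767980 ∷
    entry 21 0 0 12 24 2211214156563087172 ∷ entry 22 0 0 18 19 22744230415671984065 ∷
    entry 23 0 0 15 3 136465382543009500797 ∷ []) ∷
  row 6 1 (
    entry 1 1 0 0 0 149299 ∷ entry 2 1 0 0 0 513 ∷ entry 3 1 0 0 0 51657526 ∷ entry 4 1 0 0 0 251298550 ∷
    entry 5 1 0 0 0 1860813910 ∷ entry 6 1 0 0 0 3211664440 ∷ entry 7 1 0 8 0 66989332414 ∷
    entry 8 1 0 8 0 336198848980 ∷ entry 9 1 0 9 0 2411615967688 ∷ entry 10 1 0 8 0 14926446934948 ∷
    entry 11 1 0 10 0 99112994462152 ∷ entry 12 1 0 11 0 537352134368932 ∷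
    entry 13 1 0 14 0 3568075590968776 ∷ entry 14 1 0 13 0 19346762864287396 ∷ []) ∷
  row 5 1 (
    entry 10 0 0 0 6 2821056432056 ∷ entry 11 0 0 0 1 13539948881454 ∷ entry 12 0 0 0 16 86890003719339 ∷
    entry 13 0 0 0 15 594681260241752 ∷ entry 14 0 0 0 19 2917027590836712 ∷
    entry 15 0 0 12 5 21936582817014988 ∷ entry 16 0 0 0 15 90875849226868885 ∷
    entry 18 0 0 16 0 3410078665055403816 ∷ entry 19 0 0 11 0 22744219703724627390 ∷
    entry 20 0 0 17 23 133464319676051127407 ∷ entry 21 0 0 19 6 1023398232568219379245 ∷
    entry 22 0 0 15 26 4909752796316755049221 ∷ entry 24 0 0 11 1 215747979096459860312587 ∷ []) ∷
  row 4 1 (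
    entry 11 0 0 9 7 2250538954052 ∷ entry 12 0 0 0 15 5633505966185 ∷ entry 13 0 0 8 4 79358953590274 ∷
    entry 14 0 0 0 7 485606809141478 ∷ entry 15 0 0 0 7 2620240321464386 ∷
    entry 16 0 0 9 17 21925101978586368 ∷ entry 17 0 0 0 10 105297363065797709 ∷
    entry 20 0 0 17 7 22744230194293224642 ∷ entry 22 0 0 13 2 1003589153847275162356 ∷
    entry 23 0 0 15 1 6121041012546077187504 ∷ entry 25 0 0 12 23 220186894734199544793858 ∷ []) ∷
  row 3 1 (
    entry 12 0 0 8 16 1954315181155 ∷ entry 13 0 0 0 16 13491394547207 ∷ entry 14 0 0 9 18 101152456632558 ∷
    entry 15 0 0 0 16 608952236257722 ∷ entry 16 0 0 0 3 3641480396764372 ∷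
    entry 17 0 0 9 17 21936949108568035 ∷ entry 18 0 0 10 13 105297363072515543 ∷
    entry 21 0 0 15 24 22744222524836013469 ∷ entry 23 0 0 13 23 818781318887505143471 ∷
    entry 24 0 0 11 1 4912753487203968351408 ∷ []) ∷
  row 2 1 (
    entry 13 0 0 9 16 2252969717568 ∷ entry 14 0 0 9 2 16915340175964 ∷ entry 15 0 0 0 14 99585179730600 ∷
    entry 16 0 0 8 3 608952228211900 ∷ entry 17 0 0 10 18 3655124026714362 ∷
    entry 18 0 0 12 0 17468311023219912 ∷ entry 19 0 0 14 9 103591155800664556 ∷
    entry 23 0 0 14 3 136464895055556134088 ∷ []) ∷
  row 1 1 (
    entry 14 0 0 9 0 2488062210047 ∷ entry 15 0 0 10 1 13541321070604 ∷ entry 16 0 0 9 13 80307595364975 ∷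
    entry 18 0 0 12 9 3647695110339700 ∷ entry 19 0 0 11 0 17549560281635020 ∷
    entry 20 0 0 15 3 105295106185887592 ∷ []) ∷
  []

valid8 : All (ValidRow 8) table8
valid8 = toWitness {a? = All.all? (validRow? 8) table8} _

complete8 : Complete 8 table8
complete8 = toWitness {a? = complete? 8 table8} _

-- The case `a = 1` can be exceptional, which is why the threshold for `a` is at least 2. Row `1 8`
-- has nothing for `c = 5`, where `v = 15 < 20`, and its paths for `c = 15` and `c = 16` cannot be
-- grown by 1. Row `2 8` takes over from `a = 2` on.
table10 : List Row
table10 =
  row 1 11 (
    entry 1 1 13 0 0 5229503078 ∷ entry 3 1 14 0 0 188266606906 ∷ entry 5 1 16 0 0 12648164304734 ∷
    entry 7 1 2 0 0 470077480362038 ∷ entry 11 1 2 16 0 781672086407155334 ∷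
    entry 15 1 3 17 0 1013048156696368473302 ∷ entry 16 1 3 20 0 6048532047859304528246 ∷
    entry 17 1 3 19 0 36469733643117676045526 ∷ []) ∷
  row 1 10 (
    entry 1 1 12 0 0 871506086 ∷ entry 3 1 14 0 0 31377315514 ∷ entry 5 1 16 0 0 2108024584762 ∷
    entry 7 1 2 0 0 91639831998580 ∷ entry 9 1 19 11 0 3325813306079668 ∷
    entry 11 1 22 12 0 119730018639498676 ∷ entry 13 1 23 15 0 4310280694984160944 ∷
    entry 15 1 2 17 0 104173039286337809836 ∷ entry 16 1 2 13 0 1008088674630156727358 ∷
    entry 17 1 2 10 0 6048532047862760338210 ∷ []) ∷
  row 1 9 (
    entry 1 1 0 0 0 145112601 ∷ entry 2 1 2 0 0 1305983866 ∷ entry 3 1 0 0 0 9759156830 ∷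
    entry 4 1 3 0 0 73502068346 ∷ entry 5 1 0 0 0 360538467038 ∷ entry 6 1 2 0 0 1851567991474 ∷
    entry 7 1 0 0 0 12649082175998 ∷ entry 8 1 3 11 0 91643582169134 ∷ entry 9 1 19 10 0 452663526844240 ∷
    entry 10 1 3 13 0 3430295247746618 ∷ entry 11 1 0 11 0 19955003066544698 ∷
    entry 12 1 3 12 0 129639755053600802 ∷ entry 13 1 23 13 0 718380115587622576 ∷
    entry 14 1 2 16 0 4690032520557538826 ∷ entry 15 1 0 18 0 25863338955377614346 ∷
    entry 16 1 0 17 0 113431059213771138544 ∷ entry 17 1 0 18 0 932364052240712945068 ∷ []) ∷
  row 2 8 (
    entry 5 1 0 0 0 189181764348 ∷ entry 15 1 0 14 0 25861090916599151498 ∷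
    entry 16 1 0 18 0 168830373979242051362 ∷ []) ∷
  row 1 8 (
    entry 1 1 0 0 0 24180247 ∷ entry 2 1 2 0 0 145104825 ∷ entry 3 1 0 0 0 1366433044 ∷
    entry 4 1 2 0 0 11755388218 ∷ entry 6 1 2 0 0 423350834602 ∷ entry 7 1 0 0 0 2163229138354 ∷
    entry 8 1 2 10 0 15273928681906 ∷ entry 9 1 0 10 0 92383687875508 ∷ entry 10 1 2 12 0 470077483201360 ∷
    entry 11 1 0 12 0 3325833641951920 ∷ entry 12 1 2 11 0 21606625781800624 ∷
    entry 13 1 0 14 0 119737659268065196 ∷ entry 14 1 2 13 0 777838537628206768 ∷
    entry 15 0 0 11 0 4668163346757934017 ∷ entry 16 0 0 16 13 28422244472893122472 ∷
    entry 17 1 0 16 0 168047955313458032044 ∷ []) ∷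
  row 2 7 (
    entry 1 1 0 0 0 24102475 ∷ entry 2 1 0 0 0 217062363 ∷ entry 3 1 0 0 0 898202542 ∷
    entry 4 1 0 0 0 6273197626 ∷ entry 5 1 0 0 0 37982210926 ∷ entry 6 1 0 0 0 440984708650 ∷
    entry 7 1 0 0 0 2189303721514 ∷ entry 8 1 0 10 0 15880261125334 ∷ entry 9 1 0 10 0 92384150258854 ∷
    entry 10 1 0 10 0 470076777762628 ∷ entry 11 1 0 12 0 3325829409319528 ∷
    entry 12 1 0 12 0 20581745727889252 ∷ entry 13 1 0 14 0 119724451608201292 ∷
    entry 14 1 0 15 0 740909463097470796 ∷ entry 15 1 0 17 0 4310522714672793676 ∷
    entry 16 1 0 13 0 28140194196063325540 ∷ entry 17 1 0 18 0 168047922298494517120 ∷ []) ∷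
  row 1 7 (
    entry 12 0 0 0 12 1794053499663032 ∷ entry 13 0 0 10 21 19955003066696330 ∷
    entry 14 0 0 0 19 104072996999961817 ∷ entry 15 0 0 0 13 778030355686076512 ∷
    entry 16 0 0 0 22 3147038335381128682 ∷ entry 17 0 0 15 0 28422244472893123233 ∷
    entry 18 0 0 0 14 168146726416869684912 ∷ entry 19 0 0 0 9 814950348896188350719 ∷
    entry 20 0 0 0 12 4911920167447404145062 ∷ entry 22 0 0 14 24 162529590564032265111644 ∷
    entry 24 0 0 10 23 7958658582808840583372703 ∷ entry 25 0 0 10 28 47732315644397398589458415 ∷
    entry 26 0 0 21 32 283858850374300473115357844 ∷ entry 28 0 0 0 28 8251539531678288141134676246 ∷
    entry 29 0 0 13 30 61886548790942684311938181161 ∷ entry 30 0 0 18 31 365818266186464327222865503600 ∷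
    entry 38 0 0 35 18 498939060077481065336150517823286199 ∷ []) ∷
  row 3 6 (
    entry 1 1 0 0 0 24149059 ∷ entry 2 1 0 0 0 216781995 ∷ entry 3 1 0 0 0 862558396 ∷
    entry 4 1 0 0 0 7039072234 ∷ entry 5 1 0 0 0 37992286030 ∷ entry 6 1 0 0 0 175188122332 ∷
    entry 7 1 0 0 0 1368065130454 ∷ entry 8 1 0 10 0 15879898312726 ∷ entry 9 1 0 10 0 92384210724958 ∷
    entry 10 1 0 10 0 470037957917560 ∷ entry 11 1 0 12 0 3325831586099272 ∷
    entry 12 1 0 14 0 20581732667179684 ∷ entry 13 1 0 14 0 119727272597176396 ∷
    entry 14 1 0 16 0 740892535712431948 ∷ entry 15 1 0 12 0 4310539641211306060 ∷
    entry 16 1 0 13 0 25839747105422159692 ∷ entry 17 1 0 11 0 168047939225153825704 ∷ []) ∷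
  row 2 6 (
    entry 12 0 0 0 0 2269888758466528 ∷ entry 13 0 0 0 20 17549539178921355 ∷
    entry 14 0 0 0 6 131584167403741803 ∷ entry 15 0 0 0 4 787780222232752736 ∷
    entry 16 0 0 0 3 3784115515166730039 ∷ entry 17 0 0 11 6 28123158872009177692 ∷
    entry 18 0 0 0 1 155418894326887866368 ∷ entry 19 0 0 17 0 960311880141208307337 ∷
    entry 20 0 0 15 11 6140514443676558277450 ∷ entry 22 0 0 15 27 176850606690135259576717 ∷
    entry 23 0 0 21 6 1029426613167197537328747 ∷ entry 24 0 0 23 31 3979330265403195070482155 ∷
    entry 25 0 0 0 10 37126430811372478660319188 ∷ entry 26 0 0 15 5 261043776964264609628369596 ∷
    entry 28 0 0 24 33 10161618504547743232097458112 ∷ entry 35 0 0 25 39 2887378820390245867639203764807941 ∷ []) ∷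
  row 1 6 (
    entry 13 0 0 0 6 1688180974707899 ∷ entry 14 0 0 10 15 14398770571110599 ∷
    entry 15 0 0 0 1 104078630532530610 ∷ entry 16 0 0 10 18 631784177031995654 ∷
    entry 17 0 0 0 19 4690038770165525596 ∷ entry 18 0 0 0 6 28430288021088198518 ∷
    entry 19 0 0 10 19 135833589333749755124 ∷ entry 20 0 0 0 12 818792295222134890148 ∷
    entry 21 0 0 0 20 4912753770474745474103 ∷ entry 23 0 0 12 23 217747576021231581928892 ∷
    entry 25 0 0 23 14 7937166232733917367966812 ∷ entry 27 0 0 0 22 286493377065614680860393894 ∷
    entry 28 0 0 0 7 1719070799748332314423134339 ∷ entry 30 0 0 12 34 61886548790942665407039108309 ∷
    entry 31 0 0 25 37 371319292745659242360817673876 ∷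
    entry 37 0 0 32 25 17324087262676683625437535739346016 ∷
    entry 38 0 0 26 2 103945637534048875584804556348635254 ∷ []) ∷
  row 4 5 (
    entry 1 1 0 0 0 23682067 ∷ entry 2 1 0 0 0 212285313 ∷ entry 3 1 0 0 0 194207524 ∷
    entry 4 1 0 0 0 7034486236 ∷ entry 5 1 0 0 0 59886460810 ∷ entry 6 1 0 0 0 350743502422 ∷
    entry 7 1 0 0 0 2561937116092 ∷ entry 8 1 0 0 0 15871975609144 ∷ entry 9 1 0 10 0 92379978090046 ∷
    entry 10 1 0 10 0 470051019155668 ∷ entry 11 1 0 11 0 3325679211242440 ∷
    entry 12 1 0 14 0 20547435274615972 ∷ entry 13 1 0 15 0 119529790550089804 ∷
    entry 14 1 0 14 0 696483463233082096 ∷ entry 15 1 0 11 0 4667796132149161288 ∷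
    entry 16 1 0 15 0 26629477249386004300 ∷ entry 17 1 0 11 0 168040660753076822092 ∷
    entry 18 1 0 12 0 1013045790542327221924 ∷ []) ∷
  row 3 5 (
    entry 12 0 0 0 20 2924430393929028 ∷ entry 13 0 0 0 15 20595042685856157 ∷
    entry 14 0 0 0 22 105266644320125808 ∷ entry 15 0 0 0 22 778029105472266104 ∷
    entry 16 0 0 11 22 4730329883677009719 ∷ entry 17 0 0 0 12 22704743581889928750 ∷
    entry 18 0 0 10 21 159788747430098953959 ∷ entry 19 0 0 18 27 1023487809624082696571 ∷
    entry 20 0 0 15 11 6140521024822479956572 ∷ entry 22 0 0 17 30 201115857523722702074046 ∷
    entry 23 0 0 17 25 1326443083018113875102822 ∷ entry 24 0 0 10 24 7958097242565636019899495 ∷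
    entry 25 0 0 14 33 47751956234853528374495036 ∷ entry 27 0 0 0 7 1718989739308867060791511100 ∷
    entry 37 0 0 32 8 83156510020872147361669556179540743 ∷ []) ∷
  row 2 5 (
    entry 13 0 0 11 3 2374310095515616 ∷ entry 14 0 0 0 2 10134112474011047 ∷
    entry 15 0 0 0 5 131570923841750502 ∷ entry 16 0 0 0 18 628771233061692921 ∷
    entry 17 0 0 0 24 3787774500959218093 ∷ entry 18 0 0 0 15 22638628051870228886 ∷
    entry 19 0 0 12 25 167264856164722980248 ∷ entry 20 0 0 13 1 818543481831467502645 ∷
    entry 21 0 0 14 23 4773917248407860297915 ∷ entry 24 0 0 19 28 1061121521680764904455172 ∷
    entry 25 0 0 19 32 7767063709930171090668567 ∷ entry 26 0 0 12 32 38196660572224319396560791 ∷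
    entry 27 0 0 24 11 229208621125898005189823492 ∷ entry 28 0 0 0 23 1375256617051948259605277588 ∷
    entry 38 0 0 25 15 103944820631604358021292192174210140 ∷ []) ∷
  row 1 5 (
    entry 14 0 0 0 15 2281572637505644 ∷ entry 15 0 0 0 16 16452712717647398 ∷
    entry 16 0 0 13 21 131396015045938148 ∷ entry 17 0 0 10 9 789730221510801634 ∷
    entry 18 0 0 0 21 4730335532067352178 ∷ entry 19 0 0 12 6 22744230415475454988 ∷
    entry 20 0 0 0 7 136462457577607501369 ∷ entry 21 0 0 15 25 1008327548744048485274 ∷
    entry 22 0 0 0 1 4912753771571729770021 ∷ entry 24 0 0 21 3 207427373422818533099684 ∷
    entry 25 0 0 10 14 1326443517997997729743889 ∷ entry 28 0 0 0 9 229208416370756051487601769 ∷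
    entry 30 0 0 27 0 8237214248792574744757959939 ∷ entry 32 0 0 27 2 297055434196527393255112942228 ∷
    entry 38 0 0 15 11 17324267421313077863334037240706908 ∷ []) ∷
  row 5 4 (
    entry 1 1 0 0 0 23959411 ∷ entry 2 1 0 0 0 212284875 ∷ entry 3 1 0 0 0 899879158 ∷
    entry 4 1 0 0 0 9827788732 ∷ entry 5 1 0 0 0 37992285622 ∷ entry 6 1 0 0 0 363803622286 ∷
    entry 7 1 0 0 0 2489923024366 ∷ entry 8 1 0 10 0 15384296818966 ∷ entry 9 1 0 10 0 89482675749820 ∷
    entry 10 1 0 10 0 417847415111800 ∷ entry 11 1 0 11 0 3325757572047304 ∷
    entry 12 1 0 12 0 20580348212898724 ∷ entry 13 1 0 13 0 115969547791030348 ∷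
    entry 14 1 0 11 0 717769810361482048 ∷ entry 15 1 0 11 0 4646150155888336972 ∷
    entry 16 1 0 12 0 26607540377832017572 ∷ entry 17 1 0 18 0 167254552842571904896 ∷ []) ∷
  row 4 4 (
    entry 12 0 0 0 3 2503735042823499 ∷ entry 13 0 0 0 1 20594788002279743 ∷
    entry 14 0 0 0 18 131296708031920128 ∷ entry 15 0 0 0 4 778028722371524237 ∷
    entry 16 0 0 0 12 3421940570077403991 ∷ entry 17 0 0 0 21 22743731076919727333 ∷
    entry 18 0 0 11 20 136463674361610382394 ∷ entry 19 0 0 10 26 739187487692973680907 ∷
    entry 20 0 0 13 28 5576782342529338047486 ∷ entry 22 0 0 21 7 176859135776584805335603 ∷
    entry 23 0 0 13 22 1245383070856220945106044 ∷ entry 24 0 0 22 6 5734411837551677566234124 ∷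
    entry 25 0 0 23 0 47746644426397235810229674 ∷ entry 26 0 0 11 32 286509548173873075784605013 ∷
    entry 27 0 0 11 22 1718916048004130521970005947 ∷ []) ∷
  row 3 4 (
    entry 13 0 0 0 4 3649951998113553 ∷ entry 14 0 0 0 21 17549262728304915 ∷
    entry 15 0 0 11 6 95059174281945532 ∷ entry 16 0 0 0 21 774343482124139986 ∷
    entry 17 0 0 15 4 3790215137611951851 ∷ entry 18 0 0 10 21 22737649008963658211 ∷
    entry 19 0 0 11 15 170511527900055678647 ∷ entry 20 0 0 0 8 1023489908672325944577 ∷
    entry 21 0 0 14 28 4858244836620641468463 ∷ entry 23 0 0 10 30 176859135776575439037043 ∷
    entry 24 0 0 0 5 1326443518312551485466091 ∷ entry 26 0 0 20 31 47751904111338490394753073 ∷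
    entry 30 0 0 19 0 49509239032498639530820438484 ∷ entry 34 0 0 24 5 80204967232514323588685307361359 ∷ []) ∷
  row 2 4 (
    entry 14 0 0 0 6 2911356690965576 ∷ entry 15 0 0 0 20 21936902315808860 ∷
    entry 16 0 0 0 11 102370927376061299 ∷ entry 17 0 0 11 2 631294245035769124 ∷
    entry 18 0 0 12 0 3787768294590447801 ∷ entry 19 0 0 13 0 25902052493849218101 ∷
    entry 20 0 0 16 12 170570028148664777188 ∷ entry 21 0 0 11 25 1023490368746598317310 ∷
    entry 22 0 0 17 1 4912753771571832795896 ∷ entry 24 0 0 17 0 176859135776586676795641 ∷
    entry 25 0 0 16 29 1245383081046069936365168 ∷ entry 26 0 0 11 29 7472298425137318738250900 ∷ []) ∷
  row 1 4 (
    entry 15 0 0 0 2 2436404553068071 ∷ entry 16 0 0 0 6 17549558513895050 ∷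
    entry 17 0 0 0 13 129671752311420920 ∷ entry 18 0 0 0 14 631784177421675476 ∷
    entry 19 0 0 10 1 4736431244937053344 ∷ entry 20 0 0 0 8 22744230415127774225 ∷
    entry 21 0 0 0 8 136464285696009614905 ∷ entry 22 0 0 11 17 818792295218439738785 ∷
    entry 23 0 0 0 13 5595080684290165215013 ∷ entry 25 0 0 14 24 176850606690177675158421 ∷
    entry 26 0 0 15 28 1326443518321943938770117 ∷ entry 27 0 0 0 22 6366928256172935734283622 ∷
    entry 28 0 0 17 1 47751966659663735425989566 ∷ entry 30 0 0 18 31 1375256639798673750356071946 ∷
    entry 31 0 0 11 24 9397587029147947477198207930 ∷ entry 33 0 0 22 1 348532054255660744649999089786 ∷
    entry 37 0 0 28 9 481229800480198684909657595363295 ∷ []) ∷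
  row 6 3 (
    entry 1 1 0 0 0 21144499 ∷ entry 2 1 0 0 0 18633 ∷ entry 3 1 0 0 0 435475636 ∷
    entry 4 1 0 0 0 9046748110 ∷ entry 5 1 0 0 0 71164919350 ∷ entry 6 1 0 0 0 325689776014 ∷
    entry 7 1 0 0 0 2561938239574 ∷ entry 8 1 0 0 0 12626765748838 ∷ entry 9 1 0 10 0 92229776656318 ∷
    entry 10 1 0 10 0 469123689165268 ∷ entry 11 1 0 10 0 3320271959628232 ∷
    entry 12 1 0 13 0 20547434538384292 ∷ entry 13 1 0 14 0 112516354591825996 ∷
    entry 14 1 0 12 0 696408308200308556 ∷ entry 15 1 0 16 0 4667796132029815240 ∷
    entry 16 1 0 10 0 25073404672116554560 ∷ entry 17 1 0 18 0 168040660760863679944 ∷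
    entry 18 1 0 12 0 902642568196196122444 ∷ []) ∷
  row 5 3 (
    entry 12 0 0 0 18 3109881843237755 ∷ entry 13 0 0 0 5 17549262695136024 ∷
    entry 14 0 0 0 10 104911381471937228 ∷ entry 15 0 0 11 21 547035710635343692 ∷
    entry 16 0 0 0 3 4080234209084944153 ∷ entry 17 0 0 16 1 28382026433768318707 ∷
    entry 18 0 0 17 2 155418842071046489598 ∷ entry 19 0 0 0 5 818792262808762805251 ∷
    entry 20 0 0 0 1 6137618035211105779880 ∷ entry 22 0 0 12 21 207070818270658399566576 ∷
    entry 23 0 0 19 3 1326443515088939722283840 ∷ entry 24 0 0 13 24 7957774084944350973179646 ∷
    entry 26 0 0 21 0 229192244907055671159767564 ∷ entry 29 0 0 15 33 61886548662059240866403118440 ∷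
    entry 30 0 0 18 33 365787942077343917568310639603 ∷ []) ∷
  row 4 3 (
    entry 13 0 0 0 2 1134086181326667 ∷ entry 14 0 0 0 3 20596139792666071 ∷
    entry 15 0 0 0 13 131533683834496832 ∷ entry 16 0 0 14 1 789303608535026101 ∷
    entry 17 0 0 10 20 3788387998036575318 ∷ entry 18 0 0 16 2 22737222786641946960 ∷
    entry 19 0 0 13 25 133394209391185309728 ∷ entry 20 0 0 0 8 1023490289208713188760 ∷
    entry 21 0 0 0 2 4912753771571832752875 ∷ entry 23 0 0 10 21 221073919720664010698132 ∷
    entry 24 0 0 13 29 1043584896656725778619949 ∷ entry 25 0 0 18 5 6366910882101828638835971 ∷
    entry 30 0 0 25 14 52851876698870635531268494780 ∷ entry 31 0 0 11 35 297055434196527358999568921756 ∷ []) ∷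
  row 3 3 (
    entry 14 0 0 0 15 2875557328662518 ∷ entry 15 0 0 0 17 17549510684915543 ∷
    entry 16 0 0 0 13 105241504783221598 ∷ entry 17 0 0 0 6 787170535945166961 ∷
    entry 18 0 0 11 24 4737147948408307804 ∷ entry 19 0 0 10 24 22660832772690241395 ∷
    entry 20 0 0 16 5 170579168864437531755 ∷ entry 21 0 0 17 2 818792230940668871864 ∷
    entry 22 0 0 14 1 5250126522860351488052 ∷ entry 24 0 0 14 2 207563846848910763004813 ∷
    entry 25 0 0 0 6 1061154753236058323363944 ∷ entry 26 0 0 18 1 5968995832236368720328048 ∷
    entry 27 0 0 14 0 47746644492209632811465835 ∷ entry 35 0 0 11 30 79388064789021585451005498996781 ∷ []) ∷
  row 2 3 (
    entry 15 0 0 0 13 2817712603264187 ∷ entry 16 0 0 0 16 17549510881641100 ∷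
    entry 17 0 0 0 12 104911430449552060 ∷ entry 18 0 0 10 20 631779091301219310 ∷
    entry 19 0 0 12 6 3789607815591226546 ∷ entry 20 0 0 14 3 22737324049106485215 ∷
    entry 21 0 0 10 11 170579778222315180347 ∷ entry 22 0 0 18 0 818792289853106651118 ∷
    entry 23 0 0 14 22 4912640430597519108779 ∷ entry 25 0 0 16 3 176859135776586684777822 ∷
    entry 26 0 0 18 28 1312933444893997791628472 ∷ entry 27 0 0 20 5 7767063711756746516879632 ∷ []) ∷
  row 1 3 (
    entry 16 0 0 0 11 3649951998258720 ∷ entry 17 0 0 0 18 17549558468545425 ∷
    entry 18 0 0 0 2 131613240508849592 ∷ entry 19 0 0 0 22 789730221207366311 ∷
    entry 20 0 0 15 2 3789486210081463516 ∷ entry 21 0 0 0 19 28430288021222422659 ∷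
    entry 22 0 0 14 25 170580387588142122975 ∷ entry 23 0 0 13 26 818792295225211964228 ∷
    entry 24 0 0 10 25 4605636462606562413746 ∷ entry 26 0 0 14 0 207563846848910763804831 ∷
    entry 27 0 0 12 9 1326443517997386490626028 ∷ entry 28 0 0 17 21 6366928886860231381273127 ∷
    entry 29 0 0 0 20 38201573327734256561234369 ∷ entry 31 0 0 10 23 1375256639798690678171106435 ∷
    entry 39 0 0 21 34 2887378820390246448968186763725955 ∷ []) ∷
  row 7 2 (
    entry 1 1 0 0 0 22730803 ∷ entry 2 1 0 0 0 184757835 ∷ entry 3 1 0 0 0 435376060 ∷
    entry 4 1 0 0 0 9389918134 ∷ entry 5 1 0 0 0 69045151054 ∷ entry 6 1 0 0 0 363803621878 ∷
    entry 7 1 0 0 0 2564111662678 ∷ entry 8 1 0 10 0 14430140561686 ∷ entry 9 1 0 10 0 92308019888062 ∷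
    entry 10 1 0 11 0 417846678880120 ∷ entry 11 1 0 12 0 3323088715971016 ∷
    entry 12 1 0 12 0 18702416323808164 ∷ entry 13 1 0 11 0 115969393118552140 ∷
    entry 14 1 0 11 0 673252638079909708 ∷ entry 15 1 0 15 0 4645959796622664064 ∷
    entry 16 1 0 14 0 26607506445423369892 ∷ entry 17 1 0 13 0 167254552686203014528 ∷ []) ∷
  row 6 2 (
    entry 12 0 0 0 2 928785124648511 ∷ entry 13 0 0 0 19 21935041165765124 ∷
    entry 14 0 0 0 17 102979906179213263 ∷ entry 15 0 0 0 12 630075995378044491 ∷
    entry 16 0 0 0 5 4722978073431599136 ∷ entry 17 0 0 16 8 27875758817615872444 ∷
    entry 18 0 0 16 22 167264813846412107447 ∷ entry 19 0 0 18 6 902547572805922221054 ∷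
    entry 20 0 0 10 21 5415285436841628144445 ∷ entry 22 0 0 12 12 217798732563566987885399 ∷
    entry 23 0 0 13 1 1326439411727234125520908 ∷ entry 24 0 0 16 28 6366925886894254469810384 ∷
    entry 25 0 0 11 19 38198707554485867154588864 ∷ entry 26 0 0 15 31 229192244775436788487873803 ∷ []) ∷
  row 5 2 (
    entry 13 0 0 0 5 3656146837310627 ∷ entry 14 0 0 0 12 17541661397797484 ∷
    entry 15 0 0 0 20 105233040062773820 ∷ entry 16 0 0 0 23 621546605511724700 ∷
    entry 17 0 0 0 14 3724885754383550540 ∷ entry 18 0 0 11 24 28421858551638614238 ∷
    entry 19 0 0 15 1 166475123111449217235 ∷ entry 20 0 0 0 8 875652869134603911063 ∷
    entry 21 0 0 12 1 5992379091130776551323 ∷ entry 23 0 0 0 15 176859135776586469615816 ∷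
    entry 24 0 0 10 10 1061151813682219228040783 ∷ entry 25 0 0 20 30 6366280563317884821945837 ∷
    entry 26 0 0 21 30 47746644426396345065856047 ∷ entry 27 0 0 12 26 229205550588979921002029204 ∷
    entry 30 0 0 27 2 61682276489120829102514290704 ∷ entry 33 0 0 31 9 10685495383076509000806501731232 ∷ []) ∷
  row 4 2 (
    entry 14 0 0 0 1 2873911681087797 ∷ entry 15 0 0 0 9 17549510881619564 ∷
    entry 16 0 0 11 1 105292275932369350 ∷ entry 17 0 0 11 23 786561176215234093 ∷
    entry 18 0 0 0 0 3787047125332647991 ∷ entry 19 0 0 0 17 27877294063983630857 ∷
    entry 20 0 0 17 2 170578559507188695030 ∷ entry 21 0 0 12 20 1023490330480506293280 ∷
    entry 22 0 0 11 23 4239903621530182768856 ∷ entry 24 0 0 19 1 171050827932072048328488 ∷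
    entry 25 0 0 0 7 1326443499312376258927952 ∷ entry 28 0 0 19 2 229206369485111697023019236 ∷
    entry 29 0 0 13 27 1718916046583103608266034262 ∷ entry 35 0 0 16 37 80204967232942997197307342700075 ∷ []) ∷
  row 3 2 (
    entry 15 0 0 0 3 3224528624215379 ∷ entry 16 0 0 0 1 17549552240524623 ∷
    entry 17 0 0 0 2 131567538423199468 ∷ entry 18 0 0 0 10 631784141679302081 ∷
    entry 19 0 0 15 7 4624298473612922476 ∷ entry 20 0 0 16 4 22744166102444248671 ∷
    entry 21 0 0 10 25 136464987588247305183 ∷ entry 22 0 0 13 21 1008327548575420413197 ∷
    entry 23 0 0 10 21 3070400908990357468835 ∷ entry 25 0 0 11 0 172969872374092303018623 ∷
    entry 26 0 0 21 10 1061154814605919029673223 ∷ entry 27 0 0 20 9 6226915393767614890143711 ∷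
    entry 28 0 0 17 4 38201571906157230488690659 ∷ []) ∷
  row 2 2 (
    entry 16 0 0 0 7 3649951998266208 ∷ entry 17 0 0 0 16 16438043208742828 ∷
    entry 18 0 0 0 2 105297222011263923 ∷ entry 19 0 0 0 0 631753642540272824 ∷
    entry 20 0 0 13 17 4737040449087595679 ∷ entry 21 0 0 13 21 28140334353641341031 ∷
    entry 22 0 0 13 17 170581674013252152215 ∷ entry 23 0 0 15 27 1023490368746598334446 ∷
    entry 24 0 0 16 27 4912753771571852308328 ∷ entry 26 0 0 18 6 221073919720733357746815 ∷
    entry 27 0 0 10 4 1326443404252256817408130 ∷ entry 28 0 0 22 11 6366926676710991565474951 ∷
    entry 29 0 0 21 7 47751966659251851746918297 ∷ []) ∷
  row 1 2 (
    entry 17 0 0 0 13 2919848754210477 ∷ entry 18 0 0 10 7 21936950386419730 ∷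
    entry 19 0 0 12 2 131621703648774754 ∷ entry 20 0 0 13 11 631784177354477084 ∷
    entry 22 0 0 11 21 28430288020786991536 ∷ entry 23 0 0 10 20 136465301266963704935 ∷
    entry 24 0 0 13 1 818792295224244505802 ∷ entry 25 0 0 13 22 3888736915679014079690 ∷
    entry 27 0 0 12 11 176859135776585597704684 ∷ []) ∷
  row 8 1 (
    entry 1 1 0 0 0 5374771 ∷ entry 2 1 0 0 0 80621643 ∷ entry 3 1 0 0 0 1859670838 ∷
    entry 4 1 0 0 0 1431946 ∷ entry 5 1 0 0 0 66989300662 ∷ entry 6 1 0 0 0 325689775606 ∷
    entry 7 1 0 0 0 2411615966806 ∷ entry 8 1 0 0 0 11724832112230 ∷ entry 9 1 0 10 0 86818174836670 ∷
    entry 10 1 0 11 0 435713708278228 ∷ entry 11 1 0 11 0 3125454294120904 ∷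
    entry 12 1 0 10 0 19344675226450852 ∷ entry 13 1 0 10 0 128450440822946248 ∷
    entry 14 1 0 15 0 696408308196941476 ∷ entry 15 1 0 13 0 4624225965895530952 ∷
    entry 16 1 0 12 0 25070701181116898980 ∷ entry 17 1 0 17 0 166472134780029445576 ∷
    entry 18 1 0 18 0 902642568196192755364 ∷ []) ∷
  row 7 1 (
    entry 12 0 0 0 15 529575878474599 ∷ entry 13 0 0 0 13 15222247643203079 ∷
    entry 14 0 0 0 22 116197833663305162 ∷ entry 15 0 0 0 22 787170911914148233 ∷
    entry 16 0 0 0 23 4735941923567630135 ∷ entry 17 0 0 0 17 22660770473137429264 ∷
    entry 18 0 0 0 1 150311983813087430142 ∷ entry 19 0 0 0 11 818778401858350067763 ∷
    entry 20 0 0 16 12 5235808994523832232428 ∷ entry 22 0 0 13 1 155365466925878164897997 ∷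
    entry 23 0 0 20 7 1061154812880875624737219 ∷ entry 24 0 0 14 27 5722129953732107554317774 ∷
    entry 25 0 0 0 29 38178233640722134736889020 ∷ entry 26 0 0 15 29 229186104096465731356910784 ∷
    entry 27 0 0 17 4 1375116622209586793843788878 ∷ entry 28 0 0 23 34 10113247531529312324865582078 ∷
    entry 29 0 0 22 19 61886548786836616116871634476 ∷ entry 35 0 0 21 40 2309902785717719425384102588314564 ∷ []) ∷
  row 6 1 (
    entry 13 0 0 0 18 88065647607194 ∷ entry 14 0 0 0 21 18767966288576596 ∷
    entry 15 0 0 0 19 131533676939975840 ∷ entry 16 0 0 0 21 770717964068639784 ∷
    entry 17 0 0 0 9 3788387057303249238 ∷ entry 18 0 0 0 22 3790637363002506925 ∷
    entry 19 0 0 12 16 145939829585376853673 ∷ entry 20 0 0 0 1 313364952458038959966 ∷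
    entry 21 0 0 0 18 1880189715046017554581 ∷ entry 23 0 0 12 5 172969872285775888592476 ∷
    entry 24 0 0 0 18 397933044111884679669689 ∷ entry 25 0 0 21 21 7774432751369364613398437 ∷
    entry 26 0 0 13 10 38197679957741659426938112 ∷ entry 27 0 0 19 18 246717777903656282236910428 ∷
    entry 28 0 0 21 32 1719070083305116833011231782 ∷ entry 30 0 0 19 33 61886548766303630316328242028 ∷
    entry 31 0 0 20 38 371319292745659279660637019042 ∷ entry 34 0 0 30 6 64052577998506818532002070478304 ∷ []) ∷
  row 5 1 (
    entry 14 0 0 0 7 1096847531991552 ∷ entry 15 0 0 0 20 21936895785435613 ∷
    entry 16 0 0 0 21 21936621482669996 ∷ entry 17 0 0 0 3 631733397084463446 ∷
    entry 18 0 0 13 1 4735943648366235703 ∷ entry 19 0 0 0 10 25271279110812948851 ∷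
    entry 20 0 0 14 4 170566372094703524974 ∷ entry 21 0 0 0 19 1023489840965689503147 ∷
    entry 22 0 0 14 26 5411231488363286462454 ∷ entry 24 0 0 12 29 188984653621351703956555 ∷
    entry 25 0 0 14 1 1061154812953312844964019 ∷ entry 26 0 0 23 14 6366910882091578610868334 ∷
    entry 27 0 0 24 11 47747667938704808999959597 ∷ entry 29 0 0 12 34 1718879199350356373265845334 ∷
    entry 31 0 0 19 3 60679485189267938050929249325 ∷ []) ∷
  row 4 1 (
    entry 15 0 0 0 15 3229605563897344 ∷ entry 16 0 0 0 10 21936621510701365 ∷
    entry 17 0 0 0 15 105233030448650261 ∷ entry 18 0 0 0 18 629346738465887831 ∷
    entry 19 0 0 14 23 4735821870645493607 ∷ entry 20 0 0 0 9 22375689652870951644 ∷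
    entry 21 0 0 0 2 167264858413371396060 ∷ entry 22 0 0 14 27 1008327484473534180007 ∷
    entry 23 0 0 15 0 4912753771570420861027 ∷ entry 25 0 0 17 1 176859135776586681417289 ∷
    entry 26 0 0 0 31 1326443515155729499319864 ∷ entry 27 0 0 23 14 7958518870758393819457930 ∷
    entry 28 0 0 21 4 47720033746269718277914156 ∷ entry 30 0 0 20 25 1719070799729408388616568123 ∷
    entry 31 0 0 17 29 8251539730072901054953132014 ∷ entry 36 0 0 16 26 79882068434509658502239751556290 ∷ []) ∷
  row 3 1 (
    entry 16 0 0 0 15 2924926752048235 ∷ entry 17 0 0 10 20 21936895785206279 ∷
    entry 18 0 0 10 22 131609855071815576 ∷ entry 19 0 0 13 0 787170912139176175 ∷
    entry 20 0 0 12 24 4735943570222003087 ∷ entry 21 0 0 14 1 22744230387351646903 ∷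
    entry 22 0 0 15 7 170581694324735570296 ∷ entry 23 0 0 15 4 1023490368746598334435 ∷
    entry 24 0 0 15 27 4239903621530182798525 ∷ entry 26 0 0 18 12 221073919720733356256650 ∷ []) ∷
  row 2 1 (
    entry 17 0 0 0 14 2538998916703917 ∷ entry 18 0 0 11 10 21936942658842618 ∷
    entry 19 0 0 13 22 131619258842052023 ∷ entry 20 0 0 11 15 631601315665964219 ∷
    entry 22 0 0 0 18 28316215886593018024 ∷ entry 23 0 0 17 25 170581200063449967803 ∷
    entry 24 0 0 13 2 818792289854848077000 ∷ entry 25 0 0 14 14 5993104716709179930311 ∷
    entry 27 0 0 16 11 176850606690177707402902 ∷ entry 32 0 0 23 25 1375245586099583365506976955 ∷ []) ∷
  row 1 1 (
    entry 18 0 0 10 17 3229606622055455 ∷ entry 19 0 0 0 2 17549560267414271 ∷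
    entry 20 0 0 0 7 105292285075980143 ∷ entry 21 0 0 14 3 631784177354488751 ∷
    entry 23 0 0 12 2 22737649327432379596 ∷ entry 24 0 0 13 23 170581728177691663348 ∷
    entry 25 0 0 10 23 818792295212344762288 ∷ entry 26 0 0 14 2 6140942214464814377452 ∷
    entry 29 0 0 18 22 1326443518321955185478831 ∷ entry 30 0 0 15 27 7958659372539910166464876 ∷ []) ∷
  []

valid10 : All (ValidRow 10) table10
valid10 = toWitness {a? = All.all? (validRow? 10) table10} _

complete10 : Complete 10 table10
complete10 = toWitness {a? = complete? 10 table10} _

-- The threshold `x + 2` for `b` is attained here. For odd `c` and even `b`, paths that can be grown
-- by 2 occur only at `b = 14`; for `c` congruent to 3 modulo 4 and odd `b`, only at `b = 15`.
table12 : List Row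
table12 =
  row 2 15 (
    entry 3 1 20 0 0 1462713002570816 ∷ []) ∷
  row 1 15 (
    entry 3 0 2 0 15 365626284593961 ∷ entry 7 1 2 0 0 609220387270521014 ∷
    entry 11 1 2 0 0 623710025398562552770 ∷ entry 15 1 3 22 0 1312910411128333149547238 ∷
    entry 19 1 2 22 0 1701531892864232915576729126 ∷ entry 23 1 2 18 0 1360872672752919864003348118384 ∷ []) ∷
  row 2 14 (
    entry 1 1 16 0 0 9121588663450 ∷ entry 3 1 18 0 0 243784914242624 ∷ []) ∷
  row 1 14 (
    entry 1 0 2 0 15 1692714093465 ∷ entry 3 0 2 0 7 41658396365894 ∷ entry 5 1 2 0 0 3430294452769190 ∷
    entry 7 1 2 0 0 118770094340966824 ∷ entry 9 1 2 0 0 4445662792345874848 ∷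
    entry 11 1 2 0 0 168013122976161778882 ∷ entry 13 1 2 19 0 6078282152130296203046 ∷
    entry 15 1 2 12 0 207424546059537835226050 ∷ entry 17 1 2 23 0 7877462466765705607569614 ∷
    entry 19 1 2 25 0 282200311228707251443658938 ∷ entry 21 1 2 24 0 10209191357185242935123809742 ∷
    entry 23 1 2 12 0 370400047684847358906930276016 ∷ []) ∷
  row 2 13 (
    entry 3 1 0 0 0 40630916738076 ∷ entry 7 1 0 0 0 81948967761583788 ∷
    entry 11 1 0 0 0 132384584566793852580 ∷ []) ∷
  row 1 13 (
    entry 1 1 14 0 0 188105346662 ∷ entry 5 1 18 0 0 455328268381214 ∷ entry 9 1 2 0 0 586656736711132336 ∷
    entry 11 0 0 0 25 17702787557396422389 ∷ entry 13 1 2 18 0 615526916056865333164 ∷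
    entry 15 1 0 16 0 34583064305895214153934 ∷ entry 17 1 2 14 0 870646305222172625276332 ∷
    entry 19 1 0 19 0 43496201294876702674784462 ∷ entry 21 1 2 25 0 1141735711102935497647731490 ∷
    entry 23 1 0 17 0 58086284827174954191798883790 ∷ []) ∷
  row 2 12 (
    entry 1 1 0 0 0 188102547300 ∷ entry 3 1 0 0 0 6770659121628 ∷ entry 5 1 0 0 0 245181600294708 ∷
    entry 7 1 0 0 0 16392016284713796 ∷ entry 9 1 0 0 0 361018731721866132 ∷
    entry 11 1 0 0 0 13116938529432871968 ∷ []) ∷
  row 1 12 (
    entry 11 0 0 0 12 3091227717024289425 ∷ entry 13 1 0 16 0 107354524201697419298 ∷
    entry 15 1 0 18 0 5594177525474562883082 ∷ entry 17 1 0 16 0 207539346317701736323106 ∷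
    entry 19 1 0 19 0 7250062870525429809041930 ∷ entry 21 1 0 21 0 268972893033562326556074914 ∷
    entry 23 1 0 25 0 9396081480452544968536642058 ∷ []) ∷
  row 1 11 (
    entry 1 1 0 0 0 5224230950 ∷ entry 2 1 2 0 0 47017985242 ∷ entry 3 1 0 0 0 351332165150 ∷
    entry 4 1 16 0 0 2539027572826 ∷ entry 5 1 0 0 0 13136006990330 ∷ entry 6 1 2 0 0 91410607624670 ∷
    entry 7 1 0 0 0 280984816038442 ∷ entry 8 1 3 0 0 3291980323062014 ∷ entry 9 1 0 0 0 19955002018464314 ∷
    entry 10 1 3 13 0 118770094826386478 ∷ entry 11 1 0 0 0 586656736719066448 ∷
    entry 12 1 3 14 0 4445662795631163962 ∷ entry 13 1 0 13 0 25861684128793475642 ∷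
    entry 14 1 3 14 0 168013122993530232866 ∷ entry 15 1 0 17 0 932362920899366453164 ∷
    entry 16 1 2 18 0 6078282152206421409290 ∷ entry 17 1 0 18 0 33518887291733239283210 ∷
    entry 18 1 3 14 0 217745009071693481728034 ∷ entry 19 1 0 21 0 1208343811753768116522412 ∷
    entry 20 1 2 14 0 7877462466769918459007498 ∷ entry 21 1 0 23 0 47042672631267779649622538 ∷
    entry 23 1 0 25 0 1566013580075407234763328940 ∷ []) ∷
  row 1 10 (
    entry 1 1 0 0 0 870675607 ∷ entry 2 1 2 0 0 5224193625 ∷ entry 3 1 0 0 0 31526784340 ∷
    entry 4 1 2 0 0 423171067738 ∷ entry 5 1 0 0 0 1129551733498 ∷ entry 6 1 2 0 0 15235099591162 ∷
    entry 7 1 0 0 0 77864902701610 ∷ entry 8 1 2 0 0 548663377099306 ∷ entry 9 1 0 0 0 2837378570238130 ∷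
    entry 10 1 2 12 0 19795015743931570 ∷ entry 11 1 0 12 0 119730011927753140 ∷
    entry 12 1 2 13 0 609220456685451088 ∷ entry 13 1 0 15 0 4310280473980287664 ∷
    entry 14 1 2 15 0 28002187163411589808 ∷ entry 15 1 0 15 0 160138384469845860268 ∷
    entry 16 1 2 17 0 1013047025354676207532 ∷ entry 17 1 0 18 0 5586123772958169468592 ∷
    entry 18 1 2 13 0 36290834845203882790576 ∷ entry 19 1 0 19 0 207540812524652953669036 ∷
    entry 20 1 2 15 0 1312910411127849558183340 ∷ entry 21 1 0 14 0 7240079655055375721801200 ∷ []) ∷
  row 2 9 (
    entry 1 1 0 0 0 870209035 ∷ entry 2 1 0 0 0 7831041633 ∷ entry 3 1 0 0 0 31236827452 ∷
    entry 4 1 0 0 0 281312979676 ∷ entry 5 1 0 0 0 1168263235246 ∷ entry 6 1 0 0 0 15876387010090 ∷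
    entry 7 1 0 0 0 42061649206510 ∷ entry 8 1 0 0 0 571689400513954 ∷ entry 9 1 0 0 0 3325829409319054 ∷
    entry 10 1 0 12 0 20581745727888598 ∷ entry 11 1 0 13 0 119729858735490748 ∷
    entry 12 1 0 12 0 609219503980381816 ∷ entry 13 1 0 13 0 4310280321605524072 ∷
    entry 14 1 0 14 0 26673975846477709156 ∷ entry 15 1 0 12 0 155169896921215273036 ∷
    entry 16 1 0 17 0 960261928680404315980 ∷ entry 17 1 0 12 0 5585864014232963417260 ∷
    entry 18 1 0 13 0 36469648459523898725104 ∷ entry 19 1 0 20 0 201113323717841623846504 ∷
    entry 20 1 0 15 0 1312908900411530519768908 ∷ entry 21 1 0 21 0 7840445431250535200587648 ∷ []) ∷
  row 1 9 (
    entry 14 0 0 0 16 2188058486228758968 ∷ entry 15 0 0 0 25 17297276401444520428 ∷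
    entry 16 0 0 0 2 126981273670576000025 ∷ entry 17 0 0 14 15 1020963217672907248481 ∷
    entry 18 0 0 0 17 6140940871585468008697 ∷ entry 19 0 0 0 10 29340008982929888852273 ∷
    entry 20 0 0 18 9 165258156691667311933666 ∷ entry 21 0 0 13 19 1056179408900924882567951 ∷
    entry 22 0 0 0 11 6366110029796840765076229 ∷ entry 23 0 0 0 33 47042672671079537375485977 ∷
    entry 24 0 0 0 4 214176388926260001959310278 ∷ entry 26 0 0 12 33 10314424798490525641806860966 ∷
    entry 27 0 0 0 33 49509239032754164000812729267 ∷ entry 28 0 0 0 14 296958530077208447341277718874 ∷
    entry 30 0 0 0 39 10025525400199480970626165026952 ∷ entry 31 0 0 16 27 80204394207210798453751019114423 ∷
    entry 34 0 0 30 41 10811629497063272114947221957353588 ∷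
    entry 35 0 0 30 42 83092346053452650278103950855504958 ∷
    entry 36 0 0 35 10 623673825204293256661032106808235435 ∷
    entry 39 0 0 34 17 134713546244127343419912739916252463614 ∷
    entry 40 0 0 34 6 643593274202149949778708962714755052492 ∷
    entry 42 0 0 32 0 23278498304631182520014507871044548334708 ∷ []) ∷
  row 3 8 (
    entry 1 1 0 0 0 870488899 ∷ entry 2 1 0 0 0 7831041195 ∷ entry 3 1 0 0 0 31054589116 ∷
    entry 4 1 0 0 0 280949622748 ∷ entry 5 1 0 0 0 1168323698830 ∷ entry 6 1 0 0 0 12652162000654 ∷
    entry 7 1 0 0 0 49250344696654 ∷ entry 8 1 0 0 0 455490171372358 ∷ entry 9 1 0 0 0 3325831586098798 ∷
    entry 10 1 0 12 0 20581732667179030 ∷ entry 11 1 0 12 0 119730011110269022 ∷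
    entry 12 1 0 12 0 609220418228962708 ∷ entry 13 1 0 13 0 4310280399969685576 ∷
    entry 14 1 0 14 0 26673975376292709028 ∷ entry 15 1 0 12 0 155169998481051009100 ∷
    entry 16 1 0 18 0 960261319320662633572 ∷ entry 17 1 0 14 0 5586481114234975434664 ∷
    entry 18 1 0 13 0 36469691068738309823296 ∷ entry 19 1 0 12 0 201113320112458999775308 ∷
    entry 20 1 0 21 0 1312908878474579877719140 ∷ entry 21 1 0 17 0 7840445434906693640514472 ∷ []) ∷
  row 2 8 (
    entry 14 0 0 0 15 3091678327015238996 ∷ entry 15 0 0 0 0 13027380009684188601 ∷
    entry 16 0 0 0 10 136442196398589405339 ∷ entry 17 0 0 0 23 818555373718873579451 ∷
    entry 18 0 0 0 12 4605414161965223320463 ∷ entry 19 0 0 17 2 34593725845319528438001 ∷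
    entry 20 0 0 0 3 217790221128254556148444 ∷ entry 21 0 0 0 16 1326428355448254744970743 ∷
    entry 22 0 0 17 6 6300604869337016400112906 ∷ entry 23 0 0 22 2 47751587588744411607271659 ∷
    entry 24 0 0 0 6 268825793911777423885385456 ∷ entry 26 0 0 0 0 8004819409702989572805225488 ∷
    entry 27 0 0 0 31 61886548790871271589010639294 ∷ entry 28 0 0 17 38 371293825029427405709499716720 ∷
    entry 29 0 0 18 38 1670841310146609625685269514373 ∷ entry 30 0 0 29 21 13334472451097485654822008176656 ∷
    entry 32 0 0 25 6 481196796841086189531281436049136 ∷
    entry 33 0 0 0 20 2887378667583951036383503146472935 ∷
    entry 36 0 0 23 0 585175407385074991907644313562091703 ∷
    entry 38 0 0 26 7 22118765449811080013791049837833929980 ∷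
    entry 39 0 0 18 34 106648224109934146003389266303896004732 ∷
    entry 45 0 0 31 18 5027913686468743123388369849073623856861681 ∷ []) ∷
  row 1 8 (
    entry 15 0 0 0 6 1965742628524392023 ∷ entry 16 0 0 0 5 26579540553559183286 ∷
    entry 17 0 0 0 7 136458069380429149191 ∷ entry 18 0 0 0 9 932506115580737627183 ∷
    entry 19 0 0 0 11 4855853654831610894325 ∷ entry 20 0 0 0 4 29471783638434469433913 ∷
    entry 21 0 0 0 4 137659384437598446333479 ∷ entry 22 0 0 13 13 1061097954050536061525009 ∷
    entry 23 0 0 0 26 6366621840792231468204903 ∷ entry 24 0 0 15 13 47044530076752483312539362 ∷
    entry 25 0 0 0 7 229032493960355222753137189 ∷ entry 27 0 0 18 35 8210419767277521959582170347 ∷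
    entry 28 0 0 25 36 49509239032754175524988795638 ∷ entry 29 0 0 0 21 371301783634352556002201660918 ∷
    entry 30 0 0 0 0 2227915638567863448398435190689 ∷ entry 31 0 0 13 29 13361993511977480304976248900212 ∷
    entry 32 0 0 23 41 64163386437197452609295566626435 ∷
    entry 33 0 0 28 1 451697456361796337636241718643175 ∷
    entry 35 0 0 0 13 15784337551454399296294093750112509 ∷
    entry 37 0 0 12 31 585375953245274772777661825799945703 ∷
    entry 41 0 0 19 4 606210958075881310755093793961196734523 ∷
    entry 42 0 0 30 14 4849687663600362626987436860921319013940 ∷
    entry 47 0 0 37 44 37711171272156419785729933878225854007041585 ∷ []) ∷
  row 4 7 (
    entry 1 1 0 0 0 867689107 ∷ entry 2 1 0 0 0 7703296203 ∷ entry 3 1 0 0 0 32335277134 ∷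
    entry 4 1 0 0 0 280950800266 ∷ entry 5 1 0 0 0 1168263234838 ∷ entry 6 1 0 0 0 9128235022870 ∷
    entry 7 1 0 0 0 92379978072982 ∷ entry 8 1 0 0 0 455464775575126 ∷ entry 9 1 0 0 0 3325829409318646 ∷
    entry 10 1 0 12 0 20580818418038038 ∷ entry 11 1 0 12 0 119529794843166070 ∷
    entry 12 1 0 12 0 609219503980366036 ∷ entry 13 1 0 15 0 4310274914478105544 ∷
    entry 14 1 0 13 0 26673942463343228836 ∷ entry 15 1 0 15 0 155162889279730655308 ∷
    entry 16 1 0 16 0 960218664112740510820 ∷ entry 17 1 0 14 0 5586481012675018810312 ∷
    entry 18 1 0 13 0 34567871910118506348364 ∷ entry 19 1 0 20 0 217790107298848894184776 ∷
    entry 20 1 0 19 0 1312908900411530516401828 ∷ entry 21 1 0 16 0 7840443862758563684617600 ∷ []) ∷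
  row 3 7 (
    entry 14 0 0 0 6 3677784073388647491 ∷ entry 15 0 0 0 24 22744229625064602903 ∷
    entry 16 0 0 0 20 136458792430535719767 ∷ entry 17 0 0 0 11 1020960915761963413120 ∷
    entry 18 0 0 0 26 4912516324330337234091 ∷ entry 19 0 0 0 28 36754632483253515095372 ∷
    entry 20 0 0 0 18 202299505168465378281971 ∷ entry 21 0 0 0 0 1208482146685983897401409 ∷
    entry 22 0 0 18 2 5968995411269501838402163 ∷ entry 23 0 0 14 1 43365059495506157888290917 ∷
    entry 24 0 0 0 11 214176413425446477109732909 ∷ entry 26 0 0 0 1 8004808891917932900311910286 ∷
    entry 27 0 0 0 9 49509239032629550314966479984 ∷ entry 28 0 0 24 13 235168708546440390313716275434 ∷
    entry 29 0 0 0 36 1782331278735146046476211282405 ∷ entry 30 0 0 0 16 13361993508395012246187459440001 ∷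
    entry 31 0 0 13 31 80201185247823118350495725336439 ∷
    entry 32 0 0 22 36 384983836351395373381096867967118 ∷
    entry 33 0 0 26 39 2309902970358653152890721027526672 ∷
    entry 36 0 0 22 39 617310575473784067164924008853190273 ∷
    entry 38 0 0 34 48 22119631366377886907901382862647903484 ∷
    entry 39 0 0 34 11 134713546244127225054270192316483613024 ∷
    entry 41 0 0 26 11 4849687657659253939252904331023767050747 ∷
    entry 42 0 0 16 47 29098087875322825492034979896368501274487 ∷ []) ∷
  row 2 7 (
    entry 15 0 0 0 11 2323448628899333192 ∷ entry 16 0 0 0 0 28429955917813333060 ∷
    entry 17 0 0 0 9 136425895087350927146 ∷ entry 18 0 0 0 4 761924609864072696434 ∷
    entry 19 0 0 0 28 6130500225959195783689 ∷ entry 20 0 0 0 11 36299747871738060116590 ∷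
    entry 21 0 0 0 14 165794883727640191749166 ∷ entry 22 0 0 0 10 1061145337611441168838390 ∷
    entry 23 0 0 0 11 7958570093538193158218107 ∷ entry 24 0 0 0 11 47751966659606908406698998 ∷
    entry 25 0 0 12 30 229209439966424349378553659 ∷ entry 27 0 0 0 4 8251539838792427888369348948 ∷
    entry 28 0 0 0 17 49509239032633917393101349836 ∷ entry 29 0 0 18 4 365732312646405611151632772615 ∷
    entry 30 0 0 23 0 1782318279587344531362232666347 ∷ entry 31 0 0 16 30 13361993470526130716584932310076 ∷
    entry 32 0 0 18 36 64163458045558615365584493980907 ∷
    entry 33 0 0 23 9 384975588260684990861046583011517 ∷
    entry 34 0 0 17 1 2245716390717021708769005289957965 ∷
    entry 35 0 0 26 5 13466562526148272172947475254413949 ∷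
    entry 36 0 0 18 37 83156510026730237167013673338454644 ∷
    entry 39 0 0 17 33 17961806165883645791429927630501566987 ∷
    entry 40 0 0 12 6 126481051751430655257853088783006561500 ∷ []) ∷
  row 1 7 (
    entry 16 0 0 0 10 4730337789741703052 ∷ entry 17 0 0 0 15 22744230414916008627 ∷
    entry 18 0 0 0 1 136360084146173613670 ∷ entry 19 0 0 0 26 1023478669333697559611 ∷
    entry 20 0 0 0 1 6130514850593733710402 ∷ entry 21 0 0 12 3 29467923342193954637524 ∷
    entry 22 0 0 14 29 176722380825917624624054 ∷ entry 23 0 0 15 29 1326440991185898866093690 ∷
    entry 24 0 0 21 18 6300604184873717777614474 ∷ entry 25 0 0 0 12 38201573327731428556781667 ∷
    entry 26 0 0 15 10 286492148942983961567355484 ∷ entry 28 0 0 0 7 8251539838792428425690195936 ∷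
    entry 29 0 0 0 6 49470551096664101177110851778 ∷ entry 30 0 0 16 0 293960988850883164214433138568 ∷
    entry 31 0 0 24 0 1782332531487855598222039346337 ∷ entry 32 0 0 18 4 13366577701032691774051813689585 ∷
    entry 37 0 0 23 9 103945637534048500451472393474738873 ∷
    entry 40 0 0 27 5 17773164081558717322663806949844110268 ∷
    entry 41 0 0 35 7 134713546244127343420514613841317101438 ∷ []) ∷
  row 5 6 (
    entry 1 1 0 0 0 869366131 ∷ entry 2 1 0 0 0 7804149195 ∷ entry 3 1 0 0 0 31051416508 ∷
    entry 4 1 0 0 0 363799936462 ∷ entry 5 1 0 0 0 1166243404732 ∷ entry 6 1 0 0 0 12652161926806 ∷
    entry 7 1 0 0 0 77618503805206 ∷ entry 8 1 0 0 0 570291159944866 ∷ entry 9 1 0 0 0 3325757572046830 ∷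
    entry 10 1 0 0 0 16397202085195774 ∷ entry 11 1 0 12 0 119727272593690684 ∷
    entry 12 1 0 12 0 609219033794821588 ∷ entry 13 1 0 12 0 4310277735584653768 ∷
    entry 14 1 0 14 0 26673925536663628708 ∷ entry 15 1 0 17 0 159648792335035662412 ∷
    entry 16 1 0 13 0 960196726221006241612 ∷ entry 17 1 0 17 0 5586481114234972119496 ∷
    entry 18 1 0 12 0 34483372329670294862656 ∷ entry 19 1 0 18 0 217790129235799358109640 ∷
    entry 20 1 0 13 0 1312908878474579150429860 ∷ entry 21 1 0 15 0 7840445434906693637199304 ∷
    entry 22 1 0 12 0 47264635973254868026150564 ∷ []) ∷
  row 4 6 (
    entry 14 0 0 0 18 4738372717082330862 ∷ entry 15 0 0 0 11 18663946884576117902 ∷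
    entry 16 0 0 0 1 136458039732472746203 ∷ entry 17 0 0 0 14 511737133084092989072 ∷
    entry 18 0 0 0 6 6140652565060794536247 ∷ entry 19 0 0 0 7 36467360779762513765292 ∷
    entry 20 0 0 0 10 171861091131873983689699 ∷ entry 21 0 0 0 18 1059312523556676710019063 ∷
    entry 22 0 0 13 27 6366906143492293875596907 ∷ entry 23 0 0 0 28 47751964901540142099892311 ∷
    entry 24 0 0 15 4 117788184427206732241471834 ∷ entry 26 0 0 0 1 9383261448626806642662710448 ∷
    entry 27 0 0 0 34 48993516905805057306820548993 ∷ entry 28 0 0 18 10 185659502879479407682060796380 ∷
    entry 29 0 0 16 36 1782294403590297395051659015392 ∷ entry 30 0 0 16 28 13367491620645246355040419732683 ∷
    entry 31 0 0 30 7 80199466140177716658042825936080 ∷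
    entry 32 0 0 13 27 481196796835764051298385694887120 ∷
    entry 33 0 0 14 42 2844602837689062834093752539384791 ∷
    entry 35 0 0 14 38 102885149633967125371301894906852060 ∷
    entry 38 0 0 29 7 17878648464506849766686010319401118669 ∷
    entry 39 0 0 26 8 133341463828677717109526857386371706816 ∷ []) ∷
  row 3 6 (
    entry 15 0 0 0 4 2949680437256807999 ∷ entry 16 0 0 0 7 22741584388175730093 ∷
    entry 17 0 0 0 20 126988585872523970156 ∷ entry 18 0 0 0 25 1023018709968820766574 ∷
    entry 19 0 0 0 19 4890009540111760109749 ∷ entry 20 0 0 16 29 36830483870749555055120 ∷
    entry 21 0 0 15 26 221010739962295896529357 ∷ entry 22 0 0 0 22 1061018335139820038303956 ∷
    entry 23 0 0 19 2 6297331532622580142603319 ∷ entry 24 0 0 14 28 47751966366655361438608455 ∷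
    entry 25 0 0 0 17 268143013606163275600224272 ∷ entry 27 0 0 0 10 8251533356669174042284016812 ∷
    entry 28 0 0 15 29 61886548788358309259901710583 ∷ entry 29 0 0 17 36 371319272787596994632909240144 ∷
    entry 30 0 0 21 34 2227911511854613670452613412060 ∷ entry 31 0 0 28 10 10693954511303174961236073491197 ∷
    entry 34 0 0 0 4 2309902827102609421031030545370734 ∷
    entry 37 0 0 30 7 498938763108000408807623820468957576 ∷
    entry 39 0 0 33 17 22221587014804568341619925095502832517 ∷
    entry 46 0 0 25 33 6285194880939960413206319703797370570882287 ∷ []) ∷
  row 2 6 (
    entry 16 0 0 0 21 4668152628285231950 ∷ entry 17 0 0 0 2 28430237181382696278 ∷
    entry 18 0 0 0 15 108034607025142696459 ∷ entry 19 0 0 0 23 818752806775755522759 ∷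
    entry 20 0 0 0 19 4904212985314616297739 ∷ entry 21 0 0 13 18 36835228348484429058701 ∷
    entry 22 0 0 15 30 176552086715065939163408 ∷ entry 23 0 0 15 15 663211332979809480530153 ∷
    entry 24 0 0 18 30 7956386686902961652725727 ∷ entry 25 0 0 0 3 38201573232682581100613062 ∷
    entry 26 0 0 21 6 214176413425446477130129676 ∷ entry 28 0 0 24 8 9383261448626806642692632823 ∷
    entry 29 0 0 0 23 61256222829679754777412358025 ∷ entry 30 0 0 25 15 101081358112453439541981667540 ∷
    entry 31 0 0 0 11 1781530372128857505927274565978 ∷ entry 32 0 0 12 15 13363712406224862180262114882199 ∷
    entry 37 0 0 14 41 103945637516357636593231924184460353 ∷
    entry 41 0 0 38 11 133341463828677897796485025113876029420 ∷
    entry 43 0 0 37 0 4849687657659253939252914080779615166438 ∷ []) ∷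
  row 1 6 (
    entry 17 0 0 0 0 2956918138400906060 ∷ entry 18 0 0 0 11 26692881126058462516 ∷
    entry 19 0 0 0 3 127935971142713473904 ∷ entry 20 0 0 0 17 1023483056707544828063 ∷
    entry 21 0 0 0 7 4890009540111759333815 ∷ entry 22 0 0 14 3 36830483884166084079580 ∷
    entry 23 0 0 16 0 221011373005647145836951 ∷ entry 24 0 0 18 22 1326386657534405926520753 ∷
    entry 25 0 0 16 0 6337452075759939398696180 ∷ entry 26 0 0 18 28 38201573024778611491324583 ∷
    entry 27 0 0 22 7 283564147695127320398823795 ∷ entry 29 0 0 19 6 8251539838792428425690276535 ∷
    entry 30 0 0 0 18 49509239032754286211843472289 ∷ entry 31 0 0 0 35 297055432354242809439137674996 ∷
    entry 32 0 0 0 8 2227915645936993257919400972726 ∷ entry 33 0 0 24 5 13367341732541893685541007262067 ∷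
    entry 42 0 0 24 10 107770836995301874739151145646707778465 ∷
    entry 43 0 0 19 6 806909195049085406038500924443818211991 ∷
    entry 44 0 0 17 5 4849687663600362626959003830772576778608 ∷ []) ∷
  row 6 5 (
    entry 1 1 0 0 0 852554419 ∷ entry 2 1 0 0 0 7703278923 ∷ entry 3 1 0 0 0 66948679246 ∷
    entry 4 1 0 0 0 325702040950 ∷ entry 5 1 0 0 0 1367359578550 ∷ entry 6 1 0 0 0 12626765573014 ∷
    entry 7 1 0 0 0 92379978058294 ∷ entry 8 1 0 0 0 454563566958478 ∷ entry 9 1 0 0 0 3325679211241558 ∷
    entry 10 1 0 0 0 16396731920366182 ∷ entry 11 1 0 12 0 119724451604727742 ∷
    entry 12 1 0 12 0 607984301158203256 ∷ entry 13 1 0 13 0 4310080257770199496 ∷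
    entry 14 1 0 12 0 26629476115901057956 ∷ entry 15 1 0 13 0 154910608548418166860 ∷
    entry 16 1 0 13 0 958661105822860902220 ∷ entry 17 1 0 13 0 5992990983434526793804 ∷
    entry 18 1 0 19 0 34511802515199897926464 ∷ entry 19 1 0 15 0 215747886674922458013568 ∷
    entry 20 1 0 13 0 1169698634340122450833228 ∷ entry 21 1 0 12 0 7840105068492639322019272 ∷
    entry 22 1 0 16 0 47264664403542818866093732 ∷ []) ∷
  row 5 5 (
    entry 14 0 0 0 17 2554750019656698972 ∷ entry 15 0 0 0 2 26672132831356092047 ∷
    entry 16 0 0 0 23 123196689869401801025 ∷ entry 17 0 0 15 26 1023442043422959881360 ∷
    entry 18 0 0 0 15 6125765494571930622140 ∷ entry 19 0 0 16 10 29335947723758108942830 ∷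
    entry 20 0 0 18 4 176858501431780011214839 ∷ entry 21 0 0 0 19 1061145729836986416913916 ∷
    entry 22 0 0 0 30 6366858759911182042194421 ∷ entry 23 0 0 15 33 33079208728512714174824043 ∷
    entry 24 0 0 14 31 206217752315500075543240683 ∷ entry 26 0 0 13 33 7980742709961173467956037710 ∷
    entry 27 0 0 16 34 61886548643105715510111621200 ∷ entry 28 0 0 18 29 297055367874339514266250684512 ∷
    entry 30 0 0 27 11 13366004672571196989380375846091 ∷
    entry 33 0 0 18 36 2844602837022590545502728548092749 ∷
    entry 34 0 0 14 29 13859414994174362488859312170529518 ∷ []) ∷
  row 4 5 (
    entry 15 0 0 0 6 2306121936069678416 ∷ entry 16 0 0 0 9 26678074045246407494 ∷
    entry 17 0 0 0 18 117511369673841318503 ∷ entry 18 0 0 0 17 307036839599914362501 ∷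
    entry 19 0 0 0 1 6131399112448286137894 ∷ entry 20 0 0 15 29 29472723872905812485886 ∷
    entry 21 0 0 15 22 176015664409407581015735 ∷ entry 22 0 0 0 31 1326433093821133772748493 ∷
    entry 23 0 0 16 8 7932869148987233156593774 ∷ entry 24 0 0 21 3 47044527115597210819503451 ∷
    entry 25 0 0 0 26 187027990222210246125092788 ∷ entry 27 0 0 15 10 8251538899153920423221281228 ∷
    entry 28 0 0 16 0 48993517644992546088626798588 ∷ entry 29 0 0 21 38 371318806382991989679529477182 ∷
    entry 30 0 0 0 6 2227912835432434287321499431004 ∷ entry 31 0 0 12 37 10692620373548163499185140754657 ∷
    entry 34 0 0 30 1 2887377330388873275185122837080058 ∷
    entry 37 0 0 13 23 498939060163434605335271018183510375 ∷
    entry 42 0 0 34 50 4849687635380096272983114633436425034798 ∷ []) ∷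
  row 3 5 (
    entry 16 0 0 0 13 2884499682854554195 ∷ entry 17 0 0 0 20 26692812986041123943 ∷
    entry 18 0 0 14 0 170573683079366282716 ∷ entry 19 0 0 0 19 818160439981113421712 ∷
    entry 20 0 0 14 3 4908947705550783268444 ∷ entry 21 0 0 13 18 36825751560391836517619 ∷
    entry 22 0 0 18 2 220698638212524045084476 ∷ entry 23 0 0 0 28 1061151023866289772632339 ∷
    entry 24 0 0 13 26 6190069744055735963971856 ∷ entry 25 0 0 0 12 37140418510523893218584492 ∷
    entry 26 0 0 22 2 252452905616421493684567437 ∷ entry 28 0 0 18 3 7710350001977144248978164595 ∷
    entry 29 0 0 16 1 49509239032630173780256082444 ∷ entry 31 0 0 18 36 1782332207245993876067473567239 ∷
    entry 35 0 0 27 8 2887378667583950235007739090349116 ∷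
    entry 37 0 0 23 10 103945637534046606378511270885194807 ∷ []) ∷
  row 2 5 (
    entry 17 0 0 0 10 2175190839932799004 ∷ entry 18 0 0 0 10 13903631416763743094 ∷
    entry 19 0 0 0 12 127935869578947297100 ∷ entry 20 0 0 16 16 1023069177834084735629 ∷
    entry 21 0 0 0 16 4890009540111759318683 ∷ entry 22 0 0 12 11 36299752258817488952344 ∷
    entry 23 0 0 0 10 176859135286967280208760 ∷ entry 24 0 0 12 25 1060847766160810669650033 ∷
    entry 25 0 0 21 7 6366919937681255321648173 ∷ entry 26 0 0 0 25 37140418236312010214394933 ∷
    entry 27 0 0 0 14 229204527212684773492102555 ∷ entry 29 0 0 16 5 10313938435867149932690829034 ∷
    entry 30 0 0 20 16 55869800991139301348451305500 ∷ entry 31 0 0 16 0 293961106211118732750194761261 ∷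
    entry 33 0 0 19 18 10685744088984498464303194476226 ∷ entry 35 0 0 0 0 384872446927600634702301052792878 ∷
    entry 38 0 0 21 37 94706025308800016995780848814812884 ∷
    entry 39 0 0 24 0 498914676631348646706135062053650327 ∷
    entry 47 0 0 27 3 838025841373319791319106056111684494117933 ∷ []) ∷
  row 1 5 (
    entry 18 0 0 0 23 4730337789753160422 ∷ entry 19 0 0 0 8 28430287770891693489 ∷
    entry 20 0 0 0 17 136464285654336324627 ∷ entry 21 0 0 0 26 1023482325476655310851 ∷
    entry 22 0 0 13 0 4908963066472453515159 ∷ entry 23 0 0 18 11 29472730583549476366828 ∷
    entry 24 0 0 14 29 220698639918675461484692 ∷ entry 25 0 0 15 5 1326441780916588122501010 ∷
    entry 26 0 0 13 0 7958660817453725485861995 ∷ entry 27 0 0 0 31 47751966659666555908508228 ∷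
    entry 28 0 0 0 4 229204527212684773492116059 ∷ entry 30 0 0 21 4 8251539838792428032055536696 ∷
    entry 31 0 0 0 17 61256222831035173958915185131 ∷ entry 32 0 0 21 34 297055434049637602237863800691 ∷
    entry 33 0 0 27 14 1782332568333509549340553562289 ∷
    entry 39 0 0 15 39 103688981638903075915907037554540529 ∷
    entry 40 0 0 28 39 498938763108000408807847599760364036 ∷
    entry 43 0 0 21 14 107770836995301874734412764307488913168 ∷ []) ∷
  row 7 4 (
    entry 1 1 0 0 0 862538803 ∷ entry 2 1 0 0 0 134473035 ∷ entry 3 1 0 0 0 69657052228 ∷
    entry 4 1 0 0 0 351098866894 ∷ entry 5 1 0 0 0 2564110520014 ∷ entry 6 1 0 0 0 9118220151178 ∷
    entry 7 1 0 0 0 92382154747318 ∷ entry 8 1 0 0 0 471490216884982 ∷ entry 9 1 0 0 0 3221372034289102 ∷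
    entry 10 1 0 12 0 20530481757550870 ∷ entry 11 1 0 0 0 94723991398874890 ∷
    entry 12 1 0 12 0 541529322312541048 ∷ entry 13 1 0 15 0 4434694089509853640 ∷
    entry 14 1 0 12 0 26672131283915504548 ∷ entry 15 1 0 12 0 150303549876288626764 ∷
    entry 16 1 0 16 0 957870156880327278412 ∷ entry 17 1 0 14 0 6077894075066559650248 ∷
    entry 18 1 0 17 0 34580614585529580408208 ∷ entry 19 1 0 19 0 217785434514201471492172 ∷
    entry 20 1 0 18 0 1130932134358264546465600 ∷ entry 21 1 0 16 0 7803428417423038288694656 ∷
    entry 23 1 0 15 0 280923479494762763725983820 ∷ []) ∷
  row 6 4 (
    entry 14 0 0 0 9 2560140314356870440 ∷ entry 15 0 0 0 13 28411275997150292186 ∷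
    entry 16 0 0 0 23 117511471233771694513 ∷ entry 17 0 0 0 10 818423716954532164357 ∷
    entry 18 0 0 0 20 6121030775427601444800 ∷ entry 19 0 0 0 6 36754614887416331611868 ∷
    entry 20 0 0 19 6 221058716987007202976824 ∷ entry 21 0 0 0 20 1059312512978078743993824 ∷
    entry 22 0 0 0 22 7251223145313803961975955 ∷ entry 23 0 0 15 19 47751845819254271422033541 ∷
    entry 24 0 0 12 33 214158839716738909920552883 ∷ entry 26 0 0 18 33 7415235623315537538400821788 ∷
    entry 27 0 0 17 37 54527174862575765659015923440 ∷ entry 28 0 0 0 18 256356433008376921664578576880 ∷
    entry 29 0 0 13 35 1670936803844893715155109104051 ∷ entry 30 0 0 26 5 13366577700975829979249072954509 ∷
    entry 31 0 0 17 7 64135087825780729903511805673738 ∷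
    entry 33 0 0 32 13 2309902970358637358299425886894926 ∷
    entry 34 0 0 22 41 17067617024776125681086042886255744 ∷
    entry 40 0 0 30 11 636074539762098920660285952289775563767 ∷ []) ∷
  row 5 4 (
    entry 15 0 0 0 17 1664927999079365836 ∷ entry 16 0 0 13 1 26692495568150092252 ∷
    entry 17 0 0 0 16 170489590808359330201 ∷ entry 18 0 0 14 12 1008325224199237247542 ∷
    entry 19 0 0 0 6 6130503876421320625756 ∷ entry 20 0 0 0 18 29462297241957800094224 ∷
    entry 21 0 0 0 23 173982938019515395983671 ∷ entry 22 0 0 0 16 1326295443899490409895561 ∷
    entry 23 0 0 16 30 7874734884326146387618892 ∷ entry 24 0 0 0 24 38201573266319262404818988 ∷
    entry 25 0 0 0 22 89829702713191321092472886 ∷ entry 27 0 0 0 12 8251141905736931116532019190 ∷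
    entry 29 0 0 0 21 340376018255551667893168638471 ∷ entry 31 0 0 21 38 13360274043403897687160629274799 ∷
    entry 32 0 0 26 1 80204394177529483441740454323408 ∷ entry 33 0 0 18 3 384983842718051322542908371241532 ∷
    entry 34 0 0 0 2 2630722922591541822051294379286160 ∷
    entry 36 0 0 24 37 83156510027227926181693807178776051 ∷
    entry 37 0 0 26 6 448891160610003664985282718931726488 ∷
    entry 39 0 0 21 38 19832827641496525562077036061026391962 ∷
    entry 41 0 0 21 37 758886310508542914965869442335989399052 ∷
    entry 46 0 0 43 16 5028156156993385682265432477737930951347615 ∷ []) ∷
  row 4 4 (
    entry 16 0 0 0 16 4738381338312168092 ∷ entry 17 0 0 0 5 21322628001938486356 ∷
    entry 18 0 0 12 23 170573684333220687248 ∷ entry 19 0 0 0 26 816579100636625768336 ∷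
    entry 20 0 0 0 7 4804648477029345206830 ∷ entry 21 0 0 0 8 29339372732750766785956 ∷
    entry 22 0 0 12 29 176859132318470108288692 ∷ entry 23 0 0 19 2 1059312512983146336190412 ∷
    entry 24 0 0 20 20 7958282039439161012447159 ∷ entry 25 0 0 12 28 34402581775800644755163835 ∷
    entry 26 0 0 20 4 244949903050572560549078190 ∷ entry 28 0 0 21 1 9661096097235838290238634749 ∷
    entry 29 0 0 24 11 54529827749610718972257238197 ∷ entry 31 0 0 24 8 2227908858967028604939154685766 ∷
    entry 32 0 0 14 37 10693479884043000129323614365968 ∷ entry 33 0 0 24 7 80203763880636759214724307956331 ∷ []) ∷
  row 3 4 (
    entry 17 0 0 0 19 2175190833583851551 ∷ entry 18 0 0 0 14 22630889394755562456 ∷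
    entry 19 0 0 0 7 127935971142713474083 ∷ entry 20 0 0 0 11 818291807576090246404 ∷
    entry 21 0 0 12 11 4912753487175070868300 ∷ entry 22 0 0 14 27 36825750855686448760175 ∷
    entry 23 0 0 0 17 221058743000842214684756 ∷ entry 24 0 0 0 4 1061146285485091784299062 ∷
    entry 25 0 0 0 25 7840754782509602545046856 ∷ entry 26 0 0 0 0 38201573320633527278197405 ∷
    entry 27 0 0 19 5 226703935542954700747094731 ∷ entry 29 0 0 13 25 10314424798490535503724116352 ∷
    entry 30 0 0 26 3 61886548787626346340204973551 ∷ entry 31 0 0 14 11 297054373041699967655090592952 ∷
    entry 32 0 0 25 8 1782327564693373720169087481176 ∷ entry 35 0 0 13 29 481093652988168578339571878034747 ∷
    entry 36 0 0 20 33 2887377330528864032444672567382603 ∷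
    entry 37 0 0 17 29 13859418251212206951002719419747360 ∷
    entry 38 0 0 14 26 94706025308800016995780848814812822 ∷ []) ∷
  row 2 4 (
    entry 18 0 0 13 0 4445879494509132047 ∷ entry 19 0 0 13 18 28429745342420481281 ∷
    entry 20 0 0 14 22 170511529796440190861 ∷ entry 21 0 0 0 14 818774743256483037591 ∷
    entry 22 0 0 15 23 6140941990656629791181 ∷ entry 23 0 0 15 15 36470355920562883920059 ∷
    entry 24 0 0 16 29 221073919395521943875727 ∷ entry 25 0 0 0 30 1326428355456722678287508 ∷
    entry 26 0 0 17 31 6190069733168510084493212 ∷ entry 27 0 0 0 2 47751966643103820377970803 ∷
    entry 28 0 0 14 26 214881518684934369643069350 ∷ entry 33 0 0 23 18 1782318279469759398663228507340 ∷
    entry 37 0 0 15 42 2309902970358653152904252706029433 ∷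
    entry 39 0 0 30 10 82771526184520376708475175014466617 ∷ []) ∷
  row 1 4 (
    entry 19 0 0 13 3 3772942516346978272 ∷ entry 20 0 0 0 14 22744230417361345965 ∷
    entry 21 0 0 0 13 131726996127149624514 ∷ entry 22 0 0 13 0 818555375124081513675 ∷
    entry 23 0 0 0 11 4912714230895389410463 ∷ entry 24 0 0 14 6 36830489369251230072028 ∷
    entry 25 0 0 12 19 176807959303103646989207 ∷ entry 26 0 0 20 25 1326440991185899667552987 ∷
    entry 27 0 0 18 29 7958661061197621651303602 ∷ entry 28 0 0 0 4 38201573321099323869678794 ∷
    entry 29 0 0 18 25 226821778718297988597783983 ∷ entry 32 0 0 0 9 49509239032754164381798672881 ∷
    entry 33 0 0 0 22 371319289675188163966452691048 ∷ entry 35 0 0 22 0 13367494052477319977154797608371 ∷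
    entry 40 0 0 24 1 83156510027239100362237589889989925 ∷
    entry 44 0 0 35 19 107770836995301874734364503017173857393 ∷
    entry 45 0 0 39 0 808281270335433639925849443644128886751 ∷ []) ∷
  row 8 3 (
    entry 1 1 0 0 0 761201971 ∷ entry 2 1 0 0 0 2902998603 ∷ entry 3 1 0 0 0 6965723068 ∷
    entry 4 1 0 0 0 325701952822 ∷ entry 5 1 0 0 0 2411614824142 ∷ entry 6 1 0 0 0 11724831922126 ∷
    entry 7 1 0 0 0 92229776624566 ∷ entry 8 1 0 0 0 422094672116470 ∷ entry 9 1 0 0 0 3320271959627350 ∷
    entry 10 1 0 12 0 19344675226450198 ∷ entry 11 1 0 12 0 112516354588444534 ∷
    entry 12 1 0 12 0 564684992432924116 ∷ entry 13 1 0 12 0 4050588765180780928 ∷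
    entry 14 1 0 14 0 25070700047635319716 ∷ entry 15 1 0 14 0 145821195546508271692 ∷
    entry 16 1 0 12 0 902545167365294325580 ∷ entry 17 1 0 13 0 5992996851800608203136 ∷
    entry 18 1 0 13 0 32491628730727501167424 ∷ entry 19 1 0 15 0 215747886664821895471180 ∷
    entry 20 1 0 20 0 1169698634306190042185548 ∷ entry 21 1 0 19 0 7766923920297053816168524 ∷ []) ∷
  row 7 3 (
    entry 14 0 0 0 10 4730337789717732336 ∷ entry 15 0 0 0 22 28427119358236772814 ∷
    entry 16 0 0 0 20 170028632654799042499 ∷ entry 17 0 0 0 16 1019383385921838562401 ∷
    entry 18 0 0 0 0 6117249881001715653788 ∷ entry 19 0 0 18 10 28996352672095995571132 ∷
    entry 20 0 0 0 9 215747886959943686455151 ∷ entry 21 0 0 14 26 1168825986130567822432717 ∷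
    entry 22 0 0 21 4 7012955916783407187394310 ∷ entry 23 0 0 16 33 47751963342811443045670364 ∷
    entry 24 0 0 15 29 252654884491132969369253072 ∷ entry 26 0 0 24 5 9095576728705773431098552784 ∷
    entry 27 0 0 23 35 61886548643105715510111621120 ∷ entry 28 0 0 12 19 371166486372743447816195116109 ∷
    entry 29 0 0 24 7 1670936785115520061446588879277 ∷ entry 30 0 0 15 38 13366864189547956322274941055373 ∷
    entry 32 0 0 28 10 481186482416263070726697373944279 ∷ []) ∷
  row 6 3 (
    entry 15 0 0 0 17 3290542585122103617 ∷ entry 16 0 0 0 18 22743844452927926509 ∷
    entry 17 0 0 0 10 136403956558538522103 ∷ entry 18 0 0 12 25 1022937273545108697805 ∷
    entry 19 0 0 0 0 4833145918260577342525 ∷ entry 20 0 0 0 2 28998340694690782239592 ∷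
    entry 21 0 0 0 2 216761900566344512475370 ∷ entry 22 0 0 19 2 1043960082617609527400247 ∷
    entry 23 0 0 0 17 7958527487592350990770448 ∷ entry 24 0 0 19 32 47044530105998695356254832 ∷
    entry 25 0 0 0 15 229209439966067972425780047 ∷ entry 27 0 0 20 5 10314424798490445671513408007 ∷
    entry 28 0 0 0 6 49509238844166993356365734821 ∷ entry 29 0 0 21 29 297051720150240463989684525929 ∷
    entry 31 0 0 0 35 10693981301186224502931909919829 ∷ entry 32 0 0 30 12 80203763866307389491662373185217 ∷
    entry 33 0 0 0 33 481229762012313102926399786842119 ∷
    entry 35 0 0 21 36 13808300048567975123877974315667056 ∷
    entry 37 0 0 15 31 623672636982556470559327461088805308 ∷
    entry 40 0 0 19 12 118893020211445100607087301582632627466 ∷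
    entry 43 0 0 39 45 29098125988731257872789927346865596105549 ∷
    entry 45 0 0 16 40 1047513076963264406426280670717248777485553 ∷ []) ∷
  row 5 3 (
    entry 16 0 0 0 0 1039344284553235296 ∷ entry 17 0 0 0 25 22744165847598538217 ∷
    entry 18 0 0 0 26 136462457612121524064 ∷ entry 19 0 0 0 15 818423703709352136399 ∷
    entry 20 0 0 0 19 4899474603882444792896 ∷ entry 21 0 0 0 26 36825488774045295696845 ∷
    entry 22 0 0 0 9 176552085497191052368320 ∷ entry 23 0 0 19 1 1325897595364557255647742 ∷
    entry 24 0 0 12 25 5728270897368410493382928 ∷ entry 25 0 0 0 0 32969490561007981223701950 ∷
    entry 26 0 0 13 29 206193529710098576143337739 ∷ entry 28 0 0 25 5 8817267999357785099802954428 ∷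
    entry 29 0 0 12 32 54621352352376800890592033965 ∷ entry 30 0 0 23 9 278489469543844720329181759939 ∷
    entry 31 0 0 28 8 2227914583553989546522624132923 ∷ entry 32 0 0 14 13 13358555193825248384930469007594 ∷
    entry 33 0 0 23 41 64163114249207652576061416398996 ∷
    entry 34 0 0 26 5 481229777930010656003084611398643 ∷
    entry 37 0 0 21 2 91754482514623366002062878856289179 ∷ []) ∷
  row 4 3 (
    entry 17 0 0 0 8 3784123985464901420 ∷ entry 18 0 0 0 12 26692811340584993135 ∷
    entry 19 0 0 0 9 170562106795296827824 ∷ entry 20 0 0 13 12 818730869824389571072 ∷
    entry 21 0 0 0 9 6140941989239240366039 ∷ entry 22 0 0 15 1 36821013094406935191715 ∷
    entry 23 0 0 0 7 221073853838568523690847 ∷ entry 24 0 0 13 0 1326440201443920108160933 ∷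
    entry 25 0 0 0 2 6366928256159683048052053 ∷ entry 26 0 0 0 26 38201573264457329911786012 ∷
    entry 27 0 0 13 2 228811491748136944774706464 ∷ entry 29 0 0 0 30 10314424798490535546112672508 ∷
    entry 30 0 0 0 28 61886548787850103236738222827 ∷ entry 31 0 0 20 6 290522965155746011095341456941 ∷
    entry 33 0 0 16 32 13360274441484788377321597403499 ∷ entry 35 0 0 0 2 384810560382084881144261398191224 ∷
    entry 37 0 0 22 40 15784337551363513358092072877064460 ∷
    entry 38 0 0 32 9 83156510026399019994273097140274196 ∷
    entry 41 0 0 33 18 17961806165883645792069768887043675989 ∷
    entry 42 0 0 37 20 101035159683095503281732899931695958030 ∷
    entry 47 0 0 16 51 838026028475467339872346783927231245143381 ∷ []) ∷
  row 3 3 (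
    entry 18 0 0 0 2 2361573672410676096 ∷ entry 19 0 0 0 2 14215143685835360251 ∷
    entry 20 0 0 0 23 136462457605591246621 ∷ entry 21 0 0 0 23 1023442105999335305773 ∷
    entry 22 0 0 12 26 6140942177215715547595 ∷ entry 23 0 0 17 5 29467990983648513752614 ∷
    entry 24 0 0 12 25 221073919294181248478960 ∷ entry 25 0 0 0 6 1061136808773195675690872 ∷
    entry 26 0 0 0 13 6366925886982116375490956 ∷ entry 27 0 0 17 31 38201573313849322172204216 ∷
    entry 28 0 0 20 22 64730443694230727193039287 ∷ entry 30 0 0 23 2 8022208603472051872626376560 ∷
    entry 31 0 0 14 32 54580497892011889153385221268 ∷ entry 32 0 0 17 31 371319292191268663073772067915 ∷
    entry 33 0 0 28 39 2227915049037351148159813737517 ∷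
    entry 37 0 0 28 7 2887377903552407088019820453870970 ∷
    entry 38 0 0 18 41 17324272921854297936238227228642336 ∷ []) ∷
  row 2 3 (
    entry 19 0 0 0 18 4303298483954121555 ∷ entry 20 0 0 0 16 22744218724174060439 ∷
    entry 21 0 0 14 23 136463066971861598441 ∷ entry 22 0 0 13 24 1023478669151036013762 ∷
    entry 23 0 0 0 27 6049965291452522495019 ∷ entry 24 0 0 15 28 29472728877389345797007 ∷
    entry 25 0 0 19 5 221011372802699633735869 ∷ entry 26 0 0 15 15 1326441938792861417489933 ∷
    entry 27 0 0 18 0 6226915404126731478091748 ∷ entry 28 0 0 20 3 38024714183638221111951327 ∷
    entry 29 0 0 0 10 270594477738177630069308053 ∷ entry 31 0 0 0 33 8022316888753100268872970287 ∷
    entry 32 0 0 12 17 48993517792809934972896410939 ∷ entry 35 0 0 15 21 13334488379488473681361782176663 ∷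
    entry 41 0 0 31 11 623672636982556470559394278871542611 ∷
    entry 43 0 0 23 46 22452257707354557240087211123759641387 ∷ []) ∷
  row 1 3 (
    entry 20 0 0 13 18 4317009078104358203 ∷ entry 21 0 0 0 5 28430287770457246886 ∷
    entry 22 0 0 0 6 170581423499526804457 ∷ entry 23 0 0 14 3 1023483056705731185394 ∷
    entry 24 0 0 12 11 4605658318309237456864 ∷ entry 26 0 0 15 10 176859135282892452514186 ∷
    entry 27 0 0 0 4 1061154182872896711773180 ∷ entry 28 0 0 13 1 6366920358870669934368100 ∷
    entry 29 0 0 0 21 47751966659666556644737857 ∷ entry 30 0 0 20 6 261044084406241949008053135 ∷
    entry 33 0 0 0 13 48993517792829536044533411777 ∷ entry 34 0 0 0 16 340376018339763234066306067656 ∷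
    entry 39 0 0 17 2 2887378794922530945401245309674698 ∷
    entry 41 0 0 29 4 83156510027239100508971415284534403 ∷
    entry 45 0 0 27 43 107770836995301874734123196560129707174 ∷
    entry 46 0 0 28 43 808281277464525300809840984998099864707 ∷ []) ∷
  row 9 2 (
    entry 1 1 0 0 0 454392115 ∷ entry 2 1 0 0 0 6651279435 ∷ entry 3 1 0 0 0 15672852412 ∷
    entry 4 1 0 0 0 363796763446 ∷ entry 5 1 0 0 0 2484144021436 ∷ entry 6 1 0 0 0 12168895518670 ∷
    entry 7 1 0 0 0 92308019856310 ∷ entry 8 1 0 0 0 438080245518214 ∷ entry 9 1 0 0 0 3221372030975974 ∷
    entry 10 1 0 12 0 18701462167550230 ∷ entry 11 1 0 12 0 115969393234424638 ∷
    entry 12 1 0 12 0 541529295808200568 ∷ entry 13 1 0 13 0 4306722975898433992 ∷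
    entry 14 1 0 14 0 26607504357785533348 ∷ entry 15 1 0 12 0 150296333477145354316 ∷
    entry 16 1 0 14 0 960572627095366433296 ∷ entry 17 1 0 18 0 6021163896422853370240 ∷
    entry 18 1 0 13 0 31411277785590172515136 ∷ entry 19 1 0 16 0 216761900281318987571584 ∷
    entry 20 1 0 19 0 1130806000281246210703180 ∷ entry 21 1 0 22 0 7803428410161267019912648 ∷ []) ∷
  row 8 2 (
    entry 14 0 0 0 20 4621993627969541271 ∷ entry 15 0 0 0 22 28427728710126243675 ∷
    entry 16 0 0 0 8 136455144970894876299 ∷ entry 17 0 0 0 16 1020171795878516702400 ∷
    entry 18 0 0 14 0 4894728910321032429235 ∷ entry 19 0 0 0 25 36783023238495622947744 ∷
    entry 20 0 0 0 1 220186394266715950035757 ∷ entry 21 0 0 0 15 915819168357049458335223 ∷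
    entry 22 0 0 0 18 7012955916783407187393884 ∷ entry 23 0 0 17 12 38198707462287765843943516 ∷
    entry 24 0 0 18 28 57479219127389638637715107 ∷ entry 26 0 0 17 31 7145285944509878713971589710 ∷
    entry 27 0 0 0 15 52765923158872086815806503571 ∷ entry 28 0 0 0 3 297054594114843364079625027850 ∷
    entry 29 0 0 22 7 1782151142383707459307619749239 ∷ entry 31 0 0 25 40 64160879304257210958027754340275 ∷
    entry 32 0 0 25 29 479298912832297741511695572558431 ∷
    entry 33 0 0 21 4 2831062060986189574973570348047568 ∷
    entry 34 0 0 27 12 13859417535640123635885155281987575 ∷
    entry 39 0 0 31 34 134713546242923993880697592258381653385 ∷
    entry 40 0 0 21 48 646625020560797935190961379922301805035 ∷ []) ∷
  row 7 2 (
    entry 15 0 0 0 11 4141086920986152444 ∷ entry 16 0 0 0 14 21322644930448063276 ∷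
    entry 17 0 0 15 24 134253711329171379863 ∷ entry 18 0 0 0 10 818291604667328061200 ∷
    entry 19 0 0 0 18 4909752796669224208167 ∷ entry 20 0 0 15 11 36126983380540876423402 ∷
    entry 21 0 0 0 20 152633528993997697736726 ∷ entry 22 0 0 0 31 1326440199750926912896948 ∷
    entry 23 0 0 0 13 6366849282724085078527808 ∷ entry 24 0 0 20 11 38024694290764506206971552 ∷
    entry 25 0 0 0 20 286492148439652997792294044 ∷ entry 27 0 0 20 3 8070082365485648000256025518 ∷
    entry 28 0 0 17 35 48672934817277671824029252411 ∷ entry 30 0 0 23 2 2227910182545313546517190679660 ∷
    entry 31 0 0 29 14 10692620374435169504170447040227 ∷
    entry 33 0 0 28 39 471864592193144975677395249982295 ∷
    entry 34 0 0 19 3 2309901967567209568746435747616947 ∷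
    entry 35 0 0 22 6 13859411805404010815175728698788620 ∷
    entry 37 0 0 17 45 498939060163434605332941071576819127 ∷ []) ∷
  row 6 2 (
    entry 16 0 0 0 15 3746221809636359952 ∷ entry 17 0 0 0 20 20638271868987977063 ∷
    entry 18 0 0 0 4 136451488734096509744 ∷ entry 19 0 0 0 9 818708933814119124493 ∷
    entry 20 0 0 0 6 4899470940059741906187 ∷ entry 21 0 0 14 29 29457566786064473874831 ∷
    entry 22 0 0 14 29 176380953841830721476536 ∷ entry 23 0 0 14 28 1061141531835870799080462 ∷
    entry 24 0 0 19 3 5728270897368410493382861 ∷ entry 25 0 0 21 4 34329913959596066074282251 ∷
    entry 26 0 0 18 6 285580423722209934777734326 ∷ entry 28 0 0 18 29 9374572015393338928769530608 ∷
    entry 29 0 0 19 0 54527174862575765659016821563 ∷ entry 30 0 0 20 3 266971695200429865844234390023 ∷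
    entry 31 0 0 22 29 1782327563806769537196128062541 ∷ entry 32 0 0 23 6 13367487641336938609455757878288 ∷ []) ∷
  row 5 2 (
    entry 17 0 0 0 5 3784123985464901358 ∷ entry 18 0 0 0 10 22744219703725021541 ∷
    entry 19 0 0 15 13 170581301623841743888 ∷ entry 20 0 0 0 8 818708925820974388312 ∷
    entry 21 0 0 14 8 6140849792923375294954 ∷ entry 22 0 0 0 8 29462306388160893849666 ∷
    entry 23 0 0 0 21 216775249933362539434353 ∷ entry 24 0 0 15 2 1325727072662460047999865 ∷
    entry 25 0 0 0 2 7957944666640652002516005 ∷ entry 26 0 0 0 2 47751847252468640394624622 ∷
    entry 27 0 0 0 19 286511799958070431710032323 ∷ entry 29 0 0 0 17 10113866538519886243855857081 ∷
    entry 30 0 0 13 12 52765923158944211311700502988 ∷ entry 32 0 0 22 30 1782332502011045769834455020421 ∷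
    entry 34 0 0 22 37 64163114248184261656107864664292 ∷
    entry 35 0 0 21 40 481229796500760092892083677126520 ∷
    entry 37 0 0 25 4 12511974888325802187596014958144312 ∷
    entry 38 0 0 17 36 88884927020284935636281240490658928 ∷
    entry 39 0 0 25 37 533322607806194745199857397362641965 ∷
    entry 41 0 0 34 10 22452257707354557240087208670526602718 ∷ []) ∷
  row 4 2 (
    entry 18 0 0 0 5 4730041573213195111 ∷ entry 19 0 0 0 19 28430286055152753294 ∷
    entry 20 0 0 0 13 170581352407700239669 ∷ entry 21 0 0 0 24 1023200737002921420005 ∷
    entry 22 0 0 13 27 4894736222481438228283 ∷ entry 23 0 0 12 21 36825750307866957613451 ∷
    entry 24 0 0 15 13 176845868308771240394218 ∷ entry 25 0 0 15 28 1326423617075384296204395 ∷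
    entry 26 0 0 18 31 6809076713505185036649584 ∷ entry 27 0 0 18 31 32969490561007981223804823 ∷
    entry 28 0 0 16 30 252466416321077494721511476 ∷ entry 30 0 0 15 31 7162794998951760795951257078 ∷
    entry 31 0 0 16 36 58104593031486222901231799371 ∷ entry 32 0 0 26 0 297054594115614204150741369837 ∷
    entry 33 0 0 25 8 2227874371413439714415936583335 ∷ []) ∷
  row 3 2 (
    entry 19 0 0 12 0 3410078665055397220 ∷ entry 20 0 0 0 19 28430286055152625466 ∷
    entry 21 0 0 0 20 136382022065925645092 ∷ entry 22 0 0 0 23 1023483056431456611043 ∷
    entry 23 0 0 0 15 4912753588304193965235 ∷ entry 24 0 0 13 14 36821958211285528943807 ∷
    entry 25 0 0 0 15 176807960730021038144227 ∷ entry 26 0 0 13 27 1326440201455206381936824 ∷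
    entry 27 0 0 12 6 7958651633181279279190840 ∷ entry 28 0 0 12 10 38201573326573844373425188 ∷
    entry 29 0 0 0 14 229204527212684773617286870 ∷ entry 32 0 0 26 2 61886548790871271589059677367 ∷
    entry 33 0 0 17 16 371319287628207419605072398668 ∷ entry 34 0 0 15 24 1782332457796529458235730541673 ∷
    entry 35 0 0 15 28 13358555370685041051646013909724 ∷
    entry 37 0 0 29 40 481226021442535375106014383570096 ∷
    entry 41 0 0 30 13 467338303073608017998900326417847091 ∷ []) ∷
  row 2 2 (
    entry 20 0 0 0 8 3790705070657291382 ∷ entry 21 0 0 14 0 28430200011300585002 ∷
    entry 22 0 0 0 9 170581423499514711223 ∷ entry 23 0 0 13 25 818774745309641381065 ∷
    entry 24 0 0 0 16 4912753385644016441872 ∷ entry 26 0 0 13 28 220698639918440502018020 ∷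
    entry 27 0 0 13 27 1061151023939779686083323 ∷ entry 28 0 0 20 4 6366928387794641317977277 ∷
    entry 29 0 0 12 30 47044529616409583956732511 ∷ entry 30 0 0 22 21 224611102436265091626172340 ∷
    entry 32 0 0 17 20 4813331917119667034871412367 ∷ entry 34 0 0 13 27 297055433718898584576167824578 ∷
    entry 36 0 0 20 34 13367494538823832866217892162281 ∷ []) ∷
  row 1 2 (
    entry 21 0 0 0 24 4738381338321593484 ∷ entry 22 0 0 0 25 22744230415671988106 ∷
    entry 23 0 0 14 26 170581657087590400509 ∷ entry 24 0 0 14 5 1023478669320830308108 ∷
    entry 25 0 0 16 1 4912753760851634732331 ∷ entry 27 0 0 12 5 221073919632714728749810 ∷
    entry 28 0 0 12 10 1326441938861979262697932 ∷ entry 29 0 0 20 5 6366920358870656873688203 ∷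
    entry 30 0 0 14 13 38201573327731439805451076 ∷ entry 31 0 0 12 24 279584817140154119957250045 ∷
    entry 33 0 0 18 36 10113866538519886243885234941 ∷ entry 34 0 0 22 9 49509239032754286253746683210 ∷ []) ∷
  row 10 1 (
    entry 1 1 0 0 0 193491763 ∷ entry 2 1 0 0 0 2902376523 ∷ entry 3 1 0 0 0 66948150070 ∷
    entry 4 1 0 0 0 325682917174 ∷ entry 5 1 0 0 0 2411614823734 ∷ entry 6 1 0 0 0 11724831921718 ∷
    entry 7 1 0 0 0 86818174804918 ∷ entry 8 1 0 0 0 2405023426954 ∷ entry 9 1 0 0 0 3125454294120022 ∷
    entry 10 1 0 0 0 15195382417636966 ∷ entry 11 1 0 12 0 112516354588352446 ∷
    entry 12 1 0 13 0 564684965928583636 ∷ entry 13 1 0 14 0 4050588765180688840 ∷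
    entry 14 1 0 14 0 25070699093479062436 ∷ entry 15 1 0 15 0 166471771306538334664 ∷
    entry 16 1 0 14 0 902545167365290958500 ∷ entry 17 1 0 13 0 5992996851800608111048 ∷
    entry 18 1 0 13 0 32491626027236501511844 ∷ entry 19 1 0 16 0 215747886674918161463752 ∷
    entry 20 1 0 21 0 1169698634306190038818468 ∷ entry 21 1 0 15 0 7766923920297061603026376 ∷
    entry 22 1 0 15 0 42113691661761569194270372 ∷ []) ∷
  row 9 1 (
    entry 14 0 0 0 4 3290527628180281075 ∷ entry 15 0 0 0 17 28337798779232875459 ∷
    entry 16 0 0 0 13 136403947225412655807 ∷ entry 17 0 0 0 21 706648271170927938767 ∷
    entry 18 0 0 0 0 6140284094060118430542 ∷ entry 19 0 0 0 10 36825690233828669574869 ∷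
    entry 20 0 0 19 6 220357239014902653664531 ∷ entry 21 0 0 0 20 1060677164360433989561452 ∷
    entry 22 0 0 20 0 7958513272047738539988109 ∷ entry 23 0 0 0 19 47725643988738406766409795 ∷
    entry 24 0 0 17 29 206193529710098576142267168 ∷ entry 26 0 0 22 14 2293420843182887854798767160 ∷
    entry 27 0 0 14 35 61886548643105715509395544832 ∷ entry 28 0 0 15 35 327482987204236995115105825152 ∷
    entry 29 0 0 0 21 1964897923225421970688757172883 ∷ entry 30 0 0 12 26 13366004672570645510966188683648 ∷
    entry 31 0 0 22 39 80197747069377178454447676951187 ∷
    entry 33 0 0 29 2 2309729768404519767539432955417517 ∷
    entry 35 0 0 26 29 81799680451157025730511169888281123 ∷
    entry 41 0 0 37 16 3816447238572498020028418293842119205293 ∷ []) ∷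
  row 8 1 (
    entry 15 0 0 0 5 1319873196853815416 ∷ entry 16 0 0 0 21 19582870210546805025 ∷
    entry 17 0 0 0 18 165948643904659899970 ∷ entry 18 0 0 15 0 1022937273544310405869 ∷
    entry 19 0 0 0 25 6140388182800607347392 ∷ entry 20 0 0 0 19 28824191569435538926578 ∷
    entry 21 0 0 0 20 221048779446889917785488 ∷ entry 22 0 0 0 11 1326424562239516523423648 ∷
    entry 23 0 0 0 18 1768591243691936829089086 ∷ entry 24 0 0 0 23 47044450511751467393071960 ∷
    entry 25 0 0 0 16 286511799957997967457566400 ∷ entry 27 0 0 23 9 10314424798490535130085472846 ∷
    entry 28 0 0 21 34 52765923158260205003326978942 ∷ entry 29 0 0 12 35 297054594114948052081741442165 ∷
    entry 31 0 0 0 33 13107570893883648183343740606112 ∷ entry 32 0 0 0 23 64159160270301536365165919651568 ∷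
    entry 33 0 0 30 7 479298943058901807168398083679437 ∷
    entry 34 0 0 0 14 2887377617040607114595026379346214 ∷
    entry 35 0 0 23 37 17324265702243988681543056469585405 ∷
    entry 36 0 0 19 38 103607729735268716115370916648110285 ∷
    entry 37 0 0 23 1 432729686430204975856268378494602318 ∷
    entry 43 0 0 22 39 29097585471416195398926814425864811485949 ∷
    entry 44 0 0 24 33 174588686635037423609068492433381427205019 ∷
    entry 46 0 0 17 36 6285195198551628937062731699714728481016829 ∷ []) ∷
  row 7 1 (
    entry 16 0 0 0 4 1421514172934326915 ∷ entry 17 0 0 0 17 22682806637568082573 ∷
    entry 18 0 0 0 22 170028849019017591916 ∷ entry 19 0 0 0 12 818708846829534197971 ∷
    entry 20 0 0 0 7 5284654772914853853011 ∷ entry 21 0 0 0 10 36820999795749068568168 ∷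
    entry 22 0 0 0 20 26406051237830826328126 ∷ entry 23 0 0 0 22 1061141547119364321031885 ∷
    entry 24 0 0 0 0 6366849282724085079716430 ∷ entry 25 0 0 20 31 38201573313310239415191744 ∷
    entry 26 0 0 18 34 244254748391895143438488381 ∷ entry 28 0 0 16 36 7415235623315537538449197518 ∷
    entry 29 0 0 0 31 61886548771042011649726784300 ∷ entry 30 0 0 0 30 371318143161274416281708612005 ∷
    entry 31 0 0 19 2 2227914827963453361936923085427 ∷ entry 32 0 0 0 16 13366004654147687253717378489342 ∷
    entry 33 0 0 0 25 80203763880432047978550349839157 ∷
    entry 34 0 0 14 34 481186482195193889773010760399613 ∷
    entry 35 0 0 14 36 2887378619831984376688171923442813 ∷
    entry 36 0 0 25 38 13633656207883809372032627457558720 ∷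
    entry 41 0 0 21 37 107770836995301770865926863857957784003 ∷
    entry 42 0 0 19 50 632367145356724187672301794899774851523 ∷
    entry 44 0 0 16 45 29098053226766666352369565066108519119859 ∷
    entry 45 0 0 17 47 174588665846162964636137263457530509563742 ∷ []) ∷
  row 6 1 (
    entry 17 0 0 0 4 4621993627978120115 ∷ entry 18 0 0 0 25 22743946056058131888 ∷
    entry 19 0 0 12 24 118459005337993726206 ∷ entry 20 0 0 0 15 815633363077048426060 ∷
    entry 21 0 0 16 1 6140850031822596332382 ∷ entry 22 0 0 15 16 28964716010144618622359 ∷
    entry 23 0 0 15 1 221011371369011578911480 ∷ entry 24 0 0 17 29 1043960062322553684247632 ∷
    entry 25 0 0 16 14 6363039624080679851481760 ∷ entry 26 0 0 0 24 5600539299580063071849517 ∷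
    entry 27 0 0 0 13 63669288879571207067935750 ∷ entry 29 0 0 0 3 2873076660690650719265448301 ∷
    entry 30 0 0 0 26 49509239019487102874271319824 ∷ entry 32 0 0 0 5 2227914606548409626405834728390 ∷
    entry 38 0 0 15 17 75071849330146291117773233272826543 ∷
    entry 39 0 0 18 36 623673825204293256669077520069537802 ∷
    entry 41 0 0 14 27 19832827641496525562077036492513044349 ∷
    entry 42 0 0 24 42 114859929475124007216198940743003038398 ∷
    entry 44 0 0 20 0 3879750081034388051883483147173680621679 ∷ []) ∷
  row 5 1 (
    entry 18 0 0 0 24 4738381338320124051 ∷ entry 19 0 0 0 9 28427728710285134044 ∷
    entry 20 0 0 13 26 170581135746455316054 ∷ entry 21 0 0 0 24 818730869825375173206 ∷
    entry 22 0 0 0 26 4894728910462313708382 ∷ entry 23 0 0 15 9 29458513733295797056828 ∷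
    entry 24 0 0 16 28 221069813123572462157485 ∷ entry 25 0 0 14 30 1061141547137607277396819 ∷
    entry 26 0 0 0 7 5747921897383201687824222 ∷ entry 27 0 0 0 5 47751966644322539857542667 ∷
    entry 28 0 0 19 27 286492040223456770715685715 ∷ entry 30 0 0 13 36 10113866538519886243876028188 ∷
    entry 31 0 0 0 1 61886544492283651865739773260 ∷ entry 33 0 0 26 1 1782331765098221342294248955688 ∷
    entry 34 0 0 24 20 10689181525399148563352933268982 ∷
    entry 38 0 0 33 21 17324272880956441565573226025245952 ∷
    entry 39 0 0 21 11 83156510027215765308796925925782200 ∷
    entry 43 0 0 34 9 107770836995301734738936123596358921118 ∷ []) ∷
  row 4 1 (
    entry 19 0 0 0 9 4185570182183954282 ∷ entry 20 0 0 0 22 28430287700800207662 ∷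
    entry 21 0 0 0 3 170579168847337696271 ∷ entry 22 0 0 0 4 818292130436135436899 ∷
    entry 23 0 0 13 7 4261384281622463859502 ∷ entry 24 0 0 15 6 36825750378631532604844 ∷
    entry 25 0 0 16 1 176858767235815613370414 ∷ entry 26 0 0 15 1 1326439411716519998611650 ∷
    entry 27 0 0 17 11 7958636470361560871858314 ∷ entry 28 0 0 0 3 32895799254437224547744895 ∷
    entry 29 0 0 0 9 229209439966456345239835919 ∷ entry 31 0 0 20 4 8251539838792428436932656713 ∷
    entry 32 0 0 26 24 61886516858043690106028322316 ∷ entry 33 0 0 14 1 297055430307264019103863721143 ∷
    entry 34 0 0 28 1 1782332465165663040555452504046 ∷
    entry 40 0 0 18 31 103945637534023084154214113846880168 ∷
    entry 41 0 0 24 45 533309562121709614370498599081476078 ∷ []) ∷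
  row 3 1 (
    entry 20 0 0 0 1 3790705070657288965 ∷ entry 21 0 0 0 24 28430285584967780958 ∷
    entry 22 0 0 0 4 170581200067573761006 ∷ entry 23 0 0 0 4 1023471345769100981387 ∷
    entry 24 0 0 16 3 4912753707182630898877 ∷ entry 26 0 0 0 15 176210925209096795475138 ∷
    entry 27 0 0 16 2 1326439411726864113621960 ∷ entry 28 0 0 21 28 6366926676712182700768781 ∷
    entry 29 0 0 0 11 47751966659590386677236620 ∷ entry 30 0 0 20 29 229209439966456345469189801 ∷
    entry 32 0 0 19 15 10274631492940803541749745924 ∷ entry 33 0 0 24 35 48993517792811031820428430428 ∷
    entry 34 0 0 22 8 371319101148262124038640757004 ∷ entry 35 0 0 20 16 1782332465165023944050188856452 ∷
    entry 38 0 0 18 39 384983842718619936347274955586736 ∷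
    entry 41 0 0 32 13 101443242556377329083778190714863598 ∷ []) ∷
  row 2 1 (
    entry 21 0 0 13 19 3780041275207109663 ∷ entry 22 0 0 14 0 21322715967592361160 ∷
    entry 23 0 0 13 2 136465318220470131844 ∷ entry 24 0 0 15 15 818781326763145728191 ∷
    entry 25 0 0 13 27 4912121916301439847625 ∷ entry 27 0 0 0 13 195281962403054473366709 ∷
    entry 28 0 0 14 15 1326440359402003339972991 ∷ entry 29 0 0 12 26 6366928848470608031085768 ∷
    entry 30 0 0 12 10 47751966651837976651549876 ∷ entry 31 0 0 17 33 279614293662783551071458743 ∷
    entry 39 0 0 24 31 479670262368842525845913414192309 ∷ []) ∷
  row 1 1 (
    entry 22 0 0 12 24 4178989096991981567 ∷ entry 23 0 0 0 3 21322716011128007884 ∷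
    entry 24 0 0 13 12 170581690940920711372 ∷ entry 26 0 0 12 21 4894747922486229693695 ∷
    entry 28 0 0 12 11 221073853909881436765300 ∷ entry 30 0 0 21 6 6366928870407559880787148 ∷
    entry 31 0 0 16 18 47751966659666556644740235 ∷ entry 32 0 0 23 12 286511799958070431836989932 ∷
    entry 35 0 0 14 23 61886548790942786725213686959 ∷ []) ∷
  []

valid12 : All (ValidRow 12) table12
valid12 = toWitness {a? = All.all? (validRow? 12) table12} _

complete12 : Complete 12 table12
complete12 = toWitness {a? = complete? 12 table12} _

theorem4p4 : (x : ℕ) → 2 ∣ x → 4 ≤ x → x ≤ 12 →
    (v : ℕ) (L : List ℕ) → length L ≡ v ∸ 1 → UnderlyingSet12x x L →
    Realizable v L ⇔ Admissible v L
theorem4p4 _ (divides 1 refl) (s≤s (s≤s ()))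
theorem4p4 _ (divides 2 refl) 4≤x _ v L size U = realizable⇔admissible 4≤x size U table4 complete4 valid4
theorem4p4 _ (divides 3 refl) 4≤x _ v L size U = realizable⇔admissible 4≤x size U table6 complete6 valid6
theorem4p4 _ (divides 4 refl) 4≤x _ v L size U = realizable⇔admissible 4≤x size U table8 complete8 valid8
theorem4p4 _ (divides 5 refl) 4≤x _ v L size U = realizable⇔admissible 4≤x size U table10 complete10 valid10
theorem4p4 _ (divides 6 refl) 4≤x _ v L size U = realizable⇔admissible 4≤x size U table12 complete12 valid12
-- Quotients from 7 on give `x ≥ 14`; the bound `13 ≤ x` suffices, being `12 < x`.
theorem4p4 _ (divides (suc (suc (suc (suc (suc (suc (suc q))))))) refl) _ x≤12 =
  contradiction x≤12 (<⇒≱ (m≤m+n 13 _))
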